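{- The system $\mathsf{RCA}_0^\omega$ proves $\mathsf{HBC}_0\to\mathsf{NIN}$, where $\mathsf{HBC}_0$ is the statement: for every countable $A\subset\mathbb{R}^2$ with $(\forall x\in[0,1])(\exists(a,b)\in A)(x\in(a,b))$, there are $(a_0,b_0),\dots,(a_k,b_k)\in A$ with $(\forall x\in[0,1])(\exists i\le k)(x\in(a_i,b_i))$; and $\mathsf{NIN}$ is the statement: for any $Y:[0,1]\to\mathbb{N}$ there are $x,y\in[0,1]$ with $x\neq_{\mathbb{R}}y$ and $Y(x)=Y(y)$.
   Context: Finite types: $0$ is a type (natural numbers), and if $\sigma,\tau$ are types then so is $\sigma\to\tau$; $1:=0\to 0$ and $n+1:=n\to 0$; superscripts indicate types. $\mathsf{L}_\omega$ is the many-sorted language with variables of every finite type, constants $0,1,<_0,+_0,\times_0,=_0$ (with usual meaning), typed combinators $\Pi,\Sigma$, and recursor constants $\mathbf{R}_\sigma$. For $\tau=(\tau_1\to\dots\to\tau_k\to 0)$, $x=_\tau y$ abbreviates $\forall z_1^{\tau_1}\dots z_k^{\tau_k}(xz_1\dots z_k=_0 yz_1\dots z_k)$. $\mathsf{QF\text{ - }AC}^{\sigma,\tau}$ is the schema $(\forall x^\sigma)(\exists y^\tau)A(x,y)\to(\exists Y^{\sigma\to\tau})(\forall x^\sigma)A(x,Y(x))$ for quantifier-free $A$ of $\mathsf{L}_\omega$. $\mathsf{RCA}_0^\omega$ (Kohlenbach's base theory, classical logic) has the following axioms: ordered semi-ring axioms for $0,1,<_0,+_0,\times_0$; defining axioms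 of $\Pi,\Sigma$ (giving $\lambda$-abstraction); $\mathbf{R}_0(f,m,0)=m$ and $\mathbf{R}_0(f,m,n+1)=f(n,\mathbf{R}_0(f,m,n))$; extensionality $x=_\rho y\to\varphi(x)=_\tau\varphi(y)$ for all types $\rho,\tau$; induction for quantifier-free formulas of $\mathsf{L}_\omega$; and $\mathsf{QF\text{ - }AC}^{1,0}$. Finite sequences are coded as usual. Inside this theory a real is a sequence of rationals $(q_n)$ with $|q_n-q_{n+i}|<2^{ -n}$ for all $n,i$; reals $x,y$ represented by $(q_n),(r_n)$ satisfy $x=_{\mathbb{R}}y$ iff $|q_n-r_n|\le 2^{ -n+1}$ for all $n$. Functions on $[0,1]$, $\mathbb{R}$ or $\mathbb{R}^2$ with values in $\mathbb{N}$ or $\mathbb{R}$ are objects of the corresponding finite type that map $=_{\mathbb{R}}$-equal arguments to equal values. Subsets of $\mathbb{R}$ or $\mathbb{R}^2$ are given by characteristic functions. A set $A\subseteq\mathbb{R}$ is countable if there is $Y:\mathbb{R}\to\mathbb{N}$ with $(\forall x,y\in A)(Y(x)=Y(y)\to x=_{\mathbb{R}}y)$, and similarly for $A\subseteq\mathbb{R}^2$ with $Y:\mathbb{R}^2\to\mathbb{N}$. -}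

module Defs where

open import Data.List using (List; []; _∷_; map)
open import Data.List.Membership.Propositional using (_∈_)
open import Data.List.Relation.Unary.Any using (here; there)
open import Data.Nat using (ℕ; zero; suc)
open import Relation.Binary.PropositionalEquality using (refl)

infixr 7 _⇾_
infixl 9 _·_
infixl 8 _⊠_
infixl 7 _⊞_ _∸ᵗ_
infix  6 _≐_ _≺_ _≼_
infix  5.5 ~_
infixr 5 _∧_
infixr 4 _∨_
infixr 3 _⇒_
infix  2 _∣_⊢_ RCA₀ω⊢_

------------------------------------------------------------------------
-- The language L_ω

data Ty : Set where
  o   : Ty
  _⇾_ : Ty → Ty → Ty

pure : ℕ → Ty
pure zero    = o
pure (suc n) = pure n ⇾ o

Cxt : Set
Cxt = List Ty

-- Equality and order at type 0 are the relation symbols of the formulas below.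
data Con : Ty → Set where
  O I : Con o
  plus times : Con (o ⇾ o ⇾ o)
  Π : ∀ σ τ → Con (σ ⇾ τ ⇾ σ)
  Σ : ∀ ρ σ τ → Con ((ρ ⇾ σ ⇾ τ) ⇾ (ρ ⇾ σ) ⇾ ρ ⇾ τ)
  R : ∀ σ → Con ((o ⇾ σ ⇾ σ) ⇾ σ ⇾ o ⇾ σ)

data Tm (Γ : Cxt) : Ty → Set where
  var : ∀ {σ} → σ ∈ Γ → Tm Γ σ
  con : ∀ {σ} → Con σ → Tm Γ σ
  _·_ : ∀ {σ τ} → Tm Γ (σ ⇾ τ) → Tm Γ σ → Tm Γ τ

data Fm (Γ : Cxt) : Set where
  _≐_ _≺_     : Tm Γ o → Tm Γ o → Fm Γ
  ⊥           : Fm Γ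
  _∧_ _∨_ _⇒_ : Fm Γ → Fm Γ → Fm Γ
  all ex      : ∀ σ → Fm (σ ∷ Γ) → Fm Γ

data QF {Γ : Cxt} : Fm Γ → Set where
  _≐_ : ∀ s t → QF (s ≐ t)
  _≺_ : ∀ s t → QF (s ≺ t)
  ⊥   : QF ⊥
  _∧_ : ∀ {A B} → QF A → QF B → QF (A ∧ B)
  _∨_ : ∀ {A B} → QF A → QF B → QF (A ∨ B)
  _⇒_ : ∀ {A B} → QF A → QF B → QF (A ⇒ B)

~_ : ∀ {Γ} → Fm Γ → Fm Γ
~ A = A ⇒ ⊥

------------------------------------------------------------------------
-- Renaming and substitution

Ren Sub : Cxt → Cxt → Set
Ren Γ Δ = ∀ {σ} → σ ∈ Γ → σ ∈ Δ
Sub Γ Δ = ∀ {σ} → σ ∈ Γ → Tm Δ σ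

renTm : ∀ {Γ Δ τ} → Ren Γ Δ → Tm Γ τ → Tm Δ τ
renTm r (var x) = var (r x)
renTm r (con c) = con c
renTm r (s · t) = renTm r s · renTm r t

subTm : ∀ {Γ Δ τ} → Sub Γ Δ → Tm Γ τ → Tm Δ τ
subTm f (var x) = f x
subTm f (con c) = con c
subTm f (s · t) = subTm f s · subTm f t

wk : ∀ {Γ σ τ} → Tm Γ τ → Tm (σ ∷ Γ) τ
wk = renTm there

infixr 5 _▸_
_▸_ : ∀ {Γ Δ τ} → Tm Δ τ → Sub Γ Δ → Sub (τ ∷ Γ) Δ
(t ▸ f) (here refl) = t
(t ▸ f) (there x)   = f x

lift : ∀ {Γ Δ τ} → Sub Γ Δ → Sub (τ ∷ Γ) (τ ∷ Δ)
lift f = var (here refl) ▸ λ x → wk (f x)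

subFm : ∀ {Γ Δ} → Sub Γ Δ → Fm Γ → Fm Δ
subFm f (s ≐ t)   = subTm f s ≐ subTm f t
subFm f (s ≺ t)   = subTm f s ≺ subTm f t
subFm f ⊥         = ⊥
subFm f (A ∧ B)   = subFm f A ∧ subFm f B
subFm f (A ∨ B)   = subFm f A ∨ subFm f B
subFm f (A ⇒ B)   = subFm f A ⇒ subFm f B
subFm f (all σ A) = all σ (subFm (lift f) A)
subFm f (ex σ A)  = ex σ (subFm (lift f) A)

wkFm : ∀ {Γ σ} → Fm Γ → Fm (σ ∷ Γ)
wkFm = subFm (λ x → var (there x))

_[_] : ∀ {Γ σ} → Fm (σ ∷ Γ) → Tm Γ σ → Fm Γ
A [ t ] = subFm (t ▸ var) A

v0 : ∀ {Γ σ₀} → Tm (σ₀ ∷ Γ) σ₀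
v0 = var (here refl)

v1 : ∀ {Γ σ₀ σ₁} → Tm (σ₀ ∷ σ₁ ∷ Γ) σ₁
v1 = wk v0

v2 : ∀ {Γ σ₀ σ₁ σ₂} → Tm (σ₀ ∷ σ₁ ∷ σ₂ ∷ Γ) σ₂
v2 = wk v1

v3 : ∀ {Γ σ₀ σ₁ σ₂ σ₃} → Tm (σ₀ ∷ σ₁ ∷ σ₂ ∷ σ₃ ∷ Γ) σ₃
v3 = wk v2

------------------------------------------------------------------------
-- Terms and abbreviations of L_ω

-- λ-abstraction, by the usual bracket abstraction.
lam : ∀ {Γ σ τ} → Tm (σ ∷ Γ) τ → Tm Γ (σ ⇾ τ)
lam {σ = σ} (var (here refl))     = con (Σ σ (σ ⇾ σ) σ) · con (Π σ (σ ⇾ σ)) · con (Π σ σ)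
lam {σ = σ} {τ} (var (there x))   = con (Π τ σ) · var x
lam {σ = σ} {τ} (con c)           = con (Π τ σ) · con c
lam {σ = σ} {τ} (_·_ {σ = ρ} s t) = con (Σ σ ρ τ) · lam s · lam t

𝟎 𝟏 : ∀ {Γ} → Tm Γ o
𝟎 = con O
𝟏 = con I

_⊞_ _⊠_ : ∀ {Γ} → Tm Γ o → Tm Γ o → Tm Γ o
s ⊞ t = con plus · s · t
s ⊠ t = con times · s · t

_≼_ : ∀ {Γ} → Tm Γ o → Tm Γ o → Fm Γ
s ≼ t = (s ≺ t) ∨ (s ≐ t)

eq : ∀ {Γ} τ → Tm Γ τ → Tm Γ τ → Fm Γ
eq o       x y = x ≐ y
eq (σ ⇾ τ) x y = all σ (eq τ (wk x · v0) (wk y · v0))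

------------------------------------------------------------------------
-- The theory RCA₀^ω.  Axioms may contain free variables and terms for their
-- universally quantified variables.

data Axiom {Γ : Cxt} : Fm Γ → Set where
  +-assoc     : ∀ r s t → Axiom ((r ⊞ s) ⊞ t ≐ r ⊞ (s ⊞ t))
  +-comm      : ∀ s t → Axiom (s ⊞ t ≐ t ⊞ s)
  +-identity  : ∀ t → Axiom (t ⊞ 𝟎 ≐ t)
  *-assoc     : ∀ r s t → Axiom ((r ⊠ s) ⊠ t ≐ r ⊠ (s ⊠ t))
  *-comm      : ∀ s t → Axiom (s ⊠ t ≐ t ⊠ s)
  *-identity  : ∀ t → Axiom (t ⊠ 𝟏 ≐ t)
  *-zero      : ∀ t → Axiom (t ⊠ 𝟎 ≐ 𝟎)
  *-distrib-+ : ∀ r s t → Axiom (r ⊠ (s ⊞ t) ≐ r ⊠ s ⊞ r ⊠ t)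
  ≺-irrefl    : ∀ t → Axiom (~ (t ≺ t))
  ≺-trans     : ∀ r s t → Axiom (r ≺ s ⇒ s ≺ t ⇒ r ≺ t)
  ≺-total     : ∀ s t → Axiom (s ≺ t ∨ s ≐ t ∨ t ≺ s)
  0≺1         : Axiom (𝟎 ≺ 𝟏)
  +-mono-≺    : ∀ r s t → Axiom (r ≺ s ⇒ r ⊞ t ≺ s ⊞ t)
  *-mono-≺    : ∀ r s t → Axiom (𝟎 ≺ t ⇒ r ≺ s ⇒ r ⊠ t ≺ s ⊠ t)
  Π-def       : ∀ {σ τ} (x : Tm Γ σ) (y : Tm Γ τ) → Axiom (eq σ (con (Π σ τ) · x · y) x)
  Σ-def       : ∀ {ρ σ τ} (x : Tm Γ (ρ ⇾ σ ⇾ τ)) (y : Tm Γ (ρ ⇾ σ)) (z : Tm Γ ρ) →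
                Axiom (eq τ (con (Σ ρ σ τ) · x · y · z) (x · z · (y · z)))
  R₀-zero     : ∀ f m → Axiom (con (R o) · f · m · 𝟎 ≐ m)
  R₀-suc      : ∀ f m n → Axiom (con (R o) · f · m · (n ⊞ 𝟏) ≐ f · n · (con (R o) · f · m · n))
  ext         : ∀ {ρ τ} (x y : Tm Γ ρ) (φ : Tm Γ (ρ ⇾ τ)) →
                Axiom (eq ρ x y ⇒ eq τ (φ · x) (φ · y))
  QF-ind      : ∀ {A : Fm (o ∷ Γ)} → QF A →
                Axiom (A [ 𝟎 ] ⇒
                       all o (A ⇒ subFm (v0 ⊞ 𝟏 ▸ λ x → var (there x)) A) ⇒
                       all o A)
  -- A has y (type 0) as its first free variable and x (type 1) as its second.
  QF-AC¹⁰     : ∀ {A : Fm (o ∷ pure 1 ∷ Γ)} → QF A →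
                Axiom (all (pure 1) (ex o A) ⇒
                       ex (pure 1 ⇾ o) (all (pure 1)
                         (subFm (v1 · v0 ▸ v0 ▸ λ x → var (there (there x))) A)))

-- Derivability in RCA₀^ω: classical natural deduction with equality.
data _∣_⊢_ (Γ : Cxt) (Δ : List (Fm Γ)) : Fm Γ → Set where
  ax      : ∀ {A} → Axiom A → Γ ∣ Δ ⊢ A
  hyp     : ∀ {A} → A ∈ Δ → Γ ∣ Δ ⊢ A
  ⇒-intro : ∀ {A B} → Γ ∣ A ∷ Δ ⊢ B → Γ ∣ Δ ⊢ A ⇒ B
  ⇒-elim  : ∀ {A B} → Γ ∣ Δ ⊢ A ⇒ B → Γ ∣ Δ ⊢ A → Γ ∣ Δ ⊢ B
  ∧-intro : ∀ {A B} → Γ ∣ Δ ⊢ A → Γ ∣ Δ ⊢ B → Γ ∣ Δ ⊢ A ∧ B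
  ∧-elim₁ : ∀ {A B} → Γ ∣ Δ ⊢ A ∧ B → Γ ∣ Δ ⊢ A
  ∧-elim₂ : ∀ {A B} → Γ ∣ Δ ⊢ A ∧ B → Γ ∣ Δ ⊢ B
  ∨-intro₁ : ∀ {A B} → Γ ∣ Δ ⊢ A → Γ ∣ Δ ⊢ A ∨ B
  ∨-intro₂ : ∀ {A B} → Γ ∣ Δ ⊢ B → Γ ∣ Δ ⊢ A ∨ B
  ∨-elim  : ∀ {A B C} → Γ ∣ Δ ⊢ A ∨ B → Γ ∣ A ∷ Δ ⊢ C → Γ ∣ B ∷ Δ ⊢ C → Γ ∣ Δ ⊢ C
  raa     : ∀ {A} → Γ ∣ (~ A) ∷ Δ ⊢ ⊥ → Γ ∣ Δ ⊢ A
  ∀-intro : ∀ {σ} {A : Fm (σ ∷ Γ)} → σ ∷ Γ ∣ map wkFm Δ ⊢ A → Γ ∣ Δ ⊢ all σ A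
  ∀-elim  : ∀ {σ} {A : Fm (σ ∷ Γ)} → Γ ∣ Δ ⊢ all σ A → (t : Tm Γ σ) → Γ ∣ Δ ⊢ A [ t ]
  ∃-intro : ∀ {σ} {A : Fm (σ ∷ Γ)} (t : Tm Γ σ) → Γ ∣ Δ ⊢ A [ t ] → Γ ∣ Δ ⊢ ex σ A
  ∃-elim  : ∀ {σ} {A : Fm (σ ∷ Γ)} {C} →
            Γ ∣ Δ ⊢ ex σ A → σ ∷ Γ ∣ A ∷ map wkFm Δ ⊢ wkFm C → Γ ∣ Δ ⊢ C
  ≐-refl  : ∀ t → Γ ∣ Δ ⊢ t ≐ t
  ≐-subst : ∀ (A : Fm (o ∷ Γ)) {s t} → Γ ∣ Δ ⊢ s ≐ t → Γ ∣ Δ ⊢ A [ s ] → Γ ∣ Δ ⊢ A [ t ]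

RCA₀ω⊢_ : Fm [] → Set
RCA₀ω⊢ A = [] ∣ [] ⊢ A

------------------------------------------------------------------------
-- Coding of pairs and rationals

pred : ∀ {Γ} → Tm Γ o → Tm Γ o
pred t = con (R o) · lam (lam v1) · 𝟎 · t

_∸ᵗ_ : ∀ {Γ} → Tm Γ o → Tm Γ o → Tm Γ o
s ∸ᵗ t = con (R o) · lam (lam (pred v0)) · s · t

2^_ : ∀ {Γ} → Tm Γ o → Tm Γ o
2^ t = con (R o) · lam (lam (v0 ⊞ v0)) · 𝟏 · t

-- ⌊√t⌋: the value s at n is increased at n + 1 iff (s + 1)² ≤ n + 1.
sqrt : ∀ {Γ} → Tm Γ o → Tm Γ o
sqrt t = con (R o)
       · lam (lam (v0 ⊞ (𝟏 ∸ᵗ ((v0 ⊞ 𝟏) ⊠ (v0 ⊞ 𝟏) ∸ᵗ (v1 ⊞ 𝟏)))))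
       · 𝟎 · t

-- The pairing (s , t) ↦ (s + t)² + s, and its projections.
pair : ∀ {Γ} → Tm Γ o → Tm Γ o → Tm Γ o
pair s t = (s ⊞ t) ⊠ (s ⊞ t) ⊞ s

fst snd : ∀ {Γ} → Tm Γ o → Tm Γ o
fst t = t ∸ᵗ sqrt t ⊠ sqrt t
snd t = sqrt t ∸ᵗ fst t

-- The rational (pos − neg) / den, for a term den with positive values.
record Frac (Γ : Cxt) : Set where
  constructor frac
  field pos neg den : Tm Γ o

-- Every number codes a rational: pair (pair a b) c codes (a − b) / (c + 1).
⟪_⟫ : ∀ {Γ} → Tm Γ o → Frac Γ
⟪ q ⟫ = frac (fst (fst q)) (snd (fst q)) (snd q ⊞ 𝟏)

infixl 7 _-Q_
infix  6 _<Q_ _≤Q_ ∣_∣<Q_ ∣_∣≤Q_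

-Q_ : ∀ {Γ} → Frac Γ → Frac Γ
-Q frac a b d = frac b a d

_-Q_ : ∀ {Γ} → Frac Γ → Frac Γ → Frac Γ
frac a b d -Q frac a′ b′ d′ = frac (a ⊠ d′ ⊞ b′ ⊠ d) (b ⊠ d′ ⊞ a′ ⊠ d) (d ⊠ d′)

_<Q_ _≤Q_ ∣_∣<Q_ ∣_∣≤Q_ : ∀ {Γ} → Frac Γ → Frac Γ → Fm Γ
frac a b d <Q frac a′ b′ d′ = a ⊠ d′ ⊞ b′ ⊠ d ≺ a′ ⊠ d ⊞ b ⊠ d′
frac a b d ≤Q frac a′ b′ d′ = a ⊠ d′ ⊞ b′ ⊠ d ≼ a′ ⊠ d ⊞ b ⊠ d′
∣ x ∣<Q y = x <Q y ∧ (-Q x) <Q y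
∣ x ∣≤Q y = x ≤Q y ∧ (-Q x) ≤Q y

2^-_ 2^1-_ : ∀ {Γ} → Tm Γ o → Frac Γ
2^-  n = frac 𝟏 𝟎 (2^ n)
2^1- n = frac (𝟏 ⊞ 𝟏) 𝟎 (2^ n)

------------------------------------------------------------------------
-- Reals

T1 : Ty
T1 = pure 1

isReal : ∀ {Γ} → Tm Γ T1 → Fm Γ
isReal x = all o (all o (∣ ⟪ q · v1 ⟫ -Q ⟪ q · (v1 ⊞ v0) ⟫ ∣<Q 2^- v1))
  where q = wk (wk x)

_=ℝ_ _≤ℝ_ _<ℝ_ : ∀ {Γ} → Tm Γ T1 → Tm Γ T1 → Fm Γ
x =ℝ y = all o (∣ ⟪ wk x · v0 ⟫ -Q ⟪ wk y · v0 ⟫ ∣≤Q 2^1- v0)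
x ≤ℝ y = all o (⟪ wk x · v0 ⟫ -Q ⟪ wk y · v0 ⟫ ≤Q 2^1- v0)
x <ℝ y = ~ (y ≤ℝ x)

infix 6 _=ℝ_ _≤ℝ_ _<ℝ_

0ℝ 1ℝ : ∀ {Γ} → Tm Γ T1
0ℝ = lam (pair (pair 𝟎 𝟎) 𝟎)
1ℝ = lam (pair (pair 𝟏 𝟎) 𝟎)

in01 : ∀ {Γ} → Tm Γ T1 → Fm Γ
in01 x = isReal x ∧ 0ℝ ≤ℝ x ∧ x ≤ℝ 1ℝ

------------------------------------------------------------------------
-- Functions [0,1] → ℕ and ℝ² → ℕ, subsets of ℝ²

isFun[01→ℕ] : ∀ {Γ} → Tm Γ (T1 ⇾ o) → Fm Γ
isFun[01→ℕ] F = all T1 (all T1 (in01 v1 ∧ in01 v0 ∧ v1 =ℝ v0 ⇒ G · v1 ≐ G · v0))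
  where G = wk (wk F)

T1² : Ty
T1² = T1 ⇾ T1 ⇾ o

isFun[ℝ²→ℕ] : ∀ {Γ} → Tm Γ T1² → Fm Γ
isFun[ℝ²→ℕ] F = all T1 (all T1 (all T1 (all T1
    ((isReal v3 ∧ isReal v2) ∧ (isReal v1 ∧ isReal v0) ∧ (v3 =ℝ v1 ∧ v2 =ℝ v0)
      ⇒ G · v3 · v2 ≐ G · v1 · v0))))
  where G = wk (wk (wk (wk F)))

isSubset[ℝ²] : ∀ {Γ} → Tm Γ T1² → Fm Γ
isSubset[ℝ²] F = isFun[ℝ²→ℕ] F ∧
    all T1 (all T1 (isReal v1 ∧ isReal v0 ⇒ G · v1 · v0 ≐ 𝟎 ∨ G · v1 · v0 ≐ 𝟏))
  where G = wk (wk F)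

⟨_,_⟩∈_ : ∀ {Γ} → Tm Γ T1 → Tm Γ T1 → Tm Γ T1² → Fm Γ
⟨ a , b ⟩∈ A = isReal a ∧ isReal b ∧ A · a · b ≐ 𝟏

infix 6 ⟨_,_⟩∈_

isCountable : ∀ {Γ} → Tm Γ T1² → Fm Γ
isCountable A = ex T1² (isFun[ℝ²→ℕ] v0 ∧
    all T1 (all T1 (all T1 (all T1
      (⟨ v3 , v2 ⟩∈ B ∧ ⟨ v1 , v0 ⟩∈ B ⇒ Y · v3 · v2 ≐ Y · v1 · v0
        ⇒ v3 =ℝ v1 ∧ v2 =ℝ v0)))))
  where
  B = wk (wk (wk (wk (wk A))))
  Y = wk (wk (wk (wk v0)))

_∈⦅_,_⦆ : ∀ {Γ} → Tm Γ T1 → Tm Γ T1 → Tm Γ T1 → Fm Γ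
x ∈⦅ a , b ⦆ = a <ℝ x ∧ x <ℝ b

infix 6 _∈⦅_,_⦆

------------------------------------------------------------------------
-- The principles

covers01 : ∀ {Γ} → Tm Γ T1² → Fm Γ
covers01 A = all T1 (in01 v0 ⇒
  ex T1 (ex T1 (⟨ v1 , v0 ⟩∈ wk (wk (wk A)) ∧ v2 ∈⦅ v1 , v0 ⦆)))

-- The pairs (a₀,b₀), …, (a_k,b_k) are given by k and two sequences of type
-- 0 → 1, of which only the values up to k matter.
hasFiniteSubcover : ∀ {Γ} → Tm Γ T1² → Fm Γ
hasFiniteSubcover A = ex o (ex (o ⇾ T1) (ex (o ⇾ T1) (
    all o (v0 ≼ v3 ⇒ ⟨ v2 · v0 , v1 · v0 ⟩∈ wk (wk (wk (wk A))))
  ∧ all T1 (in01 v0 ⇒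
      ex o (v0 ≼ wk v3 ∧ v1 ∈⦅ v3 · v0 , v2 · v0 ⦆)))))

HBC₀ : Fm []
HBC₀ = all T1² (isSubset[ℝ²] v0 ∧ isCountable v0 ∧ covers01 v0 ⇒ hasFiniteSubcover v0)

NIN : Fm []
NIN = all (T1 ⇾ o) (isFun[01→ℕ] v0 ⇒
  ex T1 (ex T1 (in01 v1 ∧ in01 v0 ∧ ~ (v1 =ℝ v0) ∧ v2 · v1 ≐ v2 · v0)))

{-# OPTIONS --safe #-}

-- Let Y be injective on [0,1].  Comparing the values of Y at ∑ₙ sg (f n) 2⁻ⁿ⁻¹ and at 0
-- decides whether f vanishes identically, so every arithmetical formula has a
-- characteristic term, and arithmetical induction and comprehension become available.
-- Let A consist of the (a,b) with a = x - ε and b = x + ε, where x = (a + b)/2 lies in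
-- [0,1] and ε = 4^-(Y x + 1).  The intervals in A cover [0,1], and A is countable
-- since (a,b) is determined by Y x.  Given finitely many of them, one finds by induction
-- on m an interval [c/4^m , (c + 1)/4^m] that misses all those with Y x < m: there is at
-- most one with Y x = m, and it is too short to meet both outer quarters of the previous
-- interval.  For large m the point c/4^m is not covered.

module Submission where

-- The obstacle is the weakness of the base theory: its induction covers quantifier-free formulas
-- only, while equality and order of reals hide a universal quantifier over indices. Neither the
-- characteristic function of A nor the induction on m is available outright; the injection, assumed
-- towards a contradiction, is what supplies both.
--
-- What becomes available this way is arithmetical, so no formula may quantify over reals.
-- Membership in A therefore does not say that some x exists: it speaks of the midpoint of (a,b),
-- which is x up to equality of reals.
--
-- The radius is chosen so that an interval with Y-value m is two cells of size 4^-(m+1) long. This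
-- is exactly the gap between the closed outer quarters of a cell of size 4^-m, and the interval is
-- open, so it cannot meet both.
--
-- Working with derivations as data adds a second obstacle: statements about reals unfold to huge
-- terms. Hence lemmas are derived for variables and instantiated afterwards, predicates on reals
-- are atoms of a second syntax, and the functionals of the proof are variables of the context.

open import Defs
open import Algebra.Bundles using (CommutativeMonoid; CommutativeSemiring)
import Algebra.Solver.CommutativeMonoid as MonoidSolver
import Algebra.Solver.Ring.NaturalCoefficients.Default as SemiringSolver
open import Data.List using (List; []; _∷_; map)
open import Data.List.Membership.Propositional using (_∈_)
open import Data.List.Membership.Propositional.Properties using (∈-map⁺; ∈-map⁻)
open import Data.List.Relation.Unary.All using (All; []; _∷_)
open import Data.List.Relation.Unary.Any using (here; there)
open import Data.Maybe using (Maybe; just; nothing; From-just; from-just)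
open import Data.Product using (_×_; _,_; proj₁; proj₂)
open import Relation.Binary.PropositionalEquality
  using (_≡_; refl; sym; trans; cong; cong₂; subst; subst₂)

-- Substitution in terms, formulas, axioms and derivations.

module Substitution where

  private variable
    Γ Γ′ Γ″ : Cxt
    Δ Δ′ : List (Fm Γ)
    A B C : Fm Γ
    ρ σ τ : Ty

  subTm-cong : {f g : Sub Γ Γ′} → (∀ {σ} (x : σ ∈ Γ) → f x ≡ g x) →
               (t : Tm Γ τ) → subTm f t ≡ subTm g t
  subTm-cong h (var x) = h x
  subTm-cong h (con c) = refl
  subTm-cong h (s · t) = cong₂ _·_ (subTm-cong h s) (subTm-cong h t)

  lift-cong : {f g : Sub Γ Γ′} → (∀ {σ} (x : σ ∈ Γ) → f x ≡ g x) →
              ∀ {σ τ} (x : σ ∈ τ ∷ Γ) → lift f x ≡ lift g x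
  lift-cong h (here refl) = refl
  lift-cong h (there x)   = cong wk (h x)

  subFm-cong : {f g : Sub Γ Γ′} → (∀ {σ} (x : σ ∈ Γ) → f x ≡ g x) →
               (A : Fm Γ) → subFm f A ≡ subFm g A
  subFm-cong h (s ≐ t)   = cong₂ _≐_ (subTm-cong h s) (subTm-cong h t)
  subFm-cong h (s ≺ t)   = cong₂ _≺_ (subTm-cong h s) (subTm-cong h t)
  subFm-cong h ⊥         = refl
  subFm-cong h (A ∧ B)   = cong₂ _∧_ (subFm-cong h A) (subFm-cong h B)
  subFm-cong h (A ∨ B)   = cong₂ _∨_ (subFm-cong h A) (subFm-cong h B)
  subFm-cong h (A ⇒ B)   = cong₂ _⇒_ (subFm-cong h A) (subFm-cong h B)
  subFm-cong h (all σ A) = cong (all σ) (subFm-cong (lift-cong h) A)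
  subFm-cong h (ex σ A)  = cong (ex σ) (subFm-cong (lift-cong h) A)

  subTm-ren : (g : Sub Γ′ Γ″) (r : Ren Γ Γ′) (t : Tm Γ τ) →
              subTm g (renTm r t) ≡ subTm (λ x → g (r x)) t
  subTm-ren g r (var x) = refl
  subTm-ren g r (con c) = refl
  subTm-ren g r (s · t) = cong₂ _·_ (subTm-ren g r s) (subTm-ren g r t)

  renTm-sub : (r : Ren Γ′ Γ″) (f : Sub Γ Γ′) (t : Tm Γ τ) →
              renTm r (subTm f t) ≡ subTm (λ x → renTm r (f x)) t
  renTm-sub r f (var x) = refl
  renTm-sub r f (con c) = refl
  renTm-sub r f (s · t) = cong₂ _·_ (renTm-sub r f s) (renTm-sub r f t)

  subTm-id : {f : Sub Γ Γ} → (∀ {σ} (x : σ ∈ Γ) → f x ≡ var x) → (t : Tm Γ τ) → subTm f t ≡ t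
  subTm-id h (var x) = h x
  subTm-id h (con c) = refl
  subTm-id h (s · t) = cong₂ _·_ (subTm-id h s) (subTm-id h t)

  lift-id : {f : Sub Γ Γ} → (∀ {σ} (x : σ ∈ Γ) → f x ≡ var x) →
            ∀ {σ τ} (x : σ ∈ τ ∷ Γ) → lift f x ≡ var x
  lift-id h (here refl) = refl
  lift-id h (there x)   = cong wk (h x)

  subFm-id : {f : Sub Γ Γ} → (∀ {σ} (x : σ ∈ Γ) → f x ≡ var x) → (A : Fm Γ) → subFm f A ≡ A
  subFm-id h (s ≐ t)   = cong₂ _≐_ (subTm-id h s) (subTm-id h t)
  subFm-id h (s ≺ t)   = cong₂ _≺_ (subTm-id h s) (subTm-id h t)
  subFm-id h ⊥         = refl
  subFm-id h (A ∧ B)   = cong₂ _∧_ (subFm-id h A) (subFm-id h B)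
  subFm-id h (A ∨ B)   = cong₂ _∨_ (subFm-id h A) (subFm-id h B)
  subFm-id h (A ⇒ B)   = cong₂ _⇒_ (subFm-id h A) (subFm-id h B)
  subFm-id h (all σ A) = cong (all σ) (subFm-id (lift-id h) A)
  subFm-id h (ex σ A)  = cong (ex σ) (subFm-id (lift-id h) A)

  lift-wk : (f : Sub Γ Γ′) (t : Tm Γ τ) → subTm (lift {τ = σ} f) (wk t) ≡ wk (subTm f t)
  lift-wk f t = trans (subTm-ren (lift f) there t) (sym (renTm-sub there f t))

  subTm-sub : (g : Sub Γ′ Γ″) (f : Sub Γ Γ′) (t : Tm Γ τ) →
              subTm g (subTm f t) ≡ subTm (λ x → subTm g (f x)) t
  subTm-sub g f (var x) = refl
  subTm-sub g f (con c) = refl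
  subTm-sub g f (s · t) = cong₂ _·_ (subTm-sub g f s) (subTm-sub g f t)

  lift-sub : (g : Sub Γ′ Γ″) (f : Sub Γ Γ′) → ∀ {σ τ} (x : σ ∈ τ ∷ Γ) →
             subTm (lift g) (lift f x) ≡ lift (λ y → subTm g (f y)) x
  lift-sub g f (here refl) = refl
  lift-sub g f (there x)   = lift-wk g (f x)

  subFm-sub : (g : Sub Γ′ Γ″) (f : Sub Γ Γ′) (A : Fm Γ) →
              subFm g (subFm f A) ≡ subFm (λ x → subTm g (f x)) A
  subFm-sub g f (s ≐ t)   = cong₂ _≐_ (subTm-sub g f s) (subTm-sub g f t)
  subFm-sub g f (s ≺ t)   = cong₂ _≺_ (subTm-sub g f s) (subTm-sub g f t)
  subFm-sub g f ⊥         = refl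
  subFm-sub g f (A ∧ B)   = cong₂ _∧_ (subFm-sub g f A) (subFm-sub g f B)
  subFm-sub g f (A ∨ B)   = cong₂ _∨_ (subFm-sub g f A) (subFm-sub g f B)
  subFm-sub g f (A ⇒ B)   = cong₂ _⇒_ (subFm-sub g f A) (subFm-sub g f B)
  subFm-sub g f (all σ A) =
    cong (all σ) (trans (subFm-sub (lift g) (lift f) A) (subFm-cong (lift-sub g f) A))
  subFm-sub g f (ex σ A) =
    cong (ex σ) (trans (subFm-sub (lift g) (lift f) A) (subFm-cong (lift-sub g f) A))

  -- Commutation of substitutions with each other reduces to this criterion, in which only variables
  -- have to be inspected.
  subFm-square : {g : Sub Γ′ Γ″} {f : Sub Γ Γ′} {Γ‴ : Cxt} {g′ : Sub Γ‴ Γ″} {f′ : Sub Γ Γ‴} →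
                 (∀ {σ} (x : σ ∈ Γ) → subTm g (f x) ≡ subTm g′ (f′ x)) → (A : Fm Γ) →
                 subFm g (subFm f A) ≡ subFm g′ (subFm f′ A)
  subFm-square {g = g} {f} {g′ = g′} {f′} h A =
    trans (subFm-sub g f A) (trans (subFm-cong h A) (sym (subFm-sub g′ f′ A)))

  wk-[] : (s : Tm Γ σ) (t : Tm Γ τ) → subTm (s ▸ var) (wk t) ≡ t
  wk-[] s t = trans (subTm-ren (s ▸ var) there t) (subTm-id (λ _ → refl) t)

  wk-▸ : (f : Sub Γ Γ′) (s : Tm Γ′ σ) (t : Tm Γ τ) → subTm (s ▸ f) (wk t) ≡ subTm f t
  wk-▸ f s t = subTm-ren (s ▸ f) there t

  lift-wkFm : (f : Sub Γ Γ′) (A : Fm Γ) → subFm (lift {τ = σ} f) (wkFm A) ≡ wkFm (subFm f A)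
  lift-wkFm f = subFm-square λ x → renTm-var (f x)
    where
    renTm-var : (t : Tm Γ τ) → wk {σ = σ} t ≡ subTm (λ x → var (there x)) t
    renTm-var (var x) = refl
    renTm-var (con c) = refl
    renTm-var (s · t) = cong₂ _·_ (renTm-var s) (renTm-var t)

  sub-[] : (f : Sub Γ Γ′) (A : Fm (σ ∷ Γ)) (t : Tm Γ σ) →
           subFm f (A [ t ]) ≡ subFm (lift f) A [ subTm f t ]
  sub-[] f A t = subFm-square h A
    where
    h : ∀ {ρ} (x : ρ ∈ _ ∷ _) → subTm f ((t ▸ var) x) ≡ subTm (subTm f t ▸ var) (lift f x)
    h (here refl) = refl
    h (there x)   = sym (wk-[] (subTm f t) (f x))

  subFm-eq : (f : Sub Γ Γ′) (τ : Ty) (x y : Tm Γ τ) →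
             subFm f (eq τ x y) ≡ eq τ (subTm f x) (subTm f y)
  subFm-eq f o       x y = refl
  subFm-eq f (σ ⇾ τ) x y = cong (all σ) (trans (subFm-eq (lift f) τ _ _)
    (cong₂ (λ s t → eq τ (s · v0) (t · v0)) (lift-wk f x) (lift-wk f y)))

  QF-sub : (f : Sub Γ Γ′) → QF A → QF (subFm f A)
  QF-sub f (s ≐ t) = _ ≐ _
  QF-sub f (s ≺ t) = _ ≺ _
  QF-sub f ⊥       = ⊥
  QF-sub f (p ∧ q) = QF-sub f p ∧ QF-sub f q
  QF-sub f (p ∨ q) = QF-sub f p ∨ QF-sub f q
  QF-sub f (p ⇒ q) = QF-sub f p ⇒ QF-sub f q

  -- Most schemes are stable by computation. Those that mention `eq` are not, since `eq` recurses on
  -- its type, and `QF-ind` and `QF-AC¹⁰` contain substitutions of their own that have to be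
  -- commuted with `f`.
  Axiom-sub : (f : Sub Γ Γ′) → Axiom A → Axiom (subFm f A)
  Axiom-sub f (+-assoc r s t)     = +-assoc _ _ _
  Axiom-sub f (+-comm s t)        = +-comm _ _
  Axiom-sub f (+-identity t)      = +-identity _
  Axiom-sub f (*-assoc r s t)     = *-assoc _ _ _
  Axiom-sub f (*-comm s t)        = *-comm _ _
  Axiom-sub f (*-identity t)      = *-identity _
  Axiom-sub f (*-zero t)          = *-zero _
  Axiom-sub f (*-distrib-+ r s t) = *-distrib-+ _ _ _
  Axiom-sub f (≺-irrefl t)        = ≺-irrefl _
  Axiom-sub f (≺-trans r s t)     = ≺-trans _ _ _
  Axiom-sub f (≺-total s t)       = ≺-total _ _
  Axiom-sub f 0≺1                 = 0≺1
  Axiom-sub f (+-mono-≺ r s t)    = +-mono-≺ _ _ _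
  Axiom-sub f (*-mono-≺ r s t)    = *-mono-≺ _ _ _
  Axiom-sub f (Π-def {σ} x y)     = subst Axiom (sym (subFm-eq f σ _ _)) (Π-def _ _)
  Axiom-sub f (Σ-def {τ = τ} x y z) = subst Axiom (sym (subFm-eq f τ _ _)) (Σ-def _ _ _)
  Axiom-sub f (R₀-zero g m)       = R₀-zero _ _
  Axiom-sub f (R₀-suc g m n)      = R₀-suc _ _ _
  Axiom-sub f (ext {ρ} {τ} x y φ) =
    subst Axiom (sym (cong₂ _⇒_ (subFm-eq f ρ x y) (subFm-eq f τ _ _))) (ext _ _ _)
  Axiom-sub f (QF-ind {A} qf)     = subst Axiom
    (sym (cong₂ _⇒_ (sub-[] f A 𝟎) (cong (λ B → all o (subFm (lift f) A ⇒ B) ⇒ all o (subFm (lift f) A))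
      (subFm-square h A))))
    (QF-ind (QF-sub (lift f) qf))
    where
    h : ∀ {ρ} (x : ρ ∈ _ ∷ _) → subTm (lift f) ((v0 ⊞ 𝟏 ▸ λ y → var (there y)) x)
        ≡ subTm (v0 ⊞ 𝟏 ▸ λ y → var (there y)) (lift f x)
    h (here refl) = refl
    h (there x)   = trans (sym (lift-wkTm (f x))) (sym (wk-▸ _ _ (f x)))
      where
      lift-wkTm : ∀ {τ} (t : Tm Γ τ) → subTm (λ y → var (there {x = σ} y)) t ≡ wk t
      lift-wkTm (var x) = refl
      lift-wkTm (con c) = refl
      lift-wkTm (s · t) = cong₂ _·_ (lift-wkTm s) (lift-wkTm t)
  Axiom-sub f (QF-AC¹⁰ {A} qf)    = subst Axiom
    (cong (λ B → all (pure 1) (ex o (subFm (lift (lift f)) A)) ⇒ ex (pure 1 ⇾ o) (all (pure 1) B))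
      (sym (subFm-square h A)))
    (QF-AC¹⁰ (QF-sub (lift (lift f)) qf))
    where
    h : ∀ {ρ} (x : ρ ∈ _ ∷ _ ∷ _) →
        subTm (lift (lift f)) ((v1 · v0 ▸ v0 ▸ λ y → var (there (there y))) x)
        ≡ subTm (v1 · v0 ▸ v0 ▸ λ y → var (there (there y))) (lift (lift f) x)
    h (here refl)         = refl
    h (there (here refl)) = refl
    h (there (there x))   = trans (ww (f x)) (sym (trans (wk-▸ _ _ (wk (f x))) (wk-▸ _ _ (f x))))
      where
      ww : ∀ {τ} (t : Tm Γ τ) → wk {σ = ρ} (wk {σ = σ} t) ≡ subTm (λ y → var (there (there y))) t
      ww (var x) = refl
      ww (con c) = refl
      ww (s · t) = cong₂ _·_ (ww s) (ww t)

  -- Substituting terms and enlarging the list of hypotheses are treated in a single induction on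
  -- derivations; `weaken`, `wk⊢` and `inst` are all instances.
  sub⊢ : (f : Sub Γ Γ′) → (∀ {B} → B ∈ Δ → subFm f B ∈ Δ′) → Γ ∣ Δ ⊢ A → Γ′ ∣ Δ′ ⊢ subFm f A
  sub⊢-wk : (f : Sub Γ Γ′) → (∀ {B} → B ∈ Δ → subFm f B ∈ Δ′) →
            ∀ {B} → B ∈ map (wkFm {σ = σ}) Δ → subFm (lift f) B ∈ map wkFm Δ′
  sub⊢-wk f h i with ∈-map⁻ wkFm i
  ... | B , j , refl = subst (_∈ _) (sym (lift-wkFm f B)) (∈-map⁺ wkFm (h j))

  sub⊢-∷ : (f : Sub Γ Γ′) → (∀ {B} → B ∈ Δ → subFm f B ∈ Δ′) →
           ∀ {B} → B ∈ A ∷ Δ → subFm f B ∈ subFm f A ∷ Δ′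
  sub⊢-∷ f h (here refl) = here refl
  sub⊢-∷ f h (there i)   = there (h i)

  sub⊢ f h (ax a)            = ax (Axiom-sub f a)
  sub⊢ f h (hyp i)           = hyp (h i)
  sub⊢ f h (⇒-intro d)       = ⇒-intro (sub⊢ f (sub⊢-∷ f h) d)
  sub⊢ f h (⇒-elim d e)      = ⇒-elim (sub⊢ f h d) (sub⊢ f h e)
  sub⊢ f h (∧-intro d e)     = ∧-intro (sub⊢ f h d) (sub⊢ f h e)
  sub⊢ f h (∧-elim₁ d)       = ∧-elim₁ (sub⊢ f h d)
  sub⊢ f h (∧-elim₂ d)       = ∧-elim₂ (sub⊢ f h d)
  sub⊢ f h (∨-intro₁ d)      = ∨-intro₁ (sub⊢ f h d)
  sub⊢ f h (∨-intro₂ d)      = ∨-intro₂ (sub⊢ f h d)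
  sub⊢ f h (∨-elim d e e′)   =
    ∨-elim (sub⊢ f h d) (sub⊢ f (sub⊢-∷ f h) e) (sub⊢ f (sub⊢-∷ f h) e′)
  sub⊢ f h (raa d)           = raa (sub⊢ f (sub⊢-∷ f h) d)
  sub⊢ f h (∀-intro d)       = ∀-intro (sub⊢ (lift f) (sub⊢-wk f h) d)
  sub⊢ f h (∀-elim {A = A} d t) =
    subst (_ ∣ _ ⊢_) (sym (sub-[] f A t)) (∀-elim (sub⊢ f h d) (subTm f t))
  sub⊢ f h (∃-intro {A = A} t d) =
    ∃-intro (subTm f t) (subst (_ ∣ _ ⊢_) (sub-[] f A t) (sub⊢ f h d))
  sub⊢ f h (∃-elim {C = C} d e) = ∃-elim (sub⊢ f h d)
    (subst (_ ∣ _ ⊢_) (lift-wkFm f C) (sub⊢ (lift f) (sub⊢-∷ (lift f) (sub⊢-wk f h)) e))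
  sub⊢ f h (≐-refl t)        = ≐-refl _
  sub⊢ f h (≐-subst A {s} {t} d e) = subst (_ ∣ _ ⊢_) (sym (sub-[] f A t))
    (≐-subst (subFm (lift f) A) (sub⊢ f h d) (subst (_ ∣ _ ⊢_) (sub-[] f A s) (sub⊢ f h e)))

  weaken : (∀ {B} → B ∈ Δ → B ∈ Δ′) → Γ ∣ Δ ⊢ A → Γ ∣ Δ′ ⊢ A
  weaken {A = A} h d = subst (_ ∣ _ ⊢_) (subFm-id (λ _ → refl) A)
    (sub⊢ var (λ {B} i → subst (_∈ _) (sym (subFm-id (λ _ → refl) B)) (h i)) d)

  ↑ : Γ ∣ Δ ⊢ A → Γ ∣ B ∷ Δ ⊢ A
  ↑ = weaken there

  closed : Γ ∣ [] ⊢ A → Γ ∣ Δ ⊢ A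
  closed = weaken λ ()

  wk⊢ : Γ ∣ Δ ⊢ A → σ ∷ Γ ∣ map wkFm Δ ⊢ wkFm A
  wk⊢ = sub⊢ (λ x → var (there x)) (∈-map⁺ wkFm)

  cut : {Δ′ : List (Fm Γ)} → All (Γ ∣ Δ ⊢_) Δ′ → Γ ∣ Δ′ ⊢ A → Γ ∣ Δ ⊢ A
  cut []       d = closed d
  cut (p ∷ ps) d = ⇒-elim (cut ps (⇒-intro d)) p

  -- The working device of the development: a fact is derived for the variables of a small context,
  -- where weakening and substitution compute, and is then carried over to arbitrary terms and
  -- hypotheses.
  inst : (f : Sub Γ Γ′) → Γ ∣ Δ ⊢ A → All (Γ′ ∣ Δ′ ⊢_) (map (subFm f) Δ) → Γ′ ∣ Δ′ ⊢ subFm f A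
  inst f d ps = cut ps (sub⊢ f (∈-map⁺ (subFm f)) d)

  -- The inverse of `∀-intro`. Weakening under the binder and instantiating with `v0` cancel only up
  -- to a propositional equality, hence the transport.
  spec : Γ ∣ Δ ⊢ all σ A → σ ∷ Γ ∣ map wkFm Δ ⊢ A
  spec {A = A} d = subst (_ ∣ _ ⊢_) eq′ (∀-elim (wk⊢ d) v0)
    where
    h : ∀ {ρ} (x : ρ ∈ _ ∷ _) → subTm (v0 ▸ var) (lift (λ y → var (there y)) x) ≡ var x
    h (here refl) = refl
    h (there x)   = refl
    eq′ = trans (subFm-sub (v0 ▸ var) (lift λ y → var (there y)) A)
                (trans (subFm-cong h A) (subFm-id (λ _ → refl) A))

  h0 : Γ ∣ A ∷ Δ ⊢ A
  h0 = hyp (here refl)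

  h1 : Γ ∣ B ∷ A ∷ Δ ⊢ A
  h1 = ↑ h0

  ⊥-elim : Γ ∣ Δ ⊢ ⊥ → Γ ∣ Δ ⊢ A
  ⊥-elim d = raa (↑ d)

  em : (A : Fm Γ) → Γ ∣ Δ ⊢ A ∨ ~ A
  em A = raa (⇒-elim h0 (∨-intro₂ (⇒-intro (⇒-elim h1 (∨-intro₁ h0)))))

open Substitution

-- Equality at all types, β-conversion, quantifier-free induction and the semiring solver.

module Equality where

  private variable
    Γ : Cxt
    Δ : List (Fm Γ)
    A B : Fm Γ
    ρ σ τ : Ty

  nil : Sub [] Γ
  nil ()

  ≐-sym : {s t : Tm Γ o} → Γ ∣ Δ ⊢ s ≐ t → Γ ∣ Δ ⊢ t ≐ s
  ≐-sym {s = s} {t} d = inst (s ▸ t ▸ nil) symm (d ∷ [])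
    where
    symm : o ∷ o ∷ [] ∣ v0 ≐ v1 ∷ [] ⊢ v1 ≐ v0
    symm = ≐-subst (v0 ≐ v1) h0 (≐-refl v0)

  ≐-trans : {r s t : Tm Γ o} → Γ ∣ Δ ⊢ r ≐ s → Γ ∣ Δ ⊢ s ≐ t → Γ ∣ Δ ⊢ r ≐ t
  ≐-trans {r = r} {s} {t} d e = inst (r ▸ s ▸ t ▸ nil) transit (d ∷ e ∷ [])
    where
    transit : o ∷ o ∷ o ∷ [] ∣ v0 ≐ v1 ∷ v1 ≐ v2 ∷ [] ⊢ v0 ≐ v2
    transit = ≐-subst (v1 ≐ v0) h1 h0

  eq-refl : ∀ τ (x : Tm Γ τ) → Γ ∣ Δ ⊢ eq τ x x
  eq-refl o       x = ≐-refl x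
  eq-refl (σ ⇾ τ) x = ∀-intro (eq-refl τ _)

  eq-sym : ∀ τ {x y : Tm Γ τ} → Γ ∣ Δ ⊢ eq τ x y → Γ ∣ Δ ⊢ eq τ y x
  eq-sym o       d = ≐-sym d
  eq-sym (σ ⇾ τ) d = ∀-intro (eq-sym τ (spec d))

  eq-trans : ∀ τ {x y z : Tm Γ τ} → Γ ∣ Δ ⊢ eq τ x y → Γ ∣ Δ ⊢ eq τ y z → Γ ∣ Δ ⊢ eq τ x z
  eq-trans o       d e = ≐-trans d e
  eq-trans (σ ⇾ τ) d e = ∀-intro (eq-trans τ (spec d) (spec e))

  eq-fun : {x y : Tm Γ (σ ⇾ τ)} → Γ ∣ Δ ⊢ eq (σ ⇾ τ) x y → (t : Tm Γ σ) → Γ ∣ Δ ⊢ eq τ (x · t) (y · t)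
  eq-fun {τ = τ} {x = x} {y} d t = subst (_ ∣ _ ⊢_)
    (trans (subFm-eq (t ▸ var) τ _ _) (cong₂ (λ f g → eq τ (f · t) (g · t)) (wk-[] t x) (wk-[] t y)))
    (∀-elim d t)

  eq-arg : (x : Tm Γ (σ ⇾ τ)) {s t : Tm Γ σ} → Γ ∣ Δ ⊢ eq σ s t → Γ ∣ Δ ⊢ eq τ (x · s) (x · t)
  eq-arg x d = ⇒-elim (ax (ext _ _ x)) d

  eq-· : {x y : Tm Γ (σ ⇾ τ)} {s t : Tm Γ σ} →
         Γ ∣ Δ ⊢ eq (σ ⇾ τ) x y → Γ ∣ Δ ⊢ eq σ s t → Γ ∣ Δ ⊢ eq τ (x · s) (y · t)
  eq-· {τ = τ} {y = y} d e = eq-trans τ (eq-fun d _) (eq-arg y e)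

  -- Induction along the clauses of bracket abstraction. In the application case the parts are equal
  -- at higher types only in the sense of `eq`, so that replacing the argument uses the axiom of
  -- extensionality.
  lam-β : (t : Tm (σ ∷ Γ) τ) → σ ∷ Γ ∣ Δ ⊢ eq τ (wk (lam t) · v0) t
  lam-β (var (here refl)) = eq-trans _ (ax (Σ-def _ _ _)) (ax (Π-def _ _))
  lam-β (var (there x))   = ax (Π-def _ _)
  lam-β (con c)           = ax (Π-def _ _)
  lam-β (s · t)           = eq-trans _ (ax (Σ-def _ _ _)) (eq-· (lam-β s) (lam-β t))

  lam₂-β : (t : Tm (ρ ∷ σ ∷ Γ) τ) → ρ ∷ σ ∷ Γ ∣ Δ ⊢ eq τ (wk (wk (lam (lam t)) · v0) · v0) t
  lam₂-β {τ = τ} t = eq-trans τ (closed (spec (lam-β (lam t)))) (lam-β t)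

  ≐-cong : (f : Tm Γ (o ⇾ o)) {s t : Tm Γ o} → Γ ∣ Δ ⊢ s ≐ t → Γ ∣ Δ ⊢ f · s ≐ f · t
  ≐-cong f d = eq-arg f d

  ≐-cong₂ : (f : Tm Γ (o ⇾ o ⇾ o)) {s s′ t t′ : Tm Γ o} →
            Γ ∣ Δ ⊢ s ≐ s′ → Γ ∣ Δ ⊢ t ≐ t′ → Γ ∣ Δ ⊢ f · s · t ≐ f · s′ · t′
  ≐-cong₂ f d e = eq-· (eq-arg f d) e

  qf? : (A : Fm Γ) → Maybe (QF A)
  qf? (s ≐ t) = just (s ≐ t)
  qf? (s ≺ t) = just (s ≺ t)
  qf? ⊥ = just ⊥
  qf? (A ∧ B) with qf? A | qf? B
  ... | just p | just q = just (p ∧ q)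
  ... | _ | _ = nothing
  qf? (A ∨ B) with qf? A | qf? B
  ... | just p | just q = just (p ∨ q)
  ... | _ | _ = nothing
  qf? (A ⇒ B) with qf? A | qf? B
  ... | just p | just q = just (p ⇒ q)
  ... | _ | _ = nothing
  qf? (all σ A) = nothing
  qf? (ex σ A) = nothing

  qf : (A : Fm Γ) → From-just (qf? A)
  qf A = from-just (qf? A)

  induction : {A : Fm (o ∷ Γ)} → QF A → Γ ∣ Δ ⊢ A [ 𝟎 ] →
              o ∷ Γ ∣ A ∷ map wkFm Δ ⊢ subFm (v0 ⊞ 𝟏 ▸ λ x → var (there x)) A →
              o ∷ Γ ∣ map wkFm Δ ⊢ A
  induction q d e = spec (⇒-elim (⇒-elim (ax (QF-ind q)) d) (∀-intro (⇒-intro e)))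

  module _ (Γ : Cxt) (Δ : List (Fm Γ)) where

    -- The setoid equality is derivability from fixed hypotheses, so the ring solver produces
    -- derivations of polynomial identities.
    semiring : CommutativeSemiring _ _
    semiring = record
      { Carrier = Tm Γ o
      ; _≈_ = λ s t → Γ ∣ Δ ⊢ s ≐ t
      ; _+_ = _⊞_
      ; _*_ = _⊠_
      ; 0# = 𝟎
      ; 1# = 𝟏
      ; isCommutativeSemiring = record
        { isSemiring = record
          { isSemiringWithoutAnnihilatingZero = record
            { +-isCommutativeMonoid = record
              { isMonoid = record
                { isSemigroup = record
                  { isMagma = record
                    { isEquivalence = record { refl = ≐-refl _ ; sym = ≐-sym ; trans = ≐-trans }
                    ; ∙-cong = ≐-cong₂ (con plus)
                    }
                  ; assoc = λ r s t → ax (+-assoc r s t)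
                  }
                ; identity = (λ t → ≐-trans (ax (+-comm _ _)) (ax (+-identity t))) , λ t → ax (+-identity t)
                }
              ; comm = λ s t → ax (+-comm s t)
              }
            ; *-cong = ≐-cong₂ (con times)
            ; *-assoc = λ r s t → ax (*-assoc r s t)
            ; *-identity = (λ t → ≐-trans (ax (*-comm _ _)) (ax (*-identity t))) , λ t → ax (*-identity t)
            ; distrib = (λ r s t → ax (*-distrib-+ r s t)) ,
                        λ r s t → ≐-trans (ax (*-comm _ _)) (≐-trans (ax (*-distrib-+ r s t))
                                  (≐-cong₂ (con plus) (ax (*-comm _ _)) (ax (*-comm _ _))))
            }
          ; zero = (λ t → ≐-trans (ax (*-comm _ _)) (ax (*-zero t))) , λ t → ax (*-zero t)
          }
        ; *-comm = λ s t → ax (*-comm s t)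
        }
      }

  module S {Γ : Cxt} {Δ : List (Fm Γ)} = SemiringSolver (semiring Γ Δ)
  open S using (_:=_; _:+_; _:*_)

  pattern :0 = S.con 0
  pattern :1 = S.con 1

  ≺-resp : {s s′ t t′ : Tm Γ o} → Γ ∣ Δ ⊢ s ≐ s′ → Γ ∣ Δ ⊢ t ≐ t′ → Γ ∣ Δ ⊢ s ≺ t → Γ ∣ Δ ⊢ s′ ≺ t′
  ≺-resp {s = s} {s′} {t} {t′} d e f = inst (s ▸ s′ ▸ t ▸ t′ ▸ nil) resp (d ∷ e ∷ f ∷ [])
    where
    resp : o ∷ o ∷ o ∷ o ∷ [] ∣ v0 ≐ v1 ∷ v2 ≐ v3 ∷ v0 ≺ v2 ∷ [] ⊢ v1 ≺ v3
    resp = ≐-subst (v0 ≺ wk v3) h0 (≐-subst (v1 ≺ v0) h1 (↑ h1))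

  ≼-resp : {s s′ t t′ : Tm Γ o} → Γ ∣ Δ ⊢ s ≐ s′ → Γ ∣ Δ ⊢ t ≐ t′ → Γ ∣ Δ ⊢ s ≼ t → Γ ∣ Δ ⊢ s′ ≼ t′
  ≼-resp d e f = ∨-elim f (∨-intro₁ (≺-resp (↑ d) (↑ e) h0))
                          (∨-intro₂ (≐-trans (≐-sym (↑ d)) (≐-trans h0 (↑ e))))

open Equality

-- Order, truncated subtraction, powers of two, square roots and pairing.

module Arithmetic where

  open S using (_:=_; _:+_; _:*_)

  private variable
    Γ Γ′ : Cxt
    Δ : List (Fm Γ)
    A : Fm Γ
    a b c d r s t : Tm Γ o

  ≼-refl : Γ ∣ Δ ⊢ t ≼ t
  ≼-refl = ∨-intro₂ (≐-refl _)

  ≺-irr : Γ ∣ Δ ⊢ t ≺ t → Γ ∣ Δ ⊢ A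
  ≺-irr d = ⊥-elim (⇒-elim (ax (≺-irrefl _)) d)

  ≺-tr : Γ ∣ Δ ⊢ r ≺ s → Γ ∣ Δ ⊢ s ≺ t → Γ ∣ Δ ⊢ r ≺ t
  ≺-tr d e = ⇒-elim (⇒-elim (ax (≺-trans _ _ _)) d) e

  ≺-≼-trans : Γ ∣ Δ ⊢ r ≺ s → Γ ∣ Δ ⊢ s ≼ t → Γ ∣ Δ ⊢ r ≺ t
  ≺-≼-trans d e = ∨-elim e (≺-tr (↑ d) h0) (≺-resp (≐-refl _) h0 (↑ d))

  ≼-≺-trans : Γ ∣ Δ ⊢ r ≼ s → Γ ∣ Δ ⊢ s ≺ t → Γ ∣ Δ ⊢ r ≺ t
  ≼-≺-trans d e = ∨-elim d (≺-tr h0 (↑ e)) (≺-resp (≐-sym h0) (≐-refl _) (↑ e))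

  ≼-tr : Γ ∣ Δ ⊢ r ≼ s → Γ ∣ Δ ⊢ s ≼ t → Γ ∣ Δ ⊢ r ≼ t
  ≼-tr d e = ∨-elim d (∨-intro₁ (≺-≼-trans h0 (↑ e))) (≼-resp (≐-sym h0) (≐-refl _) (↑ e))

  ≼-or-≻ : ∀ s t → Γ ∣ Δ ⊢ s ≼ t ∨ t ≺ s
  ≼-or-≻ s t = ∨-elim (ax (≺-total s t)) (∨-intro₁ (∨-intro₁ h0))
    (∨-elim h0 (∨-intro₁ (∨-intro₂ h0)) (∨-intro₂ h0))

  by-≼-or-≻ : ∀ s t → Γ ∣ s ≼ t ∷ Δ ⊢ A → Γ ∣ t ≺ s ∷ Δ ⊢ A → Γ ∣ Δ ⊢ A
  by-≼-or-≻ s t = ∨-elim (≼-or-≻ s t)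

  ≺-by-contradiction : Γ ∣ t ≼ s ∷ Δ ⊢ s ≺ t → Γ ∣ Δ ⊢ s ≺ t
  ≺-by-contradiction d = by-≼-or-≻ _ _ d h0

  ≼-by-contradiction : Γ ∣ t ≺ s ∷ Δ ⊢ s ≼ t → Γ ∣ Δ ⊢ s ≼ t
  ≼-by-contradiction d = by-≼-or-≻ _ _ h0 d

  ⊞-mono-≺ : ∀ t → Γ ∣ Δ ⊢ r ≺ s → Γ ∣ Δ ⊢ r ⊞ t ≺ s ⊞ t
  ⊞-mono-≺ t d = ⇒-elim (ax (+-mono-≺ _ _ t)) d

  ⊞-mono-≼ : ∀ t → Γ ∣ Δ ⊢ r ≼ s → Γ ∣ Δ ⊢ r ⊞ t ≼ s ⊞ t
  ⊞-mono-≼ t d = ∨-elim d (∨-intro₁ (⊞-mono-≺ t h0)) (∨-intro₂ (≐-cong₂ (con plus) h0 (≐-refl t)))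

  ⊞-mono₂-≼ : Γ ∣ Δ ⊢ a ≼ b → Γ ∣ Δ ⊢ c ≼ d → Γ ∣ Δ ⊢ a ⊞ c ≼ b ⊞ d
  ⊞-mono₂-≼ p q = ≼-tr (⊞-mono-≼ _ p) (≼-resp (ax (+-comm _ _)) (ax (+-comm _ _)) (⊞-mono-≼ _ q))

  ⊞-cancel-≺ : ∀ t → Γ ∣ Δ ⊢ r ⊞ t ≺ s ⊞ t → Γ ∣ Δ ⊢ r ≺ s
  ⊞-cancel-≺ t p = ≺-by-contradiction (≺-irr (≺-≼-trans (↑ p) (⊞-mono-≼ t h0)))

  ⊞-cancel-≼ : ∀ t → Γ ∣ Δ ⊢ r ⊞ t ≼ s ⊞ t → Γ ∣ Δ ⊢ r ≼ s
  ⊞-cancel-≼ t p = ≼-by-contradiction (≺-irr (≼-≺-trans (↑ p) (⊞-mono-≺ t h0)))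

  ≼-antisym : Γ ∣ Δ ⊢ s ≼ t → Γ ∣ Δ ⊢ t ≼ s → Γ ∣ Δ ⊢ s ≐ t
  ≼-antisym p q = ∨-elim p (≺-irr (≺-≼-trans h0 (↑ q))) h0

  ⊞-cancel : ∀ t → Γ ∣ Δ ⊢ r ⊞ t ≐ s ⊞ t → Γ ∣ Δ ⊢ r ≐ s
  ⊞-cancel t p = ≼-antisym (⊞-cancel-≼ t (∨-intro₂ p)) (⊞-cancel-≼ t (∨-intro₂ (≐-sym p)))

  ⊞-identityˡ : ∀ t → Γ ∣ Δ ⊢ 𝟎 ⊞ t ≐ t
  ⊞-identityˡ t = ≐-trans (ax (+-comm _ _)) (ax (+-identity t))

  n≺n+1 : ∀ t → Γ ∣ Δ ⊢ t ≺ t ⊞ 𝟏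
  n≺n+1 t = ≺-resp (⊞-identityˡ t) (ax (+-comm _ _)) (⊞-mono-≺ t (ax 0≺1))

  n≼n+1 : ∀ t → Γ ∣ Δ ⊢ t ≼ t ⊞ 𝟏
  n≼n+1 t = ∨-intro₁ (n≺n+1 t)

  -- The ordered semi-ring axioms do not make 0 the least element; this takes an induction.
  0≼ : ∀ t → Γ ∣ Δ ⊢ 𝟎 ≼ t
  0≼ t = inst (t ▸ nil) (induction (qf (𝟎 ≼ v0)) ≼-refl (≼-tr h0 (n≼n+1 _))) []

  m≼m+n : ∀ s t → Γ ∣ Δ ⊢ s ≼ s ⊞ t
  m≼m+n s t = ≼-resp (⊞-identityˡ s) (ax (+-comm _ _)) (⊞-mono-≼ s (0≼ t))

  0≺n+1 : ∀ t → Γ ∣ Δ ⊢ 𝟎 ≺ t ⊞ 𝟏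
  0≺n+1 t = ≼-≺-trans (0≼ t) (n≺n+1 t)

  zero-or-pos : ∀ t → Γ ∣ Δ ⊢ t ≐ 𝟎 ∨ 𝟎 ≺ t
  zero-or-pos t = by-≼-or-≻ t 𝟎 (∨-intro₁ (≼-antisym h0 (0≼ t))) (∨-intro₂ h0)

  ⊠-mono-≺ : Γ ∣ Δ ⊢ 𝟎 ≺ t → Γ ∣ Δ ⊢ r ≺ s → Γ ∣ Δ ⊢ r ⊠ t ≺ s ⊠ t
  ⊠-mono-≺ p d = ⇒-elim (⇒-elim (ax (*-mono-≺ _ _ _)) p) d

  ⊠-congˡ : ∀ t → Γ ∣ Δ ⊢ r ≐ s → Γ ∣ Δ ⊢ r ⊠ t ≐ s ⊠ t
  ⊠-congˡ t d = ≐-cong₂ (con times) d (≐-refl t)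

  ⊠-congʳ : ∀ t → Γ ∣ Δ ⊢ r ≐ s → Γ ∣ Δ ⊢ t ⊠ r ≐ t ⊠ s
  ⊠-congʳ t d = ≐-cong₂ (con times) (≐-refl t) d

  ⊞-congˡ : ∀ t → Γ ∣ Δ ⊢ r ≐ s → Γ ∣ Δ ⊢ r ⊞ t ≐ s ⊞ t
  ⊞-congˡ t d = ≐-cong₂ (con plus) d (≐-refl t)

  ⊞-congʳ : ∀ t → Γ ∣ Δ ⊢ r ≐ s → Γ ∣ Δ ⊢ t ⊞ r ≐ t ⊞ s
  ⊞-congʳ t d = ≐-cong₂ (con plus) (≐-refl t) d

  ⊠-mono-≼ : ∀ t → Γ ∣ Δ ⊢ r ≼ s → Γ ∣ Δ ⊢ r ⊠ t ≼ s ⊠ t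
  ⊠-mono-≼ t d = ∨-elim (zero-or-pos t)
    (∨-intro₂ (≐-trans (≐-trans (⊠-congʳ _ h0) (ax (*-zero _)))
                       (≐-sym (≐-trans (⊠-congʳ _ h0) (ax (*-zero _))))))
    (∨-elim (↑ d) (∨-intro₁ (⊠-mono-≺ h1 h0)) (∨-intro₂ (⊠-congˡ t h0)))

  ⊠-mono₂-≼ : Γ ∣ Δ ⊢ a ≼ b → Γ ∣ Δ ⊢ c ≼ d → Γ ∣ Δ ⊢ a ⊠ c ≼ b ⊠ d
  ⊠-mono₂-≼ p q = ≼-tr (⊠-mono-≼ _ p) (≼-resp (ax (*-comm _ _)) (ax (*-comm _ _)) (⊠-mono-≼ _ q))

  ⊠-cancel-≼ : Γ ∣ Δ ⊢ 𝟎 ≺ t → Γ ∣ Δ ⊢ r ⊠ t ≼ s ⊠ t → Γ ∣ Δ ⊢ r ≼ s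
  ⊠-cancel-≼ p d = ≼-by-contradiction (≺-irr (≼-≺-trans (↑ d) (⊠-mono-≺ (↑ p) h0)))

  ⊠-pos : Γ ∣ Δ ⊢ 𝟎 ≺ s → Γ ∣ Δ ⊢ 𝟎 ≺ t → Γ ∣ Δ ⊢ 𝟎 ≺ s ⊠ t
  ⊠-pos p q = ≺-resp (≐-trans (ax (*-comm _ _)) (ax (*-zero _))) (≐-refl _) (⊠-mono-≺ q p)

  pred-cong : Γ ∣ Δ ⊢ s ≐ t → Γ ∣ Δ ⊢ pred s ≐ pred t
  pred-cong = ≐-cong _

  pred-suc : ∀ t → Γ ∣ Δ ⊢ pred (t ⊞ 𝟏) ≐ t
  pred-suc t = ≐-trans (ax (R₀-suc _ _ _)) (inst (pred t ▸ t ▸ nil) (lam₂-β v1) [])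

  zero-or-suc : ∀ t → Γ ∣ Δ ⊢ t ≐ 𝟎 ∨ t ≐ pred t ⊞ 𝟏
  zero-or-suc t = inst (t ▸ nil)
    (induction (qf (v0 ≐ 𝟎 ∨ v0 ≐ pred v0 ⊞ 𝟏)) (∨-intro₁ (≐-refl _))
      (∨-intro₂ (⊞-congˡ 𝟏 (≐-sym (pred-suc v0))))) []

  ∸-zero : ∀ s → Γ ∣ Δ ⊢ s ∸ᵗ 𝟎 ≐ s
  ∸-zero s = ax (R₀-zero _ _)

  ∸-suc : ∀ s t → Γ ∣ Δ ⊢ s ∸ᵗ (t ⊞ 𝟏) ≐ pred (s ∸ᵗ t)
  ∸-suc s t = ≐-trans (ax (R₀-suc _ _ _)) (inst (s ∸ᵗ t ▸ t ▸ nil) (lam₂-β (pred v0)) [])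

  ∸-cong : Γ ∣ Δ ⊢ a ≐ b → Γ ∣ Δ ⊢ c ≐ d → Γ ∣ Δ ⊢ a ∸ᵗ c ≐ b ∸ᵗ d
  ∸-cong = ≐-cong₂ _

  m+[n∸m]≐n : Γ ∣ Δ ⊢ t ≼ s → Γ ∣ Δ ⊢ t ⊞ (s ∸ᵗ t) ≐ s
  m+[n∸m]≐n {t = t} {s} p = ⇒-elim (inst (t ▸ s ▸ nil)
    (induction (qf (v0 ≼ v1 ⇒ v0 ⊞ (v1 ∸ᵗ v0) ≐ v1))
      (⇒-intro (≐-trans (⊞-identityˡ _) (∸-zero _)))
      (⇒-intro (∨-elim (zero-or-suc (v1 ∸ᵗ v0))
        -- If the difference were 0, the induction hypothesis would give `v0 ≐ v1`, against
        -- `v0 ⊞ 𝟏 ≼ v1`.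
        (≺-irr (≺-≼-trans (n≺n+1 v0) (≼-resp (≐-refl _)
          (≐-trans (≐-sym ih) (≐-trans (⊞-congʳ v0 h0) (ax (+-identity v0)))) h1)))
        (≐-trans (⊞-congʳ _ (∸-suc _ _))
          (≐-trans (S.solve 2 (λ m n → m :+ :1 :+ n := m :+ (n :+ :1)) (≐-refl _) _ _)
            (≐-trans (⊞-congʳ _ (≐-sym h0)) ih))))))
    []) p
    where
    ih : {D : Fm (o ∷ o ∷ [])} → o ∷ o ∷ [] ∣ D ∷ v0 ⊞ 𝟏 ≼ v1 ∷ (v0 ≼ v1 ⇒ v0 ⊞ (v1 ∸ᵗ v0) ≐ v1) ∷ []
         ⊢ v0 ⊞ (v1 ∸ᵗ v0) ≐ v1
    ih = ⇒-elim (↑ h1) (≼-tr (n≼n+1 v0) h1)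

  m∸[m+n]≐0 : ∀ s t → Γ ∣ Δ ⊢ s ∸ᵗ (s ⊞ t) ≐ 𝟎
  m∸[m+n]≐0 s t = inst (t ▸ s ▸ nil) (induction (qf (v1 ∸ᵗ (v1 ⊞ v0) ≐ 𝟎))
    (≐-trans (∸-cong (≐-refl _) (ax (+-identity _)))
      (⊞-cancel v0 (≐-trans (ax (+-comm _ _)) (≐-trans (m+[n∸m]≐n ≼-refl) (≐-sym (⊞-identityˡ _))))))
    (≐-trans (∸-cong (≐-refl _) (≐-sym (ax (+-assoc _ _ _))))
      (≐-trans (∸-suc _ _) (≐-trans (pred-cong h0) (ax (R₀-zero _ _)))))) []

  m≼n⇒m∸n≐0 : Γ ∣ Δ ⊢ s ≼ t → Γ ∣ Δ ⊢ s ∸ᵗ t ≐ 𝟎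
  m≼n⇒m∸n≐0 p = ≐-trans (∸-cong (≐-refl _) (≐-sym (m+[n∸m]≐n p))) (m∸[m+n]≐0 _ _)

  m+n∸m≐n : ∀ s t → Γ ∣ Δ ⊢ (s ⊞ t) ∸ᵗ s ≐ t
  m+n∸m≐n s t = ⊞-cancel s (≐-trans (ax (+-comm _ _)) (≐-trans (m+[n∸m]≐n (m≼m+n s t)) (ax (+-comm _ _))))

  -- Discreteness of the order is not an axiom. It comes from `zero-or-suc`, applied to the
  -- difference `t ∸ᵗ s`, which cannot be 0.
  m≺n⇒m+1≼n : Γ ∣ Δ ⊢ s ≺ t → Γ ∣ Δ ⊢ s ⊞ 𝟏 ≼ t
  m≺n⇒m+1≼n {s = s} {t} p = ∨-elim (zero-or-suc (t ∸ᵗ s))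
    (≺-irr (≺-resp (≐-refl _) (≐-trans (≐-sym (m+[n∸m]≐n (↑ (∨-intro₁ p)))) (≐-trans (⊞-congʳ s h0) (ax (+-identity s)))) (↑ p)))
    (≼-resp (≐-refl _)
      (≐-trans (S.solve 2 (λ m n → m :+ :1 :+ n := m :+ (n :+ :1)) (≐-refl _) s _)
        (≐-trans (⊞-congʳ s (≐-sym h0)) (m+[n∸m]≐n (↑ (∨-intro₁ p)))))
      (m≼m+n _ _))

  m≺n+1⇒m≼n : Γ ∣ Δ ⊢ s ≺ t ⊞ 𝟏 → Γ ∣ Δ ⊢ s ≼ t
  m≺n+1⇒m≼n p = ⊞-cancel-≼ 𝟏 (m≺n⇒m+1≼n p)

  pred-pos : Γ ∣ Δ ⊢ 𝟎 ≺ t → Γ ∣ Δ ⊢ pred t ⊞ 𝟏 ≐ t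
  pred-pos p = ∨-elim (zero-or-suc _) (≺-irr (≺-resp (≐-refl _) h0 (↑ p))) (≐-sym h0)

  2^-zero : Γ ∣ Δ ⊢ 2^ 𝟎 ≐ 𝟏
  2^-zero = ax (R₀-zero _ _)

  2^-suc : ∀ t → Γ ∣ Δ ⊢ 2^ (t ⊞ 𝟏) ≐ 2^ t ⊞ 2^ t
  2^-suc t = ≐-trans (ax (R₀-suc _ _ _)) (inst (2^ t ▸ t ▸ nil) (lam₂-β (v0 ⊞ v0)) [])

  2^-cong : Γ ∣ Δ ⊢ s ≐ t → Γ ∣ Δ ⊢ 2^ s ≐ 2^ t
  2^-cong = ≐-cong _

  n≺2^n : ∀ t → Γ ∣ Δ ⊢ t ≺ 2^ t
  n≺2^n t = inst (t ▸ nil) (induction (qf (v0 ≺ 2^ v0))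
    (≺-resp (≐-refl _) (≐-sym 2^-zero) (ax 0≺1))
    (≺-resp (≐-refl _) (≐-sym (2^-suc _))
      (≺-≼-trans (⊞-mono-≺ 𝟏 h0) (≼-resp (ax (+-comm _ _)) (≐-refl _)
        (⊞-mono-≼ _ (≼-resp (⊞-identityˡ _) (≐-refl _) (m≺n⇒m+1≼n (≼-≺-trans (0≼ _) h0)))))))) []

  2^-pos : ∀ t → Γ ∣ Δ ⊢ 𝟎 ≺ 2^ t
  2^-pos t = ≼-≺-trans (0≼ t) (n≺2^n t)

  sqrt-cong : Γ ∣ Δ ⊢ s ≐ t → Γ ∣ Δ ⊢ sqrt s ≐ sqrt t
  sqrt-cong = ≐-cong _

  sqrt-suc : ∀ t → Γ ∣ Δ ⊢ sqrt (t ⊞ 𝟏) ≐ sqrt t ⊞ (𝟏 ∸ᵗ ((sqrt t ⊞ 𝟏) ⊠ (sqrt t ⊞ 𝟏) ∸ᵗ (t ⊞ 𝟏)))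
  sqrt-suc t = ≐-trans (ax (R₀-suc _ _ _))
    (inst (sqrt t ▸ t ▸ nil) (lam₂-β (v0 ⊞ (𝟏 ∸ᵗ ((v0 ⊞ 𝟏) ⊠ (v0 ⊞ 𝟏) ∸ᵗ (v1 ⊞ 𝟏))))) [])

  Sqrt : Tm Γ o → Tm Γ o → Fm Γ
  Sqrt n r = r ⊠ r ≼ n ∧ n ≺ (r ⊞ 𝟏) ⊠ (r ⊞ 𝟏)

  Sqrt-resp : Γ ∣ Δ ⊢ s ≐ t → Γ ∣ Δ ⊢ Sqrt a s → Γ ∣ Δ ⊢ Sqrt a t
  Sqrt-resp p q = ∧-intro
    (≼-resp (≐-cong₂ (con times) p p) (≐-refl _) (∧-elim₁ q))
    (≺-resp (≐-refl _) (≐-cong₂ (con times) (⊞-congˡ 𝟏 p) (⊞-congˡ 𝟏 p)) (∧-elim₂ q))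

  Sqrt-suc : ∀ n r → Γ ∣ Δ ⊢ Sqrt n r → Γ ∣ Δ ⊢ Sqrt (n ⊞ 𝟏) (r ⊞ (𝟏 ∸ᵗ ((r ⊞ 𝟏) ⊠ (r ⊞ 𝟏) ∸ᵗ (n ⊞ 𝟏))))
  Sqrt-suc n r p = by-≼-or-≻ ((r ⊞ 𝟏) ⊠ (r ⊞ 𝟏)) (n ⊞ 𝟏)
    (Sqrt-resp (⊞-congʳ r (≐-sym (≐-trans (∸-cong (≐-refl _) (m≼n⇒m∸n≐0 h0)) (∸-zero _))))
      -- The root goes up by one, and the new upper bound holds because (r + 2)² exceeds (r + 1)² +
      -- 1 by 2r + 2.
      (∧-intro h0 (≺-≼-trans (⊞-mono-≺ 𝟏 (↑ (∧-elim₂ p)))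
        (≼-resp (≐-refl _)
          (S.solve 1 (λ r → (r :+ :1) :* (r :+ :1) :+ :1 :+ (r :+ r :+ :1 :+ :1)
                         := (r :+ :1 :+ :1) :* (r :+ :1 :+ :1)) (≐-refl _) r)
          (m≼m+n _ _)))))
    (Sqrt-resp (≐-sym (≐-trans (⊞-congʳ r (m≼n⇒m∸n≐0 (≼-resp (⊞-identityˡ _) (≐-refl _) (m≺n⇒m+1≼n
                   (⊞-cancel-≺ (n ⊞ 𝟏) (≺-resp (≐-sym (⊞-identityˡ _))
                     (≐-trans (≐-sym (m+[n∸m]≐n (∨-intro₁ h0))) (ax (+-comm _ _))) h0))))))
                 (ax (+-identity r))))
      (∧-intro (≼-tr (↑ (∧-elim₁ p)) (n≼n+1 n)) h0))

  sqrt-Sqrt : ∀ t → Γ ∣ Δ ⊢ Sqrt t (sqrt t)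
  sqrt-Sqrt t = inst (t ▸ nil) (induction (qf (Sqrt v0 (sqrt v0)))
    (Sqrt-resp (≐-sym (ax (R₀-zero _ _)))
      (∧-intro (∨-intro₂ (ax (*-zero 𝟎)))
        (≺-resp (≐-refl _) (S.solve 0 (:1 := (:0 :+ :1) :* (:0 :+ :1)) (≐-refl _)) (ax 0≺1))))
    (Sqrt-resp (≐-sym (sqrt-suc v0)) (Sqrt-suc v0 (sqrt v0) h0))) []

  Sqrt-≼ : Γ ∣ Δ ⊢ Sqrt a s → Γ ∣ Δ ⊢ Sqrt a t → Γ ∣ Δ ⊢ s ≼ t
  Sqrt-≼ p q = ≼-by-contradiction (≺-irr (≺-≼-trans (↑ (∧-elim₂ q))
    (≼-tr (⊠-mono₂-≼ (m≺n⇒m+1≼n h0) (m≺n⇒m+1≼n h0)) (↑ (∧-elim₁ p)))))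

  -- The summand `s` is too small to lift (s + t)² to the next square. So the root of a code is the
  -- sum of its components, and the first component is the remainder.
  sqrt-pair : ∀ s t → Γ ∣ Δ ⊢ sqrt (pair s t) ≐ s ⊞ t
  sqrt-pair s t = ≼-antisym (Sqrt-≼ (sqrt-Sqrt _) p) (Sqrt-≼ p (sqrt-Sqrt _))
    where
    p : _ ∣ _ ⊢ Sqrt (pair s t) (s ⊞ t)
    p = ∧-intro (m≼m+n _ _) (≺-≼-trans (n≺n+1 _) (≼-resp (≐-refl _)
      (S.solve 2 (λ s t → (s :+ t) :* (s :+ t) :+ s :+ :1 :+ (s :+ t :+ t)
                       := (s :+ t :+ :1) :* (s :+ t :+ :1)) (≐-refl _) s t)
      (m≼m+n _ _)))

  -- Opaque copies of the projections: terms containing unfolded square roots are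
  -- too large to be compared.
  opaque
    fst′ snd′ : Tm Γ o → Tm Γ o
    fst′ = fst
    snd′ = snd

    fst-sub : (f : Sub Γ Γ′) (t : Tm Γ o) → subTm f (fst′ t) ≡ fst′ (subTm f t)
    fst-sub f t = refl

    snd-sub : (f : Sub Γ Γ′) (t : Tm Γ o) → subTm f (snd′ t) ≡ snd′ (subTm f t)
    snd-sub f t = refl

    fst-pair : ∀ s t → Γ ∣ Δ ⊢ fst′ (pair s t) ≐ s
    fst-pair s t = ≐-trans (∸-cong (≐-refl _) (≐-cong₂ (con times) (sqrt-pair s t) (sqrt-pair s t))) (m+n∸m≐n _ _)

    snd-pair : ∀ s t → Γ ∣ Δ ⊢ snd′ (pair s t) ≐ t
    snd-pair s t = ≐-trans (∸-cong (sqrt-pair s t) (fst-pair s t)) (m+n∸m≐n _ _)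

    fst-cong : Γ ∣ Δ ⊢ s ≐ t → Γ ∣ Δ ⊢ fst′ s ≐ fst′ t
    fst-cong p = ∸-cong p (≐-cong₂ (con times) (sqrt-cong p) (sqrt-cong p))

    snd-cong : Γ ∣ Δ ⊢ s ≐ t → Γ ∣ Δ ⊢ snd′ s ≐ snd′ t
    snd-cong p = ∸-cong (sqrt-cong p) (fst-cong p)

  ⟪_⟫′ : Tm Γ o → Frac Γ
  ⟪ q ⟫′ = frac (fst′ (fst′ q)) (snd′ (fst′ q)) (snd′ q ⊞ 𝟏)

open Arithmetic

-- A second syntax of formulas, with rational and real predicates as atoms.

module Formulas where

  open Frac

  private variable
    Γ Γ′ : Cxt
    σ τ : Ty

  infixl 7 _⊕_ _⊖_
  infix 8 ⊝_

  -- Rationals are kept as expressions: their denominators are provably positive by recursion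
  -- (`den-pos`), and the large numerators are never displayed. `dy c j` stands for c / 2^j.
  data Rat (Γ : Cxt) : Set where
    code : Tm Γ o → Rat Γ
    dy   : Tm Γ o → Tm Γ o → Rat Γ
    _⊕_ _⊖_ : Rat Γ → Rat Γ → Rat Γ
    ⊝_ half : Rat Γ → Rat Γ

  ⟦_⟧ : Rat Γ → Frac Γ
  ⟦ code q ⟧ = ⟪ q ⟫′
  ⟦ dy c j ⟧ = frac c 𝟎 (2^ j)
  ⟦ x ⊕ y ⟧  = frac (pos ⟦ x ⟧ ⊠ den ⟦ y ⟧ ⊞ pos ⟦ y ⟧ ⊠ den ⟦ x ⟧)
                    (neg ⟦ x ⟧ ⊠ den ⟦ y ⟧ ⊞ neg ⟦ y ⟧ ⊠ den ⟦ x ⟧)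
                    (den ⟦ x ⟧ ⊠ den ⟦ y ⟧)
  ⟦ x ⊖ y ⟧  = ⟦ x ⟧ -Q ⟦ y ⟧
  ⟦ ⊝ x ⟧    = -Q ⟦ x ⟧
  ⟦ half x ⟧ = frac (pos ⟦ x ⟧) (neg ⟦ x ⟧) (den ⟦ x ⟧ ⊠ (𝟏 ⊞ 𝟏))

  den-pos : ∀ {Δ} (x : Rat Γ) → Γ ∣ Δ ⊢ 𝟎 ≺ den ⟦ x ⟧
  den-pos (code q) = 0≺n+1 _
  den-pos (dy c j) = 2^-pos j
  den-pos (x ⊕ y)  = ⊠-pos (den-pos x) (den-pos y)
  den-pos (x ⊖ y)  = ⊠-pos (den-pos x) (den-pos y)
  den-pos (⊝ x)    = den-pos x
  den-pos (half x) = ⊠-pos (den-pos x) (0≺n+1 𝟏)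

  -- What remains on the left of x ≤ y after clearing denominators and moving the negative parts
  -- across; the right side is `cross y x`.
  cross : Rat Γ → Rat Γ → Tm Γ o
  cross x y = pos ⟦ x ⟧ ⊠ den ⟦ y ⟧ ⊞ neg ⟦ y ⟧ ⊠ den ⟦ x ⟧

  infix 6 _≐̇_ _≺̇_ _=ṙ_ _≤ṙ_ _<ṙ_ _≼̇_ _≤_ _<_ _≈_
  infixr 5 _∧̇_
  infixr 4 _∨̇_
  infixr 3 _⇒̇_
  infix 5.5 ¬̇_
  infix 2 _⊢_

  -- Copies of the predicates of the statement in terms of the opaque projections; once `fst′` and
  -- `snd′` are unfolded they are the originals.
  isReal′ in01′ : Tm Γ T1 → Fm Γ
  isReal′ x = all o (all o (∣ ⟪ wk (wk x) · v1 ⟫′ -Q ⟪ wk (wk x) · (v1 ⊞ v0) ⟫′ ∣<Q 2^- v1))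

  infix 6 _=ℝ′_ _≤ℝ′_
  _=ℝ′_ _≤ℝ′_ : Tm Γ T1 → Tm Γ T1 → Fm Γ
  x =ℝ′ y = all o (∣ ⟪ wk x · v0 ⟫′ -Q ⟪ wk y · v0 ⟫′ ∣≤Q 2^1- v0)
  x ≤ℝ′ y = all o (⟪ wk x · v0 ⟫′ -Q ⟪ wk y · v0 ⟫′ ≤Q 2^1- v0)

  in01′ x = isReal′ x ∧ 0ℝ ≤ℝ′ x ∧ x ≤ℝ′ 1ℝ

  -- Formulas in which the predicates of Defs are atoms, so that they are never
  -- unfolded when formulas are compared.
  data Form (Γ : Cxt) : Set where
    _≐̇_ _≺̇_     : Tm Γ o → Tm Γ o → Form Γ
    ⊥̇           : Form Γ
    _∧̇_ _∨̇_ _⇒̇_ : Form Γ → Form Γ → Form Γ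
    ∀̇ ∃̇         : ∀ σ → Form (σ ∷ Γ) → Form Γ
    real unit   : Tm Γ T1 → Form Γ
    _=ṙ_ _≤ṙ_   : Tm Γ T1 → Tm Γ T1 → Form Γ
    _≤_ _<_ _≈_ : Rat Γ → Rat Γ → Form Γ

  ¬̇_ : Form Γ → Form Γ
  ¬̇ A = A ⇒̇ ⊥̇

  _≼̇_ : Tm Γ o → Tm Γ o → Form Γ
  s ≼̇ t = (s ≺̇ t) ∨̇ (s ≐̇ t)

  _<ṙ_ : Tm Γ T1 → Tm Γ T1 → Form Γ
  x <ṙ y = ¬̇ (y ≤ṙ x)

  ⌊_⌋ : Form Γ → Fm Γ
  ⌊ s ≐̇ t ⌋     = s ≐ t
  ⌊ s ≺̇ t ⌋     = s ≺ t
  ⌊ ⊥̇ ⌋         = ⊥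
  ⌊ A ∧̇ B ⌋     = ⌊ A ⌋ ∧ ⌊ B ⌋
  ⌊ A ∨̇ B ⌋     = ⌊ A ⌋ ∨ ⌊ B ⌋
  ⌊ A ⇒̇ B ⌋     = ⌊ A ⌋ ⇒ ⌊ B ⌋
  ⌊ ∀̇ σ A ⌋     = all σ ⌊ A ⌋
  ⌊ ∃̇ σ A ⌋     = ex σ ⌊ A ⌋
  ⌊ real x ⌋    = isReal′ x
  ⌊ unit x ⌋    = in01′ x
  ⌊ x =ṙ y ⌋    = x =ℝ′ y
  ⌊ x ≤ṙ y ⌋    = x ≤ℝ′ y
  ⌊ x ≈ y ⌋    = cross x y ≐ cross y x
  ⌊ x ≤ y ⌋    = ⟦ x ⟧ ≤Q ⟦ y ⟧
  ⌊ x < y ⌋    = ⟦ x ⟧ <Q ⟦ y ⟧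

  subRat : Sub Γ Γ′ → Rat Γ → Rat Γ′
  subRat f (code q) = code (subTm f q)
  subRat f (dy c j) = dy (subTm f c) (subTm f j)
  subRat f (x ⊕ y)  = subRat f x ⊕ subRat f y
  subRat f (x ⊖ y)  = subRat f x ⊖ subRat f y
  subRat f (⊝ x)    = ⊝ subRat f x
  subRat f (half x) = half (subRat f x)

  sub : Sub Γ Γ′ → Form Γ → Form Γ′
  sub f (s ≐̇ t)     = subTm f s ≐̇ subTm f t
  sub f (s ≺̇ t)     = subTm f s ≺̇ subTm f t
  sub f ⊥̇           = ⊥̇
  sub f (A ∧̇ B)     = sub f A ∧̇ sub f B
  sub f (A ∨̇ B)     = sub f A ∨̇ sub f B
  sub f (A ⇒̇ B)     = sub f A ⇒̇ sub f B
  sub f (∀̇ σ A)     = ∀̇ σ (sub (lift f) A)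
  sub f (∃̇ σ A)     = ∃̇ σ (sub (lift f) A)
  sub f (real x)    = real (subTm f x)
  sub f (unit x)    = unit (subTm f x)
  sub f (x =ṙ y)    = subTm f x =ṙ subTm f y
  sub f (x ≤ṙ y)    = subTm f x ≤ṙ subTm f y
  sub f (x ≈ y) = subRat f x ≈ subRat f y
  sub f (x ≤ y)   = subRat f x ≤ subRat f y
  sub f (x < y)  = subRat f x < subRat f y

  wkn : Form Γ → Form (σ ∷ Γ)
  wkn = sub (λ x → var (there x))

  subFrac : Sub Γ Γ′ → Frac Γ → Frac Γ′
  subFrac f (frac p n d) = frac (subTm f p) (subTm f n) (subTm f d)

  crossQ : Frac Γ → Frac Γ → Tm Γ o
  crossQ (frac a b d) (frac a′ b′ d′) = a ⊠ d′ ⊞ b′ ⊠ d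

  frac-cong : ∀ {p p′ n n′ d d′ : Tm Γ o} → p ≡ p′ → n ≡ n′ → d ≡ d′ → frac p n d ≡ frac p′ n′ d′
  frac-cong refl refl refl = refl

  ⟪⟫-sub : (f : Sub Γ Γ′) (q : Tm Γ o) {q′ : Tm Γ′ o} → subTm f q ≡ q′ → subFrac f ⟪ q ⟫′ ≡ ⟪ q′ ⟫′
  ⟪⟫-sub f q refl = frac-cong
    (trans (fst-sub f (fst′ q)) (cong fst′ (fst-sub f q)))
    (trans (snd-sub f (fst′ q)) (cong snd′ (fst-sub f q)))
    (cong (_⊞ 𝟏) (snd-sub f q))

  ⟦⟧-sub : (f : Sub Γ Γ′) (x : Rat Γ) → subFrac f ⟦ x ⟧ ≡ ⟦ subRat f x ⟧
  ⟦⟧-sub f (code q) = ⟪⟫-sub f q refl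
  ⟦⟧-sub f (dy c j) = refl
  ⟦⟧-sub f (x ⊕ y)  = cong₂ plusQ (⟦⟧-sub f x) (⟦⟧-sub f y)
    where
    plusQ : Frac Γ → Frac Γ → Frac Γ
    plusQ (frac a b d) (frac a′ b′ d′) = frac (a ⊠ d′ ⊞ a′ ⊠ d) (b ⊠ d′ ⊞ b′ ⊠ d) (d ⊠ d′)
  ⟦⟧-sub f (x ⊖ y)  = cong₂ _-Q_ (⟦⟧-sub f x) (⟦⟧-sub f y)
  ⟦⟧-sub f (⊝ x)    = cong -Q_ (⟦⟧-sub f x)
  ⟦⟧-sub f (half x) = cong (λ { (frac a b d) → frac a b (d ⊠ (𝟏 ⊞ 𝟏)) }) (⟦⟧-sub f x)

  private
    module _ (f : Sub Γ Γ′) (x y : Frac Γ) {x′ y′ : Frac Γ′} where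
      ≤Q-sub : subFrac f x ≡ x′ → subFrac f y ≡ y′ → subFm f (x ≤Q y) ≡ (x′ ≤Q y′)
      ≤Q-sub refl refl = refl

      <Q-sub : subFrac f x ≡ x′ → subFrac f y ≡ y′ → subFm f (x <Q y) ≡ (x′ <Q y′)
      <Q-sub refl refl = refl

      ≈Q-sub : subFrac f x ≡ x′ → subFrac f y ≡ y′ → subFm f (crossQ x y ≐ crossQ y x) ≡ (crossQ x′ y′ ≐ crossQ y′ x′)
      ≈Q-sub refl refl = refl

      -Q-sub : subFrac f x ≡ x′ → subFrac f y ≡ y′ → subFrac f (x -Q y) ≡ x′ -Q y′
      -Q-sub refl refl = refl

      ∣∣<-sub : subFrac f x ≡ x′ → subFrac f y ≡ y′ → subFm f (∣ x ∣<Q y) ≡ (∣ x′ ∣<Q y′)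
      ∣∣<-sub refl refl = refl

      ∣∣≤-sub : subFrac f x ≡ x′ → subFrac f y ≡ y′ → subFm f (∣ x ∣≤Q y) ≡ (∣ x′ ∣≤Q y′)
      ∣∣≤-sub refl refl = refl

    diff-sub : (f : Sub Γ Γ′) (s t : Tm Γ o) {s′ t′ : Tm Γ′ o} → subTm f s ≡ s′ → subTm f t ≡ t′ →
               subFrac f (⟪ s ⟫′ -Q ⟪ t ⟫′) ≡ ⟪ s′ ⟫′ -Q ⟪ t′ ⟫′
    diff-sub f s t p q = -Q-sub f ⟪ s ⟫′ ⟪ t ⟫′ (⟪⟫-sub f s p) (⟪⟫-sub f t q)

    at-sub : (f : Sub Γ Γ′) (x : Tm Γ T1) → subTm (lift {τ = o} f) (wk x · v0) ≡ wk (subTm f x) · v0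
    at-sub f x = cong (_· v0) (lift-wk f x)

  real-sub : (f : Sub Γ Γ′) (x : Tm Γ T1) → subFm f (isReal′ x) ≡ isReal′ (subTm f x)
  real-sub f x = cong (λ A → all o (all o A))
    (∣∣<-sub g (⟪ wk (wk x) · v1 ⟫′ -Q ⟪ wk (wk x) · (v1 ⊞ v0) ⟫′) (2^- v1)
      (diff-sub g (wk (wk x) · v1) (wk (wk x) · (v1 ⊞ v0)) (cong (_· v1) p) (cong (_· (v1 ⊞ v0)) p)) refl)
    where
    g = lift (lift f)
    p : subTm g (wk (wk x)) ≡ wk (wk (subTm f x))
    p = trans (lift-wk (lift f) (wk x)) (cong wk (lift-wk f x))

  =ℝ′-sub : (f : Sub Γ Γ′) (x y : Tm Γ T1) → subFm f (x =ℝ′ y) ≡ (subTm f x =ℝ′ subTm f y)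
  =ℝ′-sub f x y = cong (all o)
    (∣∣≤-sub (lift f) (⟪ wk x · v0 ⟫′ -Q ⟪ wk y · v0 ⟫′) (2^1- v0)
      (diff-sub (lift f) (wk x · v0) (wk y · v0) (at-sub f x) (at-sub f y)) refl)

  ≤ℝ′-sub : (f : Sub Γ Γ′) (x y : Tm Γ T1) → subFm f (x ≤ℝ′ y) ≡ (subTm f x ≤ℝ′ subTm f y)
  ≤ℝ′-sub f x y = cong (all o)
    (≤Q-sub (lift f) (⟪ wk x · v0 ⟫′ -Q ⟪ wk y · v0 ⟫′) (2^1- v0)
      (diff-sub (lift f) (wk x · v0) (wk y · v0) (at-sub f x) (at-sub f y)) refl)

  unit-sub : (f : Sub Γ Γ′) (x : Tm Γ T1) → subFm f (in01′ x) ≡ in01′ (subTm f x)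
  unit-sub f x = cong₂ _∧_ (real-sub f x) (cong₂ _∧_ (≤ℝ′-sub f 0ℝ x) (≤ℝ′-sub f x 1ℝ))

  ⌊⌋-sub : (f : Sub Γ Γ′) (A : Form Γ) → ⌊ sub f A ⌋ ≡ subFm f ⌊ A ⌋
  ⌊⌋-sub f (s ≐̇ t)     = refl
  ⌊⌋-sub f (s ≺̇ t)     = refl
  ⌊⌋-sub f ⊥̇           = refl
  ⌊⌋-sub f (A ∧̇ B)     = cong₂ _∧_ (⌊⌋-sub f A) (⌊⌋-sub f B)
  ⌊⌋-sub f (A ∨̇ B)     = cong₂ _∨_ (⌊⌋-sub f A) (⌊⌋-sub f B)
  ⌊⌋-sub f (A ⇒̇ B)     = cong₂ _⇒_ (⌊⌋-sub f A) (⌊⌋-sub f B)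
  ⌊⌋-sub f (∀̇ σ A)     = cong (all σ) (⌊⌋-sub (lift f) A)
  ⌊⌋-sub f (∃̇ σ A)     = cong (ex σ) (⌊⌋-sub (lift f) A)
  ⌊⌋-sub f (real x)    = sym (real-sub f x)
  ⌊⌋-sub f (unit x)    = sym (unit-sub f x)
  ⌊⌋-sub f (x =ṙ y)    = sym (=ℝ′-sub f x y)
  ⌊⌋-sub f (x ≤ṙ y)    = sym (≤ℝ′-sub f x y)
  ⌊⌋-sub f (x ≈ y) = sym (≈Q-sub f ⟦ x ⟧ ⟦ y ⟧ (⟦⟧-sub f x) (⟦⟧-sub f y))
  ⌊⌋-sub f (x ≤ y)   = sym (≤Q-sub f ⟦ x ⟧ ⟦ y ⟧ (⟦⟧-sub f x) (⟦⟧-sub f y))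
  ⌊⌋-sub f (x < y)  = sym (<Q-sub f ⟦ x ⟧ ⟦ y ⟧ (⟦⟧-sub f x) (⟦⟧-sub f y))

  ⌊⌋-map-sub : (f : Sub Γ Γ′) (Δ : List (Form Γ)) → map ⌊_⌋ (map (sub f) Δ) ≡ map (subFm f) (map ⌊_⌋ Δ)
  ⌊⌋-map-sub f []      = refl
  ⌊⌋-map-sub f (A ∷ Δ) = cong₂ _∷_ (⌊⌋-sub f A) (⌊⌋-map-sub f Δ)

  -- A record, because `⌊_⌋` is not injective: wrapped up, `Δ` and `A` can be inferred by
  -- unification.
  record _⊢_ {Γ} (Δ : List (Form Γ)) (A : Form Γ) : Set where
    constructor ⟨_⟩
    field un : Γ ∣ map ⌊_⌋ Δ ⊢ ⌊ A ⌋
  open _⊢_ public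

  private variable
    Δ Δ′ : List (Form Γ)
    A B C D E : Form Γ
    x y : Rat Γ

  #0 : A ∷ Δ ⊢ A
  #0 = ⟨ h0 ⟩

  up : Δ ⊢ A → B ∷ Δ ⊢ A
  up ⟨ p ⟩ = ⟨ ↑ p ⟩

  #1 : B ∷ A ∷ Δ ⊢ A
  #1 = up #0

  #2 : C ∷ B ∷ A ∷ Δ ⊢ A
  #2 = up #1

  #3 : D ∷ C ∷ B ∷ A ∷ Δ ⊢ A
  #3 = up #2

  #4 : E ∷ D ∷ C ∷ B ∷ A ∷ Δ ⊢ A
  #4 = up #3

  ⇒I : A ∷ Δ ⊢ B → Δ ⊢ A ⇒̇ B
  ⇒I ⟨ p ⟩ = ⟨ ⇒-intro p ⟩

  ⇒E : Δ ⊢ A ⇒̇ B → Δ ⊢ A → Δ ⊢ B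
  ⇒E ⟨ p ⟩ ⟨ q ⟩ = ⟨ ⇒-elim p q ⟩

  ∧I : Δ ⊢ A → Δ ⊢ B → Δ ⊢ A ∧̇ B
  ∧I ⟨ p ⟩ ⟨ q ⟩ = ⟨ ∧-intro p q ⟩

  ∧E₁ : Δ ⊢ A ∧̇ B → Δ ⊢ A
  ∧E₁ ⟨ p ⟩ = ⟨ ∧-elim₁ p ⟩

  ∧E₂ : Δ ⊢ A ∧̇ B → Δ ⊢ B
  ∧E₂ ⟨ p ⟩ = ⟨ ∧-elim₂ p ⟩

  ∨I₁ : Δ ⊢ A → Δ ⊢ A ∨̇ B
  ∨I₁ ⟨ p ⟩ = ⟨ ∨-intro₁ p ⟩

  ∨I₂ : Δ ⊢ B → Δ ⊢ A ∨̇ B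
  ∨I₂ ⟨ p ⟩ = ⟨ ∨-intro₂ p ⟩

  ∨E : Δ ⊢ A ∨̇ B → A ∷ Δ ⊢ C → B ∷ Δ ⊢ C → Δ ⊢ C
  ∨E ⟨ p ⟩ ⟨ q ⟩ ⟨ r ⟩ = ⟨ ∨-elim p q r ⟩

  ⊥E : Δ ⊢ ⊥̇ → Δ ⊢ A
  ⊥E ⟨ p ⟩ = ⟨ ⊥-elim p ⟩

  RAA : ¬̇ A ∷ Δ ⊢ ⊥̇ → Δ ⊢ A
  RAA ⟨ p ⟩ = ⟨ raa p ⟩

  EM : (A : Form Γ) → Δ ⊢ A ∨̇ ¬̇ A
  EM A = ⟨ em ⌊ A ⌋ ⟩

  ∀I : map wkn Δ ⊢ A → Δ ⊢ ∀̇ σ A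
  ∀I {Δ = Δ} ⟨ p ⟩ = ⟨ ∀-intro (subst (_ ∣_⊢ _) (⌊⌋-map-sub _ Δ) p) ⟩

  ∀E : Δ ⊢ ∀̇ σ A → (t : Tm Γ σ) → Δ ⊢ sub (t ▸ var) A
  ∀E {A = A} ⟨ p ⟩ t = ⟨ subst (_ ∣ _ ⊢_) (sym (⌊⌋-sub _ A)) (∀-elim p t) ⟩

  ∃I : (t : Tm Γ σ) → Δ ⊢ sub (t ▸ var) A → Δ ⊢ ∃̇ σ A
  ∃I {A = A} t ⟨ p ⟩ = ⟨ ∃-intro t (subst (_ ∣ _ ⊢_) (⌊⌋-sub _ A) p) ⟩

  ∃E : Δ ⊢ ∃̇ σ A → A ∷ map wkn Δ ⊢ wkn C → Δ ⊢ C
  ∃E {Δ = Δ} {A = A} {C = C} ⟨ p ⟩ ⟨ q ⟩ = ⟨ ∃-elim p (subst (_ ∣ _ ⊢_) (⌊⌋-sub _ C)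
    (subst (λ Θ → _ ∣ ⌊ A ⌋ ∷ Θ ⊢ ⌊ wkn C ⌋) (⌊⌋-map-sub _ Δ) q)) ⟩

  wkD : Δ ⊢ A → map (wkn {σ = σ}) Δ ⊢ wkn A
  wkD {Δ = Δ} {A = A} ⟨ p ⟩ = ⟨ subst (_ ∣ _ ⊢_) (sym (⌊⌋-sub _ A))
    (subst (_ ∣_⊢ _) (sym (⌊⌋-map-sub _ Δ)) (wk⊢ p)) ⟩

  instantiate : (f : Sub Γ Γ′) → Δ ⊢ A → All (Δ′ ⊢_) (map (sub f) Δ) → Δ′ ⊢ sub f A
  instantiate {Δ = Δ} {A = A} {Δ′ = Δ′} f ⟨ p ⟩ qs =
    ⟨ subst (_ ∣ _ ⊢_) (sym (⌊⌋-sub f A)) (inst f p (go Δ qs)) ⟩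
    where
    go : ∀ Θ → All (Δ′ ⊢_) (map (sub f) Θ) → All (_ ∣ map ⌊_⌋ Δ′ ⊢_) (map (subFm f) (map ⌊_⌋ Θ))
    go []      []       = []
    go (A ∷ Θ) (q ∷ qs) = subst (_ ∣ _ ⊢_) (⌊⌋-sub f A) (un q) ∷ go Θ qs

  specialise : Δ ⊢ ∀̇ σ A → map wkn Δ ⊢ A
  specialise {Δ = Δ} ⟨ p ⟩ = ⟨ subst (_ ∣_⊢ _) (sym (⌊⌋-map-sub _ Δ)) (spec p) ⟩

open Formulas

-- Order and addition of rational expressions.

module Rationals where

  open S using (_:=_; _:+_; _:*_)
  open Frac

  private variable
    Γ : Cxt
    Δ : List (Form Γ)
    A : Form Γ
    Θ : List (Fm Γ)
    a b c d s t : Tm Γ o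
    u v x y z : Rat Γ

  ≤-refl : Δ ⊢ x ≤ x
  ≤-refl = ⟨ ≼-refl ⟩

  ≈⇒≤ : Δ ⊢ x ≈ y → Δ ⊢ x ≤ y
  ≈⇒≤ ⟨ p ⟩ = ⟨ ∨-intro₂ p ⟩

  ≈-sym : Δ ⊢ x ≈ y → Δ ⊢ y ≈ x
  ≈-sym ⟨ p ⟩ = ⟨ ≐-sym p ⟩

  ≈⇒≥ : Δ ⊢ x ≈ y → Δ ⊢ y ≤ x
  ≈⇒≥ p = ≈⇒≤ (≈-sym p)

  ≤-antisym : Δ ⊢ x ≤ y → Δ ⊢ y ≤ x → Δ ⊢ x ≈ y
  ≤-antisym ⟨ p ⟩ ⟨ q ⟩ = ⟨ ≼-antisym p q ⟩

  <⇒≤ : Δ ⊢ x < y → Δ ⊢ x ≤ y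
  <⇒≤ ⟨ p ⟩ = ⟨ ∨-intro₁ p ⟩

  -- The two inequalities are multiplied by the denominators of `z` and `x` and added. The terms
  -- with the numerator of `y` cancel, and so does its denominator, being positive.
  ≤-trans : Δ ⊢ x ≤ y → Δ ⊢ y ≤ z → Δ ⊢ x ≤ z
  ≤-trans {x = x} {y} {z} ⟨ p ⟩ ⟨ q ⟩ = ⟨ ⊠-cancel-≼ (den-pos y)
    (⊞-cancel-≼ (neg ⟦ y ⟧ ⊠ den ⟦ x ⟧ ⊠ den ⟦ z ⟧ ⊞ pos ⟦ y ⟧ ⊠ den ⟦ x ⟧ ⊠ den ⟦ z ⟧)
      (≼-resp
        (S.solve 9 (λ a m d b n e c k f →
            (a :* e :+ n :* d) :* f :+ (b :* f :+ k :* e) :* d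
            := (a :* f :+ k :* d) :* e :+ (n :* d :* f :+ b :* d :* f)) (≐-refl _)
          (pos ⟦ x ⟧) (neg ⟦ x ⟧) (den ⟦ x ⟧) (pos ⟦ y ⟧) (neg ⟦ y ⟧) (den ⟦ y ⟧)
          (pos ⟦ z ⟧) (neg ⟦ z ⟧) (den ⟦ z ⟧))
        (S.solve 9 (λ a m d b n e c k f →
            (b :* d :+ m :* e) :* f :+ (c :* e :+ n :* f) :* d
            := (c :* d :+ m :* f) :* e :+ (n :* d :* f :+ b :* d :* f)) (≐-refl _)
          (pos ⟦ x ⟧) (neg ⟦ x ⟧) (den ⟦ x ⟧) (pos ⟦ y ⟧) (neg ⟦ y ⟧) (den ⟦ y ⟧)
          (pos ⟦ z ⟧) (neg ⟦ z ⟧) (den ⟦ z ⟧))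
        (⊞-mono₂-≼ (⊠-mono-≼ (den ⟦ z ⟧) p) (⊠-mono-≼ (den ⟦ x ⟧) q)))) ⟩

  ≈-trans : Δ ⊢ x ≈ y → Δ ⊢ y ≈ z → Δ ⊢ x ≈ z
  ≈-trans p q = ≤-antisym (≤-trans (≈⇒≤ p) (≈⇒≤ q)) (≤-trans (≈⇒≥ q) (≈⇒≥ p))

  by-≤-or-> : ∀ x y → x ≤ y ∷ Δ ⊢ A → y < x ∷ Δ ⊢ A → Δ ⊢ A
  by-≤-or-> x y p q = ⟨ by-≼-or-≻ (cross x y) (cross y x) (un p) (un q) ⟩

  by-> : y < x ∷ Δ ⊢ x ≤ y → Δ ⊢ x ≤ y
  by-> p = by-≤-or-> _ _ #0 p

  by-≥ : y ≤ x ∷ Δ ⊢ x < y → Δ ⊢ x < y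
  by-≥ p = by-≤-or-> _ _ p #0

  <-≤-contr : Δ ⊢ x < y → Δ ⊢ y ≤ x → Δ ⊢ A
  <-≤-contr ⟨ p ⟩ ⟨ q ⟩ = ⟨ ≺-irr (≺-≼-trans p q) ⟩

  <-≤-trans : Δ ⊢ x < y → Δ ⊢ y ≤ z → Δ ⊢ x < z
  <-≤-trans p q = by-≥ (<-≤-contr (up p) (≤-trans (up q) #0))

  ≤-<-trans : Δ ⊢ x ≤ y → Δ ⊢ y < z → Δ ⊢ x < z
  ≤-<-trans p q = by-≥ (<-≤-contr (up q) (≤-trans #0 (up p)))

  -- The second summand does not change when `x` and `y` are exchanged, up to commuting two
  -- denominators, and the first is `cross x y` times a positive factor. Hence adding `z` both
  -- preserves and reflects the order.
  ⊕-cross : ∀ x y z → Γ ∣ Θ ⊢ cross (x ⊕ z) (y ⊕ z) ≐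
    cross x y ⊠ (den ⟦ z ⟧ ⊠ den ⟦ z ⟧) ⊞
    (pos ⟦ z ⟧ ⊞ neg ⟦ z ⟧) ⊠ (den ⟦ z ⟧ ⊠ (den ⟦ x ⟧ ⊠ den ⟦ y ⟧))
  ⊕-cross x y z = S.solve 7 (λ a d n e c k f →
            (a :* f :+ c :* d) :* (e :* f) :+ (n :* f :+ k :* e) :* (d :* f)
            := (a :* e :+ n :* d) :* (f :* f) :+ (c :+ k) :* (f :* (d :* e))) (≐-refl _)
          (pos ⟦ x ⟧) (den ⟦ x ⟧) (neg ⟦ y ⟧) (den ⟦ y ⟧)
          (pos ⟦ z ⟧) (neg ⟦ z ⟧) (den ⟦ z ⟧)

  ⊕-cross′ : ∀ x y z → Γ ∣ Θ ⊢ cross (y ⊕ z) (x ⊕ z) ≐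
    cross y x ⊠ (den ⟦ z ⟧ ⊠ den ⟦ z ⟧) ⊞
    (pos ⟦ z ⟧ ⊞ neg ⟦ z ⟧) ⊠ (den ⟦ z ⟧ ⊠ (den ⟦ x ⟧ ⊠ den ⟦ y ⟧))
  ⊕-cross′ x y z = ≐-trans (⊕-cross y x z)
    (⊞-congʳ _ (⊠-congʳ _ (⊠-congʳ _ (ax (*-comm _ _)))))

  ⊕-monoˡ : ∀ z → Δ ⊢ x ≤ y → Δ ⊢ x ⊕ z ≤ y ⊕ z
  ⊕-monoˡ {x = x} {y} z ⟨ p ⟩ = ⟨ ≼-resp (≐-sym (⊕-cross x y z)) (≐-sym (⊕-cross′ x y z))
    (⊞-mono-≼ _ (⊠-mono-≼ _ p)) ⟩

  ⊕-cancelʳ : ∀ z → Δ ⊢ x ⊕ z ≤ y ⊕ z → Δ ⊢ x ≤ y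
  ⊕-cancelʳ {x = x} {y} z ⟨ p ⟩ = ⟨ ⊠-cancel-≼ (⊠-pos (den-pos z) (den-pos z))
    (⊞-cancel-≼ _ (≼-resp (⊕-cross x y z) (⊕-cross′ x y z) p)) ⟩

  ⊕-comm : ∀ x y → Δ ⊢ x ⊕ y ≈ y ⊕ x
  ⊕-comm x y = ⟨ S.solve 6 (λ a m d b n e →
      (a :* e :+ b :* d) :* (e :* d) :+ (n :* d :+ m :* e) :* (d :* e)
      := (b :* d :+ a :* e) :* (d :* e) :+ (m :* e :+ n :* d) :* (e :* d)) (≐-refl _)
    (pos ⟦ x ⟧) (neg ⟦ x ⟧) (den ⟦ x ⟧) (pos ⟦ y ⟧) (neg ⟦ y ⟧) (den ⟦ y ⟧) ⟩

  ⊕-assoc : ∀ x y z → Δ ⊢ x ⊕ y ⊕ z ≈ x ⊕ (y ⊕ z)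
  ⊕-assoc x y z = ⟨ S.solve 9 (λ a m d b n e c k f →
      ((a :* e :+ b :* d) :* f :+ c :* (d :* e)) :* (d :* (e :* f)) :+
      (m :* (e :* f) :+ (n :* f :+ k :* e) :* d) :* (d :* e :* f)
      := (a :* (e :* f) :+ (b :* f :+ c :* e) :* d) :* (d :* e :* f) :+
         ((m :* e :+ n :* d) :* f :+ k :* (d :* e)) :* (d :* (e :* f))) (≐-refl _)
    (pos ⟦ x ⟧) (neg ⟦ x ⟧) (den ⟦ x ⟧) (pos ⟦ y ⟧) (neg ⟦ y ⟧) (den ⟦ y ⟧)
    (pos ⟦ z ⟧) (neg ⟦ z ⟧) (den ⟦ z ⟧) ⟩

  ⊕-identityʳ : ∀ j x → Δ ⊢ x ⊕ dy 𝟎 j ≈ x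
  ⊕-identityʳ j x = ⟨ S.solve 4 (λ a m d f →
      (a :* f :+ :0 :* d) :* d :+ m :* (d :* f) := a :* (d :* f) :+ (m :* f :+ :0 :* d) :* d)
    (≐-refl _) (pos ⟦ x ⟧) (neg ⟦ x ⟧) (den ⟦ x ⟧) (2^ j) ⟩

  ⊕-mono : Δ ⊢ x ≤ y → Δ ⊢ u ≤ v → Δ ⊢ x ⊕ u ≤ y ⊕ v
  ⊕-mono p q = ≤-trans (⊕-monoˡ _ p) (≤-trans (≈⇒≤ (⊕-comm _ _)) (≤-trans (⊕-monoˡ _ q) (≈⇒≤ (⊕-comm _ _))))

  ⊕-cong : Δ ⊢ x ≈ y → Δ ⊢ u ≈ v → Δ ⊢ x ⊕ u ≈ y ⊕ v
  ⊕-cong p q = ≤-antisym (⊕-mono (≈⇒≤ p) (≈⇒≤ q)) (⊕-mono (≈⇒≥ p) (≈⇒≥ q))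

  -- Only the additive structure is given to the solver; differences are always moved to the other
  -- side.
  monoid : (Γ : Cxt) (Δ : List (Form Γ)) → CommutativeMonoid _ _
  monoid Γ Δ = record
    { Carrier = Rat Γ
    ; _≈_ = λ x y → Δ ⊢ x ≈ y
    ; _∙_ = _⊕_
    ; ε = dy 𝟎 𝟎
    ; isCommutativeMonoid = record
      { isMonoid = record
        { isSemigroup = record
          { isMagma = record
            { isEquivalence = record { refl = ≤-antisym ≤-refl ≤-refl ; sym = ≈-sym ; trans = ≈-trans }
            ; ∙-cong = ⊕-cong
            }
          ; assoc = ⊕-assoc
          }
        ; identity = (λ x → ≈-trans (⊕-comm _ x) (⊕-identityʳ 𝟎 x)) , ⊕-identityʳ 𝟎
        }
      ; comm = ⊕-comm
      }
    }

  ≈-refl : Δ ⊢ x ≈ x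
  ≈-refl = ≤-antisym ≤-refl ≤-refl

  module M {Γ : Cxt} {Δ : List (Form Γ)} = MonoidSolver (monoid Γ Δ)
  open M using (_⊜_) renaming (_⊕_ to infixl 6 _⊹_)

  -- Linear arithmetic in one step: the second hypothesis says x - y = u - v without subtraction. In
  -- applications `u ≤ v` is a sum of known inequalities and the identity is left to the monoid
  -- solver.
  ≤-linear : Δ ⊢ u ≤ v → Δ ⊢ x ⊕ v ≈ y ⊕ u → Δ ⊢ x ≤ y
  ≤-linear {u = u} {v} p q = ⊕-cancelʳ v (≤-trans (≈⇒≤ q) (≤-trans (≈⇒≤ (⊕-comm _ u))
    (≤-trans (⊕-monoˡ _ p) (≈⇒≤ (⊕-comm v _)))))

  <-linear : Δ ⊢ u < v → Δ ⊢ x ⊕ v ≈ y ⊕ u → Δ ⊢ x < y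
  <-linear {u = u} {v} {x} {y} p q = by-≥ (<-≤-contr (up p)
    (≤-linear #0 (≈-trans (⊕-comm v x) (≈-trans (up q) (⊕-comm y u)))))

  ⊝-inverse : ∀ x → Δ ⊢ x ⊕ ⊝ x ≈ dy 𝟎 𝟎
  ⊝-inverse x = ⟨ S.solve 4 (λ a m d f →
      (a :* d :+ m :* d) :* f :+ :0 :* (d :* d) := :0 :* (d :* d) :+ (m :* d :+ a :* d) :* f)
    (≐-refl _) (pos ⟦ x ⟧) (neg ⟦ x ⟧) (den ⟦ x ⟧) (2^ 𝟎) ⟩

  ⊖-⊕ : ∀ x y → Δ ⊢ x ⊖ y ⊕ y ≈ x
  ⊖-⊕ x y = ⟨ S.solve 6 (λ a m d b n e →
      ((a :* e :+ n :* d) :* e :+ b :* (d :* e)) :* d :+ m :* (d :* e :* e)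
      := a :* (d :* e :* e) :+ ((m :* e :+ b :* d) :* e :+ n :* (d :* e)) :* d)
    (≐-refl _) (pos ⟦ x ⟧) (neg ⟦ x ⟧) (den ⟦ x ⟧) (pos ⟦ y ⟧) (neg ⟦ y ⟧) (den ⟦ y ⟧) ⟩

  half-double : ∀ x → Δ ⊢ half x ⊕ half x ≈ x
  half-double x = ⟨ S.solve 3 (λ a m d →
      (a :* (d :* (:1 :+ :1)) :+ a :* (d :* (:1 :+ :1))) :* d :+ m :* (d :* (:1 :+ :1) :* (d :* (:1 :+ :1)))
      := a :* (d :* (:1 :+ :1) :* (d :* (:1 :+ :1))) :+
         (m :* (d :* (:1 :+ :1)) :+ m :* (d :* (:1 :+ :1))) :* d)
    (≐-refl _) (pos ⟦ x ⟧) (neg ⟦ x ⟧) (den ⟦ x ⟧) ⟩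

  dy-add : ∀ c d j → Δ ⊢ dy (c ⊞ d) j ≈ dy c j ⊕ dy d j
  dy-add c d j = ⟨ S.solve 3 (λ c d e →
      (c :+ d) :* (e :* e) :+ (:0 :* e :+ :0 :* e) :* e
      := (c :* e :+ d :* e) :* e :+ :0 :* (e :* e)) (≐-refl _) c d (2^ j) ⟩

  dy-suc : ∀ c j → Δ ⊢ dy (c ⊞ c) (j ⊞ 𝟏) ≈ dy c j
  dy-suc c j = ⟨ ≐-trans
    (S.solve 3 (λ c e f → (c :+ c) :* e :+ :0 :* f := c :* (e :+ e)) (≐-refl _) c (2^ j) (2^ (j ⊞ 𝟏)))
    (≐-trans (⊠-congʳ c (≐-sym (2^-suc j)))
    (S.solve 3 (λ c e f → c :* f := c :* f :+ :0 :* e) (≐-refl _) c (2^ j) (2^ (j ⊞ 𝟏)))) ⟩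

  dy-mono : ∀ j → Δ ⊢ c ≼̇ d → Δ ⊢ dy c j ≤ dy d j
  dy-mono j ⟨ p ⟩ = ⟨ ⊞-mono-≼ _ (⊠-mono-≼ _ p) ⟩

  dy-mono-< : ∀ j → Δ ⊢ c ≺̇ d → Δ ⊢ dy c j < dy d j
  dy-mono-< j ⟨ p ⟩ = ⟨ ⊞-mono-≺ _ (⊠-mono-≺ (2^-pos j) p) ⟩

  dy-cong : Δ ⊢ a ≐̇ b → Δ ⊢ c ≐̇ d → Δ ⊢ dy a c ≈ dy b d
  dy-cong ⟨ p ⟩ ⟨ q ⟩ = ⟨ ⊞-cong₂ (⊠-cong₂ p (≐-sym (2^-cong q))) (⊠-congʳ _ (2^-cong q)) ⟩
    where
    ⊞-cong₂ = ≐-cong₂ (con plus)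
    ⊠-cong₂ = ≐-cong₂ (con times)

  -- If x exceeded y, the integers `cross x y` and `cross y x` would differ by at least 1. Taking
  -- `i` to be the product `D` of the denominators then yields 2^D ≤ D, contrary to `n≺2^n`.
  archimedean : ((i : Tm Γ o) → Δ ⊢ x ≤ y ⊕ dy 𝟏 i) → Δ ⊢ x ≤ y
  archimedean {x = x} {y} h = ⟨ ≼-by-contradiction (≺-irr (≺-≼-trans (n≺2^n D)
    (⊞-cancel-≼ (cross y x ⊠ 2^ D) (≼-tr
      (≼-resp (S.solve 2 (λ m n → (m :+ :1) :* n := n :+ m :* n) (≐-refl _) _ _) (≐-refl _)
        (⊠-mono-≼ (2^ D) (m≺n⇒m+1≼n h0)))
      (≼-resp
        (S.solve 6 (λ a d n e f c → a :* (e :* f) :+ (n :* f :+ :0 :* e) :* d := (a :* e :+ n :* d) :* f)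
          (≐-refl _) (pos ⟦ x ⟧) (den ⟦ x ⟧) (neg ⟦ y ⟧) (den ⟦ y ⟧) (2^ D) (2^ D))
        (S.solve 5 (λ m d b e f → (b :* f :+ :1 :* e) :* d :+ m :* (e :* f)
                               := d :* e :+ (b :* d :+ m :* e) :* f)
          (≐-refl _) (neg ⟦ x ⟧) (den ⟦ x ⟧) (pos ⟦ y ⟧) (den ⟦ y ⟧) (2^ D))
        (↑ (un (h D)))))))) ⟩
    where
    D = den ⟦ x ⟧ ⊠ den ⟦ y ⟧

  -- A code stores the denominator minus one; `den-pos` ensures that `pred` loses nothing.
  encode : Rat Γ → Tm Γ o
  encode x = pair (pair (pos ⟦ x ⟧) (neg ⟦ x ⟧)) (pred (den ⟦ x ⟧))

  ≈-from-parts : Γ ∣ map ⌊_⌋ Δ ⊢ pos ⟦ x ⟧ ≐ pos ⟦ y ⟧ → Γ ∣ map ⌊_⌋ Δ ⊢ neg ⟦ x ⟧ ≐ neg ⟦ y ⟧ →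
                 Γ ∣ map ⌊_⌋ Δ ⊢ den ⟦ x ⟧ ≐ den ⟦ y ⟧ → Δ ⊢ x ≈ y
  ≈-from-parts p q r = ⟨ ≐-cong₂ (con plus) (≐-cong₂ (con times) p (≐-sym r))
                                            (≐-cong₂ (con times) (≐-sym q) r) ⟩

  decode : ∀ q x → Δ ⊢ q ≐̇ encode x → Δ ⊢ code q ≈ x
  decode q x ⟨ p ⟩ = ≈-from-parts
    (≐-trans (fst-cong (≐-trans (fst-cong p) (fst-pair _ _))) (fst-pair _ _))
    (≐-trans (snd-cong (≐-trans (fst-cong p) (fst-pair _ _))) (snd-pair _ _))
    (≐-trans (⊞-congˡ 𝟏 (≐-trans (snd-cong p) (snd-pair _ _))) (pred-pos (den-pos x)))

  code-cong : Δ ⊢ s ≐̇ t → Δ ⊢ code s ≈ code t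
  code-cong ⟨ p ⟩ = ≈-from-parts (fst-cong (fst-cong p)) (snd-cong (fst-cong p)) (⊞-congˡ 𝟏 (snd-cong p))

  2^-≈2^1- : ∀ n → Δ ⊢ dy (𝟏 ⊞ 𝟏) n ≈ dy 𝟏 n ⊕ dy 𝟏 n
  2^-≈2^1- n = dy-add 𝟏 𝟏 n

  ⊖-<⇒< : Δ ⊢ x ⊖ y < z → Δ ⊢ x < z ⊕ y
  ⊖-<⇒< {x = x} {y} {z} p = <-≤-trans (≤-<-trans (≈⇒≥ (⊖-⊕ x y)) (<-linear p
    (M.solve 3 (λ d y z → d ⊹ y ⊹ z ⊜ z ⊹ y ⊹ d) ≈-refl (x ⊖ y) y z))) ≤-refl

  <⇒⊖-< : Δ ⊢ x < z ⊕ y → Δ ⊢ x ⊖ y < z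
  <⇒⊖-< {x = x} {z} {y} p = <-linear (≤-<-trans (≈⇒≤ (⊖-⊕ x y)) p)
    (M.solve 3 (λ d y z → d ⊹ (z ⊹ y) ⊜ z ⊹ (d ⊹ y)) ≈-refl (x ⊖ y) y z)

  ⊖-≤⇒≤ : Δ ⊢ x ⊖ y ≤ z → Δ ⊢ x ≤ z ⊕ y
  ⊖-≤⇒≤ {x = x} {y} {z} p = ≤-trans (≈⇒≥ (⊖-⊕ x y)) (⊕-monoˡ y p)

  ≤⇒⊖-≤ : Δ ⊢ x ≤ z ⊕ y → Δ ⊢ x ⊖ y ≤ z
  ≤⇒⊖-≤ {x = x} {y = y} p = ⊕-cancelʳ y (≤-trans (≈⇒≤ (⊖-⊕ x y)) p)

  ⊝-⊖ : ∀ x y → Δ ⊢ ⊝ (x ⊖ y) ≈ y ⊖ x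
  ⊝-⊖ x y = ≤-antisym (⊕-cancelʳ x (≈⇒≤ q)) (⊕-cancelʳ x (≈⇒≥ q))
    where
    q : _ ⊢ ⊝ (x ⊖ y) ⊕ x ≈ y ⊖ x ⊕ x
    q = ≈-trans (⊕-cong ≈-refl (≈-sym (⊖-⊕ x y))) (≈-trans
      (M.solve 3 (λ d n y → n ⊹ (d ⊹ y) ⊜ d ⊹ n ⊹ y) ≈-refl (x ⊖ y) (⊝ (x ⊖ y)) y)
      (≈-trans (⊕-cong (⊝-inverse (x ⊖ y)) ≈-refl)
      (≈-trans (≈-trans (⊕-comm _ y) (⊕-identityʳ 𝟎 y)) (≈-sym (⊖-⊕ y x)))))

  ⊝⊖-<⇒< : Δ ⊢ ⊝ (x ⊖ y) < z → Δ ⊢ y < z ⊕ x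
  ⊝⊖-<⇒< p = ⊖-<⇒< (≤-<-trans (≈⇒≥ (⊝-⊖ _ _)) p)

  <⇒⊝⊖-< : Δ ⊢ y < z ⊕ x → Δ ⊢ ⊝ (x ⊖ y) < z
  <⇒⊝⊖-< p = ≤-<-trans (≈⇒≤ (⊝-⊖ _ _)) (<⇒⊖-< p)

  ⊝⊖-≤⇒≤ : Δ ⊢ ⊝ (x ⊖ y) ≤ z → Δ ⊢ y ≤ z ⊕ x
  ⊝⊖-≤⇒≤ p = ⊖-≤⇒≤ (≤-trans (≈⇒≥ (⊝-⊖ _ _)) p)

  ≤⇒⊝⊖-≤ : Δ ⊢ y ≤ z ⊕ x → Δ ⊢ ⊝ (x ⊖ y) ≤ z
  ≤⇒⊝⊖-≤ p = ≤-trans (≈⇒≤ (⊝-⊖ _ _)) (≤⇒⊖-≤ p)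

open Rationals

-- Reals as fast converging sequences, and their order.

module Reals where

  open M using (_⊜_) renaming (_⊕_ to infixl 6 _⊹_)

  private variable
    Γ : Cxt
    Δ : List (Form Γ)
    Θ : List (Form Γ)
    A : Form Γ
    σ τ : Ty
    u v w x y z : Rat Γ
    X Y Z : Tm Γ T1

  e 2e 4e : Tm Γ o → Rat Γ
  e n = dy 𝟏 n
  2e n = e n ⊕ e n
  4e n = 2e n ⊕ 2e n

  infixl 9 _at_
  _at_ : Tm Γ T1 → Tm Γ o → Rat Γ
  x at n = code (x · n)

  2^-mono : ∀ {Δ} (s t : Tm Γ o) → Γ ∣ Δ ⊢ 2^ s ≼ 2^ (s ⊞ t)
  2^-mono s t = inst (t ▸ s ▸ nil) (induction (qf (2^ v1 ≼ 2^ (v1 ⊞ v0)))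
    (≼-resp (≐-refl _) (≐-sym (2^-cong (ax (+-identity _)))) ≼-refl)
    (≼-resp (≐-refl _) (≐-sym (≐-trans (2^-cong (≐-sym (ax (+-assoc _ _ _)))) (2^-suc _)))
      (≼-tr h0 (m≼m+n _ _)))) []

  e-anti : ∀ s t → Θ ⊢ e (s ⊞ t) ≤ e s
  e-anti s t = ⟨ ⊞-mono₂-≼ (≼-resp (ax (*-comm _ _)) (ax (*-comm _ _)) (⊠-mono-≼ 𝟏 (2^-mono s t)))
    (≼-resp (≐-sym (≐-trans (ax (*-comm _ _)) (ax (*-zero _)))) (≐-refl _) (0≼ _)) ⟩

  e-anti′ : ∀ s t → Θ ⊢ e (s ⊞ t) ≤ e t
  e-anti′ s t = ≤-trans (≈⇒≤ (dy-cong ⟨ ≐-refl _ ⟩ ⟨ ax (+-comm _ _) ⟩)) (e-anti t s)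

  2e-suc : ∀ n → Θ ⊢ 2e (n ⊞ 𝟏) ≈ e n
  2e-suc n = ≈-trans (≈-sym (2^-≈2^1- _)) (dy-suc 𝟏 _)

  4e-suc-suc : ∀ n → Θ ⊢ 4e (n ⊞ 𝟏 ⊞ 𝟏) ≈ e n
  4e-suc-suc n = ≈-trans (⊕-cong (2e-suc _) (2e-suc _)) (2e-suc _)

  dy-nonneg : ∀ c j x → Θ ⊢ x ≤ dy c j ⊕ x
  dy-nonneg c j x = ≤-trans (≈⇒≥ (⊕-identityʳ j x))
    (≤-trans (⊕-mono ≤-refl (dy-mono j ⟨ 0≼ c ⟩)) (≈⇒≤ (⊕-comm _ _)))

  2e-nonneg : ∀ n x → Θ ⊢ x ≤ 2e n ⊕ x
  2e-nonneg n x = ≤-trans (dy-nonneg 𝟏 n x)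
    (≤-trans (dy-nonneg 𝟏 n (e n ⊕ x)) (≈⇒≥ (⊕-assoc _ _ _)))

  double-cancel : Θ ⊢ x ⊕ x ≤ y ⊕ y → Θ ⊢ x ≤ y
  double-cancel {x = x} {y} p = by-> (<-≤-contr
    (≤-<-trans (⊕-mono ≤-refl (<⇒≤ #0))
               (<-linear #0 (M.solve 2 (λ x y → y ⊹ x ⊹ x ⊜ x ⊹ x ⊹ y) ≈-refl x y)))
    (up p))

  double-cancel-< : Θ ⊢ x ⊕ x < y ⊕ y → Θ ⊢ x < y
  double-cancel-< p = by-≥ (<-≤-contr (up p) (⊕-mono #0 #0))

  sub-wk : (t : Tm Γ τ) → subTm (λ x → var (there {x = σ} x)) t ≡ wk t
  sub-wk (var x) = refl
  sub-wk (con c) = refl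
  sub-wk (s · t) = cong₂ _·_ (sub-wk s) (sub-wk t)

  ≼-or-≻̇ : ∀ (s t : Tm Γ o) → s ≼̇ t ∷ Δ ⊢ A → t ≺̇ s ∷ Δ ⊢ A → Δ ⊢ A
  ≼-or-≻̇ s t p q = ⟨ by-≼-or-≻ s t (un p) (un q) ⟩

  private
    realF : Form (T1 ∷ [])
    realF = ∀̇ o (∀̇ o (v2 at v1 ⊖ v2 at (v1 ⊞ v0) < e v1 ∧̇ ⊝ (v2 at v1 ⊖ v2 at (v1 ⊞ v0)) < e v1))
    leqF : Form (T1 ∷ T1 ∷ [])
    leqF = ∀̇ o (v1 at v0 ⊖ v2 at v0 ≤ dy (𝟏 ⊞ 𝟏) v0)
    eqF : Form (T1 ∷ T1 ∷ [])
    eqF = ∀̇ o (v1 at v0 ⊖ v2 at v0 ≤ dy (𝟏 ⊞ 𝟏) v0 ∧̇ ⊝ (v1 at v0 ⊖ v2 at v0) ≤ dy (𝟏 ⊞ 𝟏) v0)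

    -- An atom and its unfolding have the same image under `⌊_⌋`, so the hypothesis itself is the
    -- proof. Stating this for variables keeps the conversion check small.
    real⇒ : real v0 ∷ [] ⊢ realF
    real⇒ = ⟨ h0 ⟩
    ⇒real : realF ∷ [] ⊢ real v0
    ⇒real = ⟨ h0 ⟩
    leq⇒ : v0 ≤ṙ v1 ∷ [] ⊢ leqF
    leq⇒ = ⟨ h0 ⟩
    ⇒leq : leqF ∷ [] ⊢ v0 ≤ṙ v1
    ⇒leq = ⟨ h0 ⟩
    eq⇒ : v0 =ṙ v1 ∷ [] ⊢ eqF
    eq⇒ = ⟨ h0 ⟩
    ⇒eq : eqF ∷ [] ⊢ v0 =ṙ v1
    ⇒eq = ⟨ h0 ⟩

  wk-≤ṙ : Δ ⊢ X ≤ṙ Y → map (wkn {σ = σ}) Δ ⊢ wk X ≤ṙ wk Y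
  wk-≤ṙ {X = X} {Y} p = subst₂ (λ X Y → _ ⊢ X ≤ṙ Y) (sub-wk X) (sub-wk Y) (wkD p)

  wk-=ṙ : Δ ⊢ X =ṙ Y → map (wkn {σ = σ}) Δ ⊢ wk X =ṙ wk Y
  wk-=ṙ {X = X} {Y} p = subst₂ (λ X Y → _ ⊢ X =ṙ Y) (sub-wk X) (sub-wk Y) (wkD p)

  real-elim : Δ ⊢ real X → ∀ n i → (Δ ⊢ X at n < e n ⊕ X at (n ⊞ i)) × (Δ ⊢ X at (n ⊞ i) < e n ⊕ X at n)
  real-elim {X = X} d n i = ⊖-<⇒< ((∧E₁ p)) , ⊝⊖-<⇒< ((∧E₂ p))
    where
    p = instantiate (i ▸ n ▸ X ▸ nil) (specialise (specialise real⇒)) (d ∷ [])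

  real-intro : map wkn (map wkn Δ) ⊢ wk (wk X) at v1 < e v1 ⊕ wk (wk X) at (v1 ⊞ v0) →
               map wkn (map wkn Δ) ⊢ wk (wk X) at (v1 ⊞ v0) < e v1 ⊕ wk (wk X) at v1 →
               Δ ⊢ real X
  real-intro {X = X} p q = instantiate (X ▸ nil) ⇒real
    (∀I (∀I (∧I ((<⇒⊖-< p)) ((<⇒⊝⊖-< q)))) ∷ [])

  real-elim≼ : Δ ⊢ real X → ∀ m n → Δ ⊢ m ≼̇ n → (Δ ⊢ X at m < e m ⊕ X at n) × (Δ ⊢ X at n < e m ⊕ X at m)
  real-elim≼ {X = X} d m n p =
    <-≤-trans (proj₁ (real-elim d m (n ∸ᵗ m))) (⊕-mono ≤-refl (≈⇒≤ q)) ,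
    ≤-<-trans (≈⇒≥ q) (proj₂ (real-elim d m (n ∸ᵗ m)))
    where
    q = code-cong ⟨ ≐-cong X (m+[n∸m]≐n (un p)) ⟩

  ≤ṙ-elim : Δ ⊢ X ≤ṙ Y → ∀ n → Δ ⊢ X at n ≤ 2e n ⊕ Y at n
  ≤ṙ-elim {X = X} {Y} d n = ≤-trans
    (⊖-≤⇒≤ (instantiate (n ▸ X ▸ Y ▸ nil) (specialise leq⇒) (d ∷ [])))
    (⊕-monoˡ _ (≈⇒≤ (2^-≈2^1- n)))

  ≤ṙ-intro : map wkn Δ ⊢ wk X at v0 ≤ 2e v0 ⊕ wk Y at v0 → Δ ⊢ X ≤ṙ Y
  ≤ṙ-intro {X = X} {Y} p = instantiate (X ▸ Y ▸ nil) ⇒leq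
    (∀I ((≤⇒⊖-≤ (≤-trans p (⊕-monoˡ _ (≈⇒≥ (2^-≈2^1- v0)))))) ∷ [])

  =ṙ⇒≤ṙ : Δ ⊢ X =ṙ Y → Δ ⊢ X ≤ṙ Y
  =ṙ⇒≤ṙ {X = X} {Y} d = ≤ṙ-intro (≤-trans
    (⊖-≤⇒≤ (∧E₁ (instantiate (v0 ▸ wk X ▸ wk Y ▸ nil) (specialise eq⇒) (wk-=ṙ d ∷ []))))
    (⊕-monoˡ _ (≈⇒≤ (2^-≈2^1- v0))))

  =ṙ⇒≥ṙ : Δ ⊢ X =ṙ Y → Δ ⊢ Y ≤ṙ X
  =ṙ⇒≥ṙ {X = X} {Y} d = ≤ṙ-intro (≤-trans
    (⊝⊖-≤⇒≤ (∧E₂ (instantiate (v0 ▸ wk X ▸ wk Y ▸ nil) (specialise eq⇒) (wk-=ṙ d ∷ []))))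
    (⊕-monoˡ _ (≈⇒≤ (2^-≈2^1- v0))))

  ≤ṙ-antisym : Δ ⊢ X ≤ṙ Y → Δ ⊢ Y ≤ṙ X → Δ ⊢ X =ṙ Y
  ≤ṙ-antisym {X = X} {Y} p q = instantiate (X ▸ Y ▸ nil) ⇒eq (∀I (∧I
    (≤⇒⊖-≤ (≤-trans (≤ṙ-elim (wk-≤ṙ p) v0) (⊕-monoˡ _ (≈⇒≥ (2^-≈2^1- v0)))))
    (≤⇒⊝⊖-≤ (≤-trans (≤ṙ-elim (wk-≤ṙ q) v0) (⊕-monoˡ _ (≈⇒≥ (2^-≈2^1- v0)))))) ∷ [])

  -- The constant 4 leaves room for the error of a composition of two inequalities.
  ≤ṙ-criterion : Δ ⊢ real X → Δ ⊢ real Y → map wkn Δ ⊢ wk X at v0 ≤ 4e v0 ⊕ wk Y at v0 → Δ ⊢ X ≤ṙ Y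
  ≤ṙ-criterion {X = X} {Y} p q h = instantiate (X ▸ Y ▸ nil) main (p ∷ q ∷ ∀I (h) ∷ [])
    where
    H : List (Form (T1 ∷ T1 ∷ []))
    H = real v0 ∷ real v1 ∷ ∀̇ o (v1 at v0 ≤ 4e v0 ⊕ v2 at v0) ∷ []
    step : ∀ i → map wkn H ⊢ v1 at v0 ≤ 2e v0 ⊕ v2 at v0 ⊕ e i
    step i = ≤-linear
          (⊕-mono (⊕-mono (⊕-mono (<⇒≤ (proj₁ (real-elim #0 v0 (i ⊞ 𝟏 ⊞ 𝟏))))
                                  ((∀E #2 m)))
                          (<⇒≤ (proj₂ (real-elim #1 v0 (i ⊞ 𝟏 ⊞ 𝟏)))))
                  (≤-trans (⊕-mono (⊕-mono em≤ em≤) (⊕-mono em≤ em≤)) (≈⇒≤ (4e-suc-suc i))))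
          (M.solve 7 (λ xn en xm f ym yn ei →
              xn ⊹ (en ⊹ xm ⊹ (f ⊹ ym) ⊹ (en ⊹ yn) ⊹ ei) ⊜
              en ⊹ en ⊹ yn ⊹ ei ⊹ (xn ⊹ xm ⊹ ym ⊹ f)) ≈-refl
            (v1 at v0) (e v0) (v1 at m) (4e m) (v2 at m) (v2 at v0) (e i))
      where
      -- The comparison is made `i ⊞ 𝟏 ⊞ 𝟏` places further on, where the error `4e m` is at most
      -- `e i`; passing to `m` and back costs `e v0` each way, which is the `2e v0` allowed.
      m = v0 ⊞ (i ⊞ 𝟏 ⊞ 𝟏)
      em≤ = e-anti′ v0 (i ⊞ 𝟏 ⊞ 𝟏)
    main : H ⊢ v0 ≤ṙ v1
    main = ≤ṙ-intro (archimedean step)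

  ≤ṙ-trans : Δ ⊢ real X → Δ ⊢ real Z → Δ ⊢ X ≤ṙ Y → Δ ⊢ Y ≤ṙ Z → Δ ⊢ X ≤ṙ Z
  ≤ṙ-trans {X = X} {Z} {Y} p q r s = ≤ṙ-criterion p q
    (≤-linear (⊕-mono (≤ṙ-elim (wk-≤ṙ r) v0) (≤ṙ-elim (wk-≤ṙ s) v0))
      (M.solve 4 (λ x y z e → x ⊹ (e ⊹ e ⊹ y ⊹ (e ⊹ e ⊹ z)) ⊜ e ⊹ e ⊹ (e ⊹ e) ⊹ z ⊹ (x ⊹ y))
        ≈-refl (wk X at v0) (wk Y at v0) (wk Z at v0) (e v0)))

  -- Suppose that at some index n the term of `X` exceeds that of `Y` by more than 4·2^-n. Then
  -- `Y ≤ṙ X` holds at every index k, contradicting `X <ṙ Y`: for k ≥ n the gap absorbs the loss of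
  -- 2·2^-n in passing from n to k, and for k < n the loss of 2·2^-k is what `≤ṙ` tolerates.
  <ṙ⇒≤ṙ : Δ ⊢ real X → Δ ⊢ real Y → Δ ⊢ X <ṙ Y → Δ ⊢ X ≤ṙ Y
  <ṙ⇒≤ṙ {X = X} {Y} p q r = instantiate (Y ▸ X ▸ nil) main (r ∷ q ∷ p ∷ [])
    where
    chain : Θ ⊢ u ⊕ x < y → Θ ⊢ w < v ⊕ x → Θ ⊢ y < v ⊕ z → Θ ⊢ u ⊕ w ≤ v ⊕ v ⊕ z
    chain {u = u} {x} {y} {w} {v} {z} p q r =
      ≤-linear (⊕-mono (⊕-mono (<⇒≤ p) (<⇒≤ q)) (<⇒≤ r))
        (M.solve 6 (λ u x y w v z →
          u ⊹ w ⊹ (y ⊹ (v ⊹ x) ⊹ (v ⊹ z)) ⊜ v ⊹ v ⊹ z ⊹ (u ⊹ x ⊹ w ⊹ y)) ≈-refl u x y w v z)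
    H : List (Form (o ∷ o ∷ T1 ∷ T1 ∷ []))
    H = 4e v1 ⊕ v2 at v1 < v3 at v1 ∷ ¬̇ (v2 ≤ṙ v3) ∷ real v2 ∷ real v3 ∷ []
    near : v1 ≼̇ v0 ∷ H ⊢ v2 at v0 ≤ 2e v0 ⊕ v3 at v0
    near = ≤-trans (2e-nonneg v1 _) (≤-trans
      (⊕-cancelʳ (2e v1) (≤-linear
        (chain (#1) (proj₂ (real-elim≼ #3 v1 v0 #0)) (proj₁ (real-elim≼ #4 v1 v0 #0)))
        (M.solve 3 (λ e x y → e ⊹ e ⊹ x ⊹ (e ⊹ e) ⊹ (e ⊹ e ⊹ y) ⊜
                              y ⊹ (e ⊹ e) ⊹ (e ⊹ e ⊹ (e ⊹ e) ⊹ x))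
          ≈-refl (e v1) (v2 at v0) (v3 at v0))))
      (2e-nonneg v0 _))
    far : v0 ≺̇ v1 ∷ H ⊢ v2 at v0 ≤ 2e v0 ⊕ v3 at v0
    far = ≤-trans (≤-trans (2e-nonneg v1 _) (≤-trans (2e-nonneg v1 _) (≈⇒≥ (⊕-assoc _ _ _))))
      (chain (#1) (proj₁ (real-elim≼ #3 v0 v1 (∨I₁ #0))) (proj₂ (real-elim≼ #4 v0 v1 (∨I₁ #0))))
    main : ¬̇ (v0 ≤ṙ v1) ∷ real v0 ∷ real v1 ∷ [] ⊢ v1 ≤ṙ v0
    main = ≤ṙ-criterion #2 #1 ((by-≤-or-> (v2 at v0) (4e v0 ⊕ v1 at v0) #0
      (⊥E (⇒E #1 (≤ṙ-intro ((≼-or-≻̇ v1 v0 (near) (far))))))))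

  =ṙ-sym : Δ ⊢ X =ṙ Y → Δ ⊢ Y =ṙ X
  =ṙ-sym p = ≤ṙ-antisym (=ṙ⇒≥ṙ p) (=ṙ⇒≤ṙ p)

  =ṙ-trans : Δ ⊢ real X → Δ ⊢ real Z → Δ ⊢ X =ṙ Y → Δ ⊢ Y =ṙ Z → Δ ⊢ X =ṙ Z
  =ṙ-trans p q r s = ≤ṙ-antisym (≤ṙ-trans p q (=ṙ⇒≤ṙ r) (=ṙ⇒≤ṙ s)) (≤ṙ-trans q p (=ṙ⇒≥ṙ s) (=ṙ⇒≥ṙ r))

open Reals

-- Characteristic terms, induction and comprehension for arithmetical formulas.

module Arithmetical where

  private variable
    Γ Γ′ : Cxt
    ρ σ σ₁ σ₂ σ₃ τ : Ty
    s t : Tm Γ o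

  module _ where
    private variable
      Δ : List (Fm Γ)
      A B : Fm Γ

    data Arith {Γ : Cxt} : Fm Γ → Set where
      _≐_ : ∀ s t → Arith (s ≐ t)
      _≺_ : ∀ s t → Arith (s ≺ t)
      ⊥   : Arith ⊥
      _∧_ : Arith A → Arith B → Arith (A ∧ B)
      _∨_ : Arith A → Arith B → Arith (A ∨ B)
      _⇒_ : Arith A → Arith B → Arith (A ⇒ B)
      all : {A : Fm (o ∷ Γ)} → Arith A → Arith (all o A)
      ex  : {A : Fm (o ∷ Γ)} → Arith A → Arith (ex o A)

    cast : A ≡ B → Γ ∣ Δ ⊢ A → Γ ∣ Δ ⊢ B
    cast refl p = p

    -- Kleene's number quantifier as a functional of type 2, with value 0 exactly on the functions
    -- that vanish identically.
    Kleene : (T1 ⇾ o) ∈ Γ → Form Γ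
    Kleene i = ∀̇ T1 ((var (there i) · v0 ≐̇ 𝟎 ⇒̇ ∀̇ o (v1 · v0 ≐̇ 𝟎)) ∧̇
                     (∀̇ o (v1 · v0 ≐̇ 𝟎) ⇒̇ var (there i) · v0 ≐̇ 𝟎))

    -- The value 0 stands for truth.
    χ : (T1 ⇾ o) ∈ Γ → {A : Fm Γ} → Arith A → Tm Γ o
    χ i (s ≐ t) = (s ∸ᵗ t) ⊞ (t ∸ᵗ s)
    χ i (s ≺ t) = (s ⊞ 𝟏) ∸ᵗ t
    χ i ⊥       = 𝟏
    χ i (a ∧ b) = χ i a ⊞ χ i b
    χ i (a ∨ b) = χ i a ⊠ χ i b
    χ i (a ⇒ b) = (𝟏 ∸ᵗ χ i a) ⊠ χ i b
    χ i (all a) = var i · lam (χ (there i) a)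
    χ i (ex a)  = 𝟏 ∸ᵗ var i · lam (𝟏 ∸ᵗ χ (there i) a)

    infix 3.5 _⇔_
    _⇔_ : Fm Γ → Fm Γ → Fm Γ
    A ⇔ B = (A ⇒ B) ∧ (B ⇒ A)

    fwd : Γ ∣ Δ ⊢ A ⇔ B → Γ ∣ Δ ⊢ A → Γ ∣ Δ ⊢ B
    fwd p = ⇒-elim (∧-elim₁ p)

    bwd : Γ ∣ Δ ⊢ A ⇔ B → Γ ∣ Δ ⊢ B → Γ ∣ Δ ⊢ A
    bwd p = ⇒-elim (∧-elim₂ p)

    m∸n≐0⇒m≼n : Γ ∣ Δ ⊢ s ∸ᵗ t ≐ 𝟎 → Γ ∣ Δ ⊢ s ≼ t
    m∸n≐0⇒m≼n {s = s} {t} p = ≼-by-contradiction (≼-resp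
      (≐-trans (≐-trans (≐-sym (ax (+-identity t))) (⊞-congʳ t (≐-sym (↑ p)))) (m+[n∸m]≐n (∨-intro₁ h0)))
      (≐-refl t) ≼-refl)

    0≐1 : Γ ∣ Δ ⊢ 𝟏 ≐ 𝟎 → Γ ∣ Δ ⊢ A
    0≐1 p = ≺-irr (≺-resp (≐-refl 𝟎) p (ax 0≺1))

    sum-zero : Γ ∣ Δ ⊢ s ⊞ t ≐ 𝟎 → Γ ∣ Δ ⊢ s ≐ 𝟎
    sum-zero p = ≼-antisym (≼-resp (≐-refl _) p (m≼m+n _ _)) (0≼ _)

    sum-zero′ : Γ ∣ Δ ⊢ s ⊞ t ≐ 𝟎 → Γ ∣ Δ ⊢ t ≐ 𝟎
    sum-zero′ p = sum-zero (≐-trans (ax (+-comm _ _)) p)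

    zero-zero : Γ ∣ Δ ⊢ s ≐ 𝟎 → Γ ∣ Δ ⊢ t ≐ 𝟎 → Γ ∣ Δ ⊢ s ⊞ t ≐ 𝟎
    zero-zero p q = ≐-trans (≐-cong₂ (con plus) p q) (ax (+-identity 𝟎))

    prod-zero : Γ ∣ Δ ⊢ s ⊠ t ≐ 𝟎 → Γ ∣ Δ ⊢ (s ≐ 𝟎) ∨ (t ≐ 𝟎)
    prod-zero {s = s} {t} p = ∨-elim (zero-or-pos s) (∨-intro₁ h0)
      (∨-elim (zero-or-pos t) (∨-intro₂ h0)
        (≺-irr (≺-resp (≐-refl 𝟎) (↑ (↑ p)) (⊠-pos h1 h0))))

    zero-prod : ∀ t → Γ ∣ Δ ⊢ s ≐ 𝟎 → Γ ∣ Δ ⊢ s ⊠ t ≐ 𝟎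
    zero-prod t p = ≐-trans (⊠-congˡ t p) (≐-trans (ax (*-comm _ _)) (ax (*-zero t)))

    prod-zero′ : ∀ s → Γ ∣ Δ ⊢ t ≐ 𝟎 → Γ ∣ Δ ⊢ s ⊠ t ≐ 𝟎
    prod-zero′ s p = ≐-trans (⊠-congʳ s p) (ax (*-zero s))

    1∸0 : Γ ∣ Δ ⊢ t ≐ 𝟎 → Γ ∣ Δ ⊢ 𝟏 ∸ᵗ t ≐ 𝟏
    1∸0 p = ≐-trans (∸-cong (≐-refl _) p) (∸-zero 𝟏)

    1∸pos : Γ ∣ Δ ⊢ 𝟎 ≺ t → Γ ∣ Δ ⊢ 𝟏 ∸ᵗ t ≐ 𝟎
    1∸pos p = m≼n⇒m∸n≐0 (≼-resp (⊞-identityˡ _) (≐-refl _) (m≺n⇒m+1≼n p))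

    1∸≐0⇒≢0 : Γ ∣ Δ ⊢ 𝟏 ∸ᵗ t ≐ 𝟎 → Γ ∣ Δ ⊢ t ≐ 𝟎 → Γ ∣ Δ ⊢ A
    1∸≐0⇒≢0 p q = 0≐1 (≐-trans (≐-sym (1∸0 q)) p)

    1∸-dichotomy : ∀ t → Γ ∣ Δ ⊢ t ≐ 𝟎 ∨ 𝟏 ∸ᵗ t ≐ 𝟎
    1∸-dichotomy t = ∨-elim (zero-or-pos t) (∨-intro₁ h0) (∨-intro₂ (1∸pos h0))

    ⇔-trans : Γ ∣ Δ ⊢ A ⇔ B → {C : Fm Γ} → Γ ∣ Δ ⊢ B ⇔ C → Γ ∣ Δ ⊢ A ⇔ C
    ⇔-trans p q = ∧-intro (⇒-intro (fwd (↑ q) (fwd (↑ p) h0))) (⇒-intro (bwd (↑ p) (bwd (↑ q) h0)))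

    not-spec : Γ ∣ Δ ⊢ (t ≐ 𝟎) ⇔ A → Γ ∣ Δ ⊢ (𝟏 ∸ᵗ t ≐ 𝟎) ⇔ ~ A
    not-spec {t = t} p = ∧-intro
      (⇒-intro (⇒-intro (1∸≐0⇒≢0 h1 (bwd (↑ (↑ p)) h0))))
      (⇒-intro (∨-elim (1∸-dichotomy t) (⊥-elim (⇒-elim h1 (fwd (↑ (↑ p)) h0))) h0))

    all-spec : (i : (T1 ⇾ o) ∈ Γ) {t : Tm (o ∷ Γ) o} {A : Fm (o ∷ Γ)} → Γ ∣ Δ ⊢ ⌊ Kleene i ⌋ →
               o ∷ Γ ∣ map wkFm Δ ⊢ (t ≐ 𝟎) ⇔ A → Γ ∣ Δ ⊢ (var i · lam t ≐ 𝟎) ⇔ all o A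
    all-spec i {t} k p = ∧-intro
      (⇒-intro (∀-intro (fwd (↑ p) (≐-trans (≐-sym (lam-β t)) (spec (⇒-elim (∧-elim₁ (↑ k′)) h0))))))
      (⇒-intro (⇒-elim (∧-elim₂ (↑ k′)) (∀-intro (≐-trans (lam-β t) (bwd (↑ p) (spec h0))))))
      where
      k′ = ∀-elim k (lam t)

    ¬∀¬⇔∃ : {A : Fm (σ ∷ Γ)} → Γ ∣ Δ ⊢ (~ all σ (~ A)) ⇔ ex σ A
    ¬∀¬⇔∃ {A = A} = ∧-intro
      (⇒-intro (raa (⇒-elim h1 (∀-intro (⇒-intro
        (⇒-elim h1 (∃-intro v0 (cast (sym A≡) h0))))))))
      (⇒-intro (⇒-intro (∃-elim h1 (⇒-elim (↑ (spec h0)) h0))))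
      where
      h : ∀ {ρ} (x : ρ ∈ _ ∷ _) → subTm (v0 ▸ var) (lift (λ y → var (there y)) x) ≡ var x
      h (here refl) = refl
      h (there x)   = refl
      A≡ = trans (subFm-sub (v0 ▸ var) (lift λ y → var (there y)) A)
                 (trans (subFm-cong h A) (subFm-id (λ _ → refl) A))

    χ-spec : ∀ (i : (T1 ⇾ o) ∈ Γ) {A} (a : Arith A) → Γ ∣ Δ ⊢ ⌊ Kleene i ⌋ → Γ ∣ Δ ⊢ (χ i a ≐ 𝟎) ⇔ A
    χ-spec i (s ≐ t) k = ∧-intro
      (⇒-intro (≼-antisym (m∸n≐0⇒m≼n (sum-zero h0)) (m∸n≐0⇒m≼n (sum-zero′ h0))))
      (⇒-intro (zero-zero (m≼n⇒m∸n≐0 (∨-intro₂ h0)) (m≼n⇒m∸n≐0 (∨-intro₂ (≐-sym h0)))))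
    χ-spec i (s ≺ t) k = ∧-intro
      (⇒-intro (≺-≼-trans (n≺n+1 s) (m∸n≐0⇒m≼n h0)))
      (⇒-intro (m≼n⇒m∸n≐0 (m≺n⇒m+1≼n h0)))
    χ-spec i ⊥ k = ∧-intro (⇒-intro (0≐1 h0)) (⇒-intro (⊥-elim h0))
    χ-spec i (a ∧ b) k = ∧-intro
      (⇒-intro (∧-intro (fwd (↑ (χ-spec i a k)) (sum-zero h0)) (fwd (↑ (χ-spec i b k)) (sum-zero′ h0))))
      (⇒-intro (zero-zero (bwd (↑ (χ-spec i a k)) (∧-elim₁ h0)) (bwd (↑ (χ-spec i b k)) (∧-elim₂ h0))))
    χ-spec i (a ∨ b) k = ∧-intro
      (⇒-intro (∨-elim (prod-zero h0) (∨-intro₁ (fwd (↑ (↑ (χ-spec i a k))) h0))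
                                      (∨-intro₂ (fwd (↑ (↑ (χ-spec i b k))) h0))))
      (⇒-intro (∨-elim h0 (zero-prod _ (bwd (↑ (↑ (χ-spec i a k))) h0))
                          (prod-zero′ _ (bwd (↑ (↑ (χ-spec i b k))) h0))))
    χ-spec i (a ⇒ b) k = ∧-intro
      (⇒-intro (⇒-intro (∨-elim (prod-zero h1)
        (1∸≐0⇒≢0 h0 (bwd (↑ (↑ (↑ (χ-spec i a k)))) h1))
        (fwd (↑ (↑ (↑ (χ-spec i b k)))) h0))))
      (⇒-intro (∨-elim (1∸-dichotomy (χ i a))
        (prod-zero′ _ (bwd (↑ (↑ (χ-spec i b k))) (⇒-elim h1 (fwd (↑ (↑ (χ-spec i a k))) h0))))
        (zero-prod _ h0)))
    χ-spec i (all a) k = all-spec i k (χ-spec (there i) a (wk⊢ k))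
    χ-spec i (ex a)  k = ⇔-trans (not-spec (all-spec i k (not-spec (χ-spec (there i) a (wk⊢ k))))) ¬∀¬⇔∃

    -- The axiom is applied to `χ ≐ 𝟎`, which is quantifier-free because the quantifiers of `A` have
    -- moved into a term.
    arith-induction : (i : (T1 ⇾ o) ∈ Γ) {A : Fm (o ∷ Γ)} → Arith A → Γ ∣ Δ ⊢ ⌊ Kleene i ⌋ →
                      Γ ∣ Δ ⊢ A [ 𝟎 ] →
                      o ∷ Γ ∣ A ∷ map wkFm Δ ⊢ subFm (v0 ⊞ 𝟏 ▸ λ x → var (there x)) A →
                      o ∷ Γ ∣ map wkFm Δ ⊢ A
    arith-induction {Δ = Δ} i {A} a k p q = fwd c⇔A (induction (c ≐ 𝟎)
      (⇒-elim (∀-elim (∀-intro (∧-elim₂ c⇔A)) 𝟎) p)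
      (⇒-elim (↑ (∧-elim₂ (sub⊢ f stable c⇔A))) (⇒-elim (↑ (⇒-intro q)) (fwd (↑ c⇔A) h0))))
      where
      c = χ (there i) a
      c⇔A = χ-spec (there i) a (wk⊢ k)
      f : Sub _ _
      f = v0 ⊞ 𝟏 ▸ λ x → var (there x)
      -- The remaining hypotheses are weakened and do not mention the induction variable, so
      -- replacing it by its successor leaves them alone.
      stable : ∀ {B} → B ∈ map wkFm Δ → subFm f B ∈ map wkFm Δ
      stable m with ∈-map⁻ wkFm m
      ... | B , j , refl = subst (_∈ _) (sym (subFm-sub f _ B)) (∈-map⁺ wkFm j)

    lam₃-β : (t : Tm (σ₃ ∷ σ₂ ∷ σ₁ ∷ Γ) τ) →
             σ₃ ∷ σ₂ ∷ σ₁ ∷ Γ ∣ Δ ⊢ eq τ (wk (wk (wk (lam (lam (lam t))) · v0) · v0) · v0) t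
    lam₃-β {τ = τ} t = eq-trans τ (closed (spec (lam₂-β (lam t)))) (lam-β t)

  -- The atoms about reals count as arithmetical: their arguments have type 1, but the quantifiers
  -- in their definitions range over indices of type 0.
  arith? : (A : Form Γ) → Maybe (Arith ⌊ A ⌋)
  arith? (s ≐̇ t) = just (s ≐ t)
  arith? (s ≺̇ t) = just (s ≺ t)
  arith? ⊥̇ = just ⊥
  arith? (A ∧̇ B) with arith? A | arith? B
  ... | just a | just b = just (a ∧ b)
  ... | _ | _ = nothing
  arith? (A ∨̇ B) with arith? A | arith? B
  ... | just a | just b = just (a ∨ b)
  ... | _ | _ = nothing
  arith? (A ⇒̇ B) with arith? A | arith? B
  ... | just a | just b = just (a ⇒ b)
  ... | _ | _ = nothing
  arith? (∀̇ o A) with arith? A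
  ... | just a = just (all a)
  ... | nothing = nothing
  arith? (∀̇ (_ ⇾ _) A) = nothing
  arith? (∃̇ o A) with arith? A
  ... | just a = just (ex a)
  ... | nothing = nothing
  arith? (∃̇ (_ ⇾ _) A) = nothing
  arith? (real x) = just (all (all ((_ ≺ _) ∧ (_ ≺ _))))
  arith? (unit x) = just (all (all ((_ ≺ _) ∧ (_ ≺ _))) ∧ all ((_ ≺ _) ∨ (_ ≐ _)) ∧ all ((_ ≺ _) ∨ (_ ≐ _)))
  arith? (x =ṙ y) = just (all (((_ ≺ _) ∨ (_ ≐ _)) ∧ ((_ ≺ _) ∨ (_ ≐ _))))
  arith? (x ≤ṙ y) = just (all ((_ ≺ _) ∨ (_ ≐ _)))
  arith? (x ≤ y) = just ((_ ≺ _) ∨ (_ ≐ _))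
  arith? (x < y) = just (_ ≺ _)
  arith? (x ≈ y) = just (_ ≐ _)

  arith : (A : Form Γ) → From-just (arith? A)
  arith A = from-just (arith? A)

  private variable
    Δ : List (Form Γ)
    A B : Form Γ

  shift₁ : Sub (o ∷ Γ) (o ∷ Γ)
  shift₁ = v0 ⊞ 𝟏 ▸ λ x → var (there x)

  numInd : (A : Form (o ∷ Γ)) → QF ⌊ A ⌋ → Δ ⊢ sub (𝟎 ▸ var) A → A ∷ map wkn Δ ⊢ sub shift₁ A → map wkn Δ ⊢ A
  numInd {Δ = Δ} A a p q = ⟨ subst (_ ∣_⊢ _) (sym (⌊⌋-map-sub _ Δ))
    (induction a (cast (⌊⌋-sub _ A) (un p))
      (subst (λ Θ → _ ∣ ⌊ A ⌋ ∷ Θ ⊢ _) (⌊⌋-map-sub _ Δ) (cast (⌊⌋-sub shift₁ A) (un q)))) ⟩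

  arithInd : (i : (T1 ⇾ o) ∈ Γ) (A : Form (o ∷ Γ)) → Arith ⌊ A ⌋ → Δ ⊢ Kleene i →
             Δ ⊢ sub (𝟎 ▸ var) A → A ∷ map wkn Δ ⊢ sub shift₁ A → map wkn Δ ⊢ A
  arithInd {Δ = Δ} i A a k p q = ⟨ subst (_ ∣_⊢ _) (sym (⌊⌋-map-sub _ Δ))
    (arith-induction i a (un k) (cast (⌊⌋-sub _ A) (un p))
      (subst (λ Θ → _ ∣ ⌊ A ⌋ ∷ Θ ⊢ _) (⌊⌋-map-sub _ Δ) (cast (⌊⌋-sub shift₁ A) (un q)))) ⟩

  wk₂ : Sub (σ₂ ∷ σ₁ ∷ Γ) (σ₂ ∷ σ₁ ∷ ρ ∷ Γ)
  wk₂ = lift (lift λ x → var (there x))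

  wk₃ : Sub (σ₃ ∷ σ₂ ∷ σ₁ ∷ Γ) (σ₃ ∷ σ₂ ∷ σ₁ ∷ ρ ∷ Γ)
  wk₃ = lift (lift (lift λ x → var (there x)))

  wk₂-cancel : (F : Tm Γ ρ) → ∀ {σ} (x : σ ∈ σ₂ ∷ σ₁ ∷ Γ) → subTm (lift (lift (F ▸ var))) (wk₂ x) ≡ var x
  wk₂-cancel F (here refl)         = refl
  wk₂-cancel F (there (here refl)) = refl
  wk₂-cancel F (there (there x))   = refl

  wk₃-cancel : (F : Tm Γ ρ) → ∀ {σ} (x : σ ∈ σ₃ ∷ σ₂ ∷ σ₁ ∷ Γ) →
               subTm (lift (lift (lift (F ▸ var)))) (wk₃ x) ≡ var x
  wk₃-cancel F (here refl)                 = refl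
  wk₃-cancel F (there (here refl))         = refl
  wk₃-cancel F (there (there (here refl))) = refl
  wk₃-cancel F (there (there (there x)))   = refl

  subTm-cancel : {g : Sub Γ′ Γ} {f : Sub Γ Γ′} → (∀ {σ} (x : σ ∈ Γ) → subTm g (f x) ≡ var x) →
                 (t : Tm Γ τ) → subTm g (subTm f t) ≡ t
  subTm-cancel {g = g} {f} h t = trans (subTm-sub g f t) (subTm-id h t)

  subRat-cancel : {g : Sub Γ′ Γ} {f : Sub Γ Γ′} → (∀ {σ} (x : σ ∈ Γ) → subTm g (f x) ≡ var x) →
                  (x : Rat Γ) → subRat g (subRat f x) ≡ x
  subRat-cancel h (code q) = cong code (subTm-cancel h q)
  subRat-cancel h (dy c j) = cong₂ dy (subTm-cancel h c) (subTm-cancel h j)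
  subRat-cancel h (x ⊕ y)  = cong₂ _⊕_ (subRat-cancel h x) (subRat-cancel h y)
  subRat-cancel h (x ⊖ y)  = cong₂ _⊖_ (subRat-cancel h x) (subRat-cancel h y)
  subRat-cancel h (⊝ x)    = cong ⊝_ (subRat-cancel h x)
  subRat-cancel h (half x) = cong half (subRat-cancel h x)

  castF : A ≡ B → Δ ⊢ A → Δ ⊢ B
  castF refl p = p

  -- An existential statement, so that callers obtain the functional as a variable and never handle
  -- the combinators into which its λ-term expands.
  function₂ : (t : Tm (σ₂ ∷ σ₁ ∷ Γ) o) →
              Δ ⊢ ∃̇ (σ₁ ⇾ σ₂ ⇾ o) (∀̇ σ₁ (∀̇ σ₂ (v2 · v1 · v0 ≐̇ subTm wk₂ t)))
  function₂ t = ∃I F (∀I (∀I (castF (cong (wk (wk F) · v1 · v0 ≐̇_) (sym (subTm-cancel (wk₂-cancel F) t)))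
    ⟨ lam₂-β t ⟩)))
    where
    F = lam (lam t)

  sequence₂ : (x : Rat (o ∷ σ₂ ∷ σ₁ ∷ Γ)) →
              Δ ⊢ ∃̇ (σ₁ ⇾ σ₂ ⇾ T1) (∀̇ σ₁ (∀̇ σ₂ (∀̇ o ((v3 · v2 · v1) at v0 ≈ subRat wk₃ x))))
  sequence₂ x = ∃I F (∀I (∀I (∀I (castF (cong (code (wk (wk (wk F)) · v2 · v1 · v0) ≈_) (sym (subRat-cancel (wk₃-cancel F) x)))
    (decode _ x ⟨ lam₃-β (encode x) ⟩)))))
    where
    F = lam (lam (lam (encode x)))

  comprehension : (i : (T1 ⇾ o) ∈ Γ) (A : Form (T1 ∷ T1 ∷ Γ)) → Arith ⌊ A ⌋ → Δ ⊢ Kleene i →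
    Δ ⊢ ∃̇ T1² (∀̇ T1 (∀̇ T1 (((v2 · v1 · v0 ≐̇ 𝟏 ⇒̇ sub wk₂ A) ∧̇ (sub wk₂ A ⇒̇ v2 · v1 · v0 ≐̇ 𝟏))
      ∧̇ (v2 · v1 · v0 ≐̇ 𝟎 ∨̇ v2 · v1 · v0 ≐̇ 𝟏))))
  comprehension {Γ = Γ} {Δ = Δ} i A a k = ⟨ ∃-intro F (∀-intro (∀-intro (∧-intro (∧-intro
    (⇒-intro (cast A≡ (fwd spec′ (≐-one (≐-trans (≐-sym β) h0)))))
    (⇒-intro (≐-trans β (1∸0 (bwd spec′ (cast (sym A≡) h0))))))
    (∨-elim (1∸-dichotomy c) (∨-intro₂ (≐-trans β (1∸0 h0))) (∨-intro₁ (≐-trans β h0)))))) ⟩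
    where
    c = χ (there (there i)) a
    F : Tm Γ T1²
    -- The truth value is flipped, since `χ` marks truth by 0 and a characteristic function marks
    -- membership by 1.
    F = lam (lam (𝟏 ∸ᵗ c))
    β : ∀ {Θ} → T1 ∷ T1 ∷ Γ ∣ Θ ⊢ wk (wk F) · v1 · v0 ≐ 𝟏 ∸ᵗ c
    β = lam₂-β (𝟏 ∸ᵗ c)
    spec′ : ∀ {B} → T1 ∷ T1 ∷ Γ ∣ B ∷ map wkFm (map wkFm (map ⌊_⌋ Δ)) ⊢ (c ≐ 𝟎) ⇔ ⌊ A ⌋
    spec′ = ↑ (χ-spec (there (there i)) a (wk⊢ (wk⊢ (un k))))
    ≐-one : ∀ {Θ : List (Fm (T1 ∷ T1 ∷ Γ))} → T1 ∷ T1 ∷ Γ ∣ Θ ⊢ 𝟏 ∸ᵗ c ≐ 𝟏 → T1 ∷ T1 ∷ Γ ∣ Θ ⊢ c ≐ 𝟎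
    ≐-one p = ∨-elim (1∸-dichotomy c) h0 (0≐1 (≐-trans (≐-sym (↑ p)) h0))
    A≡ : ⌊ A ⌋ ≡ subFm (lift (lift (F ▸ var))) ⌊ sub wk₂ A ⌋
    A≡ = sym (trans (cong (subFm _) (⌊⌋-sub wk₂ A))
      (trans (subFm-sub _ wk₂ ⌊ A ⌋) (subFm-id (wk₂-cancel F) ⌊ A ⌋)))

open Arithmetical

-- Translates, midpoints and dyadic constants.

module Translates where

  open M using (_⊜_) renaming (_⊕_ to infixl 6 _⊹_)

  private variable
    Γ : Cxt
    Δ : List (Form Γ)
    A : Form Γ
    X Y Z W : Tm Γ T1
    u v w x y z x′ y′ z′ : Rat Γ

  ⊕-mono-< : Δ ⊢ x < y → Δ ⊢ u < v → Δ ⊢ x ⊕ u < y ⊕ v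
  ⊕-mono-< {x = x} {y} {u} {v} p q = <-≤-trans
    (<-linear p (M.solve 3 (λ x y u → x ⊹ u ⊹ y ⊜ y ⊹ u ⊹ x) ≈-refl x y u))
    (⊕-mono ≤-refl (<⇒≤ q))

  e-pos : ∀ n x → Δ ⊢ x < e n ⊕ x
  e-pos n x = ≤-<-trans (≈⇒≥ (⊕-identityʳ n x)) (<-linear (dy-mono-< n ⟨ ax 0≺1 ⟩)
      (M.solve 3 (λ x z e → x ⊹ z ⊹ e ⊜ e ⊹ x ⊹ z) ≈-refl x (dy 𝟎 n) (e n)))

  2e-pos : ∀ n x → Δ ⊢ x < 2e n ⊕ x
  2e-pos n x = <-≤-trans (e-pos n x) (≤-trans (dy-nonneg 𝟏 n (e n ⊕ x)) (≈⇒≥ (⊕-assoc _ _ _)))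

  e≰2e : ∀ n → Δ ⊢ e n ≤ 2e (n ⊞ 𝟏 ⊞ 𝟏) → Δ ⊢ A
  e≰2e n p = <-≤-contr (2e-pos m (2e m)) (≤-trans (≈⇒≤ (4e-suc-suc n)) p)
    where m = n ⊞ 𝟏 ⊞ 𝟏

  module _ (p : Δ ⊢ x′ ≈ x ⊕ z) (q : Δ ⊢ y′ ≈ y ⊕ z) where

    private
      swap : Δ ⊢ x′ ⊕ (w ⊕ y) ≈ w ⊕ y′ ⊕ x
      swap {w = w} = ≈-trans (⊕-cong p ≈-refl) (≈-trans
        (M.solve 4 (λ x y z w → x ⊹ z ⊹ (w ⊹ y) ⊜ w ⊹ (y ⊹ z) ⊹ x) ≈-refl x y z w)
        (⊕-cong (⊕-cong ≈-refl (≈-sym q)) ≈-refl))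
      swap′ : Δ ⊢ x ⊕ (w ⊕ y′) ≈ w ⊕ y ⊕ x′
      swap′ {w = w} = ≈-trans (⊕-cong ≈-refl (⊕-cong ≈-refl q)) (≈-trans
        (M.solve 4 (λ x y z w → x ⊹ (w ⊹ (y ⊹ z)) ⊜ w ⊹ y ⊹ (x ⊹ z)) ≈-refl x y z w)
        (⊕-cong ≈-refl (≈-sym p)))

    translate-≤ : Δ ⊢ x ≤ w ⊕ y → Δ ⊢ x′ ≤ w ⊕ y′
    translate-≤ r = ≤-linear r swap

    translate-< : Δ ⊢ x < w ⊕ y → Δ ⊢ x′ < w ⊕ y′
    translate-< r = <-linear r swap

    untranslate-≤ : Δ ⊢ x′ ≤ w ⊕ y′ → Δ ⊢ x ≤ w ⊕ y
    untranslate-≤ r = ≤-linear r swap′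

    untranslate-< : Δ ⊢ x′ < w ⊕ y′ → Δ ⊢ x < w ⊕ y
    untranslate-< r = <-linear r swap′

  -- The relation holds index by index and not merely up to `=ṙ`. So the modulus of convergence and
  -- all inequalities pass between the two sequences without reindexing, in both directions.
  shift : Tm Γ o → Tm Γ T1 → Tm Γ T1 → Form Γ
  shift j X Y = ∀̇ o (wk Y at v0 ≈ wk X at v0 ⊕ e (wk j))

  -- Doubled, to keep fractions out of the calculations; `double-cancel` removes the factor at the
  -- end.
  mid : Tm Γ T1 → Tm Γ T1 → Tm Γ T1 → Form Γ
  mid X Y Z = ∀̇ o (wk Z at v0 ⊕ wk Z at v0 ≈ wk X at v0 ⊕ wk Y at v0)

  const : Tm Γ o → Tm Γ o → Tm Γ T1 → Form Γ
  const c j X = ∀̇ o (wk X at v0 ≈ dy (wk c) (wk j))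

  shift-real : ∀ j X Y → Δ ⊢ shift j X Y → Δ ⊢ real X → Δ ⊢ real Y
  shift-real j X Y p q = instantiate (j ▸ X ▸ Y ▸ nil) main (p ∷ q ∷ [])
    where
    main : shift v0 v1 v2 ∷ real v1 ∷ [] ⊢ real {o ∷ T1 ∷ T1 ∷ []} v2
    main = real-intro (translate-< (∀E #0 v1) (∀E #0 (v1 ⊞ v0)) (proj₁ (real-elim #1 v1 v0)))
                      (translate-< (∀E #0 (v1 ⊞ v0)) (∀E #0 v1) (proj₂ (real-elim #1 v1 v0)))

  shift-real⁻ : ∀ j X Y → Δ ⊢ shift j X Y → Δ ⊢ real Y → Δ ⊢ real X
  shift-real⁻ j X Y p q = instantiate (j ▸ X ▸ Y ▸ nil) main (p ∷ q ∷ [])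
    where
    main : shift v0 v1 v2 ∷ real v2 ∷ [] ⊢ real {o ∷ T1 ∷ T1 ∷ []} v1
    main = real-intro (untranslate-< (∀E #0 v1) (∀E #0 (v1 ⊞ v0)) (proj₁ (real-elim #1 v1 v0)))
                      (untranslate-< (∀E #0 (v1 ⊞ v0)) (∀E #0 v1) (proj₂ (real-elim #1 v1 v0)))

  shift-≤ : ∀ j X Y Z W → Δ ⊢ shift j X Y → Δ ⊢ shift j Z W → Δ ⊢ X ≤ṙ Z → Δ ⊢ Y ≤ṙ W
  shift-≤ j X Y Z W p q r = instantiate (j ▸ X ▸ Y ▸ Z ▸ W ▸ nil) main (p ∷ q ∷ r ∷ [])
    where
    main : shift v0 v1 v2 ∷ shift v0 v3 (wk v3) ∷ v1 ≤ṙ v3 ∷ [] ⊢ _≤ṙ_ {o ∷ T1 ∷ T1 ∷ T1 ∷ T1 ∷ []} v2 (wk v3)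
    main = ≤ṙ-intro (translate-≤ (∀E #0 v0) (∀E #1 v0) (≤ṙ-elim #2 v0))

  shift-≤⁻ : ∀ j X Y Z W → Δ ⊢ shift j X Y → Δ ⊢ shift j Z W → Δ ⊢ Y ≤ṙ W → Δ ⊢ X ≤ṙ Z
  shift-≤⁻ j X Y Z W p q r = instantiate (j ▸ X ▸ Y ▸ Z ▸ W ▸ nil) main (p ∷ q ∷ r ∷ [])
    where
    main : shift v0 v1 v2 ∷ shift v0 v3 (wk v3) ∷ v2 ≤ṙ wk v3 ∷ [] ⊢ _≤ṙ_ {o ∷ T1 ∷ T1 ∷ T1 ∷ T1 ∷ []} v1 v3
    main = ≤ṙ-intro (untranslate-≤ (∀E #0 v0) (∀E #1 v0) (≤ṙ-elim #2 v0))

  shift-< : ∀ j X Y → Δ ⊢ shift j X Y → Δ ⊢ X <ṙ Y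
  shift-< j X Y p = instantiate (j ▸ X ▸ Y ▸ nil) main (p ∷ [])
    where
    main : shift v0 v1 v2 ∷ [] ⊢ _<ṙ_ {o ∷ T1 ∷ T1 ∷ []} v1 v2
    main = ⇒I (e≰2e v0 (≤-linear (⊕-mono (≤ṙ-elim #0 m) (≈⇒≥ (∀E #1 m)))
      (M.solve 4 (λ e₀ y x e → e₀ ⊹ (e ⊹ e ⊹ x ⊹ y) ⊜ e ⊹ e ⊹ (y ⊹ (x ⊹ e₀))) ≈-refl
        (e v0) (v2 at m) (v1 at m) (e m))))
      -- Two places beyond the exponent of the translation, the tolerance 2·2^-m of `≤ṙ` is half of
      -- the translation and cannot hide it.
      where m = v0 ⊞ 𝟏 ⊞ 𝟏

  pointwise-≤ : map wkn Δ ⊢ wk X at v0 ≤ wk Y at v0 → Δ ⊢ X ≤ṙ Y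
  pointwise-≤ p = ≤ṙ-intro (≤-trans p (2e-nonneg v0 _))

  module _ (p : Δ ⊢ z ⊕ z ≈ x ⊕ y) (p′ : Δ ⊢ z′ ⊕ z′ ≈ x′ ⊕ y′) where

    private
      doubled : Δ ⊢ w ⊕ x′ ⊕ (w ⊕ y′) ≤ w ⊕ z′ ⊕ (w ⊕ z′)
      doubled {w = w} = ≤-trans
        (≈⇒≤ (M.solve 3 (λ w x y → w ⊹ x ⊹ (w ⊹ y) ⊜ w ⊹ w ⊹ (x ⊹ y)) ≈-refl w x′ y′))
        (≤-trans (⊕-mono ≤-refl (≈⇒≥ p′))
        (≈⇒≤ (M.solve 2 (λ w z → w ⊹ w ⊹ (z ⊹ z) ⊜ w ⊹ z ⊹ (w ⊹ z)) ≈-refl w z′)))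

    average-≤ : Δ ⊢ x ≤ w ⊕ x′ → Δ ⊢ y ≤ w ⊕ y′ → Δ ⊢ z ≤ w ⊕ z′
    average-≤ q r = double-cancel (≤-trans (≈⇒≤ p) (≤-trans (⊕-mono q r) doubled))

    average-< : Δ ⊢ x < w ⊕ x′ → Δ ⊢ y < w ⊕ y′ → Δ ⊢ z < w ⊕ z′
    average-< q r = double-cancel-< (≤-<-trans (≈⇒≤ p) (<-≤-trans (⊕-mono-< q r) doubled))

  mid-real : ∀ X Y Z → Δ ⊢ mid X Y Z → Δ ⊢ real X → Δ ⊢ real Y → Δ ⊢ real Z
  mid-real X Y Z p q r = instantiate (X ▸ Y ▸ Z ▸ nil) main (p ∷ q ∷ r ∷ [])
    where
    main : mid v0 v1 v2 ∷ real v0 ∷ real v1 ∷ [] ⊢ real {T1 ∷ T1 ∷ T1 ∷ []} v2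
    main = real-intro
      (average-< (∀E #0 v1) (∀E #0 (v1 ⊞ v0)) (proj₁ (real-elim #1 v1 v0)) (proj₁ (real-elim #2 v1 v0)))
      (average-< (∀E #0 (v1 ⊞ v0)) (∀E #0 v1) (proj₂ (real-elim #1 v1 v0)) (proj₂ (real-elim #2 v1 v0)))

  mid-≤ : ∀ X Y Z X′ Y′ Z′ → Δ ⊢ mid X Y Z → Δ ⊢ mid X′ Y′ Z′ → Δ ⊢ X ≤ṙ X′ → Δ ⊢ Y ≤ṙ Y′ → Δ ⊢ Z ≤ṙ Z′
  mid-≤ X Y Z X′ Y′ Z′ p p′ q r = instantiate (X ▸ Y ▸ Z ▸ X′ ▸ Y′ ▸ Z′ ▸ nil) main (p ∷ p′ ∷ q ∷ r ∷ [])
    where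
    v4 : ∀ {Γ ρ₀ ρ₁ ρ₂ ρ₃ ρ₄} → Tm (ρ₀ ∷ ρ₁ ∷ ρ₂ ∷ ρ₃ ∷ ρ₄ ∷ Γ) ρ₄
    v4 = wk v3
    v5 : ∀ {Γ ρ₀ ρ₁ ρ₂ ρ₃ ρ₄ ρ₅} → Tm (ρ₀ ∷ ρ₁ ∷ ρ₂ ∷ ρ₃ ∷ ρ₄ ∷ ρ₅ ∷ Γ) ρ₅
    v5 = wk v4
    main : mid v0 v1 v2 ∷ mid v3 v4 v5 ∷ v0 ≤ṙ v3 ∷ v1 ≤ṙ v4 ∷ [] ⊢ _≤ṙ_ {T1 ∷ T1 ∷ T1 ∷ T1 ∷ T1 ∷ T1 ∷ []} v2 v5
    main = ≤ṙ-intro (average-≤ (∀E #0 v0) (∀E #1 v0) (≤ṙ-elim #2 v0) (≤ṙ-elim #3 v0))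

  -- Adding the two translations gives 2W = X + Y = 2Z at every index. This identifies the midpoint
  -- of the interval built around a point with that point.
  mid-unique : ∀ j X Y Z W → Δ ⊢ shift j X Z → Δ ⊢ shift j Z Y → Δ ⊢ mid X Y W → Δ ⊢ W =ṙ Z
  mid-unique j X Y Z W p q r = instantiate (j ▸ X ▸ Y ▸ Z ▸ W ▸ nil) main (p ∷ q ∷ r ∷ [])
    where
    H : List (Form (o ∷ T1 ∷ T1 ∷ T1 ∷ T1 ∷ []))
    H = shift v0 v1 v3 ∷ shift v0 v3 v2 ∷ mid v1 v2 (wk v3) ∷ []
    double : map wkn H ⊢ wk (wk v3) at v0 ⊕ wk (wk v3) at v0 ≈ wk v3 at v0 ⊕ wk v3 at v0
    double = ≈-trans (∀E #2 v0) (≈-trans (⊕-cong ≈-refl (∀E #1 v0)) (≈-trans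
      (M.solve 3 (λ x z e → x ⊹ (z ⊹ e) ⊜ (x ⊹ e) ⊹ z) ≈-refl (v2 at v0) (wk v3 at v0) (e v1))
      (⊕-cong (≈-sym (∀E #0 v0)) ≈-refl)))
    main : H ⊢ wk v3 =ṙ v3
    main = ≤ṙ-antisym (pointwise-≤ (double-cancel (≈⇒≤ double))) (pointwise-≤ (double-cancel (≈⇒≥ double)))

  const-real : ∀ c j X → Δ ⊢ const c j X → Δ ⊢ real X
  const-real c j X p = instantiate (c ▸ j ▸ X ▸ nil) main (p ∷ [])
    where
    step : ∀ {Γ} {Δ : List (Form Γ)} {n x y z} → Δ ⊢ x ≈ z → Δ ⊢ y ≈ z → Δ ⊢ x < e n ⊕ y
    step p q = ≤-<-trans (≈⇒≤ (≈-trans p (≈-sym q))) (e-pos _ _)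
    main : const v0 v1 v2 ∷ [] ⊢ real {o ∷ o ∷ T1 ∷ []} v2
    main = real-intro (step (∀E #0 v1) (∀E #0 (v1 ⊞ v0))) (step (∀E #0 (v1 ⊞ v0)) (∀E #0 v1))

  const-≤ : ∀ c i X d j Y → Δ ⊢ const c i X → Δ ⊢ const d j Y → Δ ⊢ dy c i ≤ dy d j → Δ ⊢ X ≤ṙ Y
  const-≤ c i X d j Y p q r = instantiate (c ▸ i ▸ X ▸ d ▸ j ▸ Y ▸ nil) main (p ∷ q ∷ r ∷ [])
    where
    main : const v0 v1 v2 ∷ const v3 (wk v3) (wk (wk v3)) ∷ dy v0 v1 ≤ dy v3 (wk v3) ∷ []
           ⊢ _≤ṙ_ {o ∷ o ∷ T1 ∷ o ∷ o ∷ T1 ∷ []} v2 (wk (wk v3))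
    main = pointwise-≤ (≤-trans (≈⇒≤ (∀E #0 v0)) (≤-trans #2 (≈⇒≥ (∀E #1 v0))))

  -- Here `X` and `Y` are the ends of the interval of radius 2^-j about `Z`, so they differ by
  -- exactly 2·2^-j, and a dyadic bound on the left end becomes one on the right end.
  const-shift-≤ : ∀ j X Z Y c i V d k W → Δ ⊢ shift j X Z → Δ ⊢ shift j Z Y →
                  Δ ⊢ const c i V → Δ ⊢ const d k W → Δ ⊢ dy c i ⊕ e j ⊕ e j ≤ dy d k → Δ ⊢ X ≤ṙ V → Δ ⊢ Y ≤ṙ W
  const-shift-≤ j X Z Y c i V d k W p q r s h l =
    instantiate (j ▸ X ▸ Z ▸ Y ▸ c ▸ i ▸ V ▸ d ▸ k ▸ W ▸ nil) main (p ∷ q ∷ r ∷ s ∷ h ∷ l ∷ [])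
    where
    Ψ : Cxt
    Ψ = o ∷ T1 ∷ T1 ∷ T1 ∷ o ∷ o ∷ T1 ∷ o ∷ o ∷ T1 ∷ []
    c′ i′ d′ k′ : Tm Ψ o
    c′ = wk v3
    i′ = wk (wk v3)
    d′ = wk (wk (wk (wk v3)))
    k′ = wk (wk (wk (wk (wk v3))))
    V′ W′ : Tm Ψ T1
    V′ = wk (wk (wk v3))
    W′ = wk (wk (wk (wk (wk (wk v3)))))
    H : List (Form Ψ)
    H = shift v0 v1 v2 ∷ shift v0 v2 v3 ∷ const c′ i′ V′ ∷ const d′ k′ W′ ∷
        dy c′ i′ ⊕ e v0 ⊕ e v0 ≤ dy d′ k′ ∷ v1 ≤ṙ V′ ∷ []
    main : H ⊢ v3 ≤ṙ W′
    main = ≤ṙ-intro (≤-trans (≈⇒≤ (≈-trans (∀E #1 v0) (⊕-cong (∀E #0 v0) ≈-refl)))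
      (≤-linear (⊕-mono (⊕-mono (≤ṙ-elim (up #4) v0) (≈⇒≤ (∀E #2 v0))) (⊕-mono #4 (≈⇒≥ (∀E #3 v0))))
        (M.solve 7 (λ x v n q e d w →
          x ⊹ e ⊹ e ⊹ (n ⊹ n ⊹ v ⊹ q ⊹ (d ⊹ w)) ⊜ n ⊹ n ⊹ w ⊹ (x ⊹ v ⊹ (q ⊹ e ⊹ e ⊹ d)))
          ≈-refl (v2 at v0) (wk V′ at v0) (e v0) (dy (wk c′) (wk i′)) (e v1) (dy (wk d′) (wk k′)) (wk W′ at v0))))

  const-0 : Δ ⊢ const 𝟎 𝟎 0ℝ
  const-0 = ∀I (decode _ (dy 𝟎 𝟎) ⟨ ≐-trans (lam-β (pair (pair 𝟎 𝟎) 𝟎)) (⊞-congˡ _ (≐-cong₂ (con times) q q)) ⟩)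
    where
    q : ∀ {Γ Δ} → Γ ∣ Δ ⊢ pair 𝟎 𝟎 ⊞ 𝟎 ≐ pair 𝟎 𝟎 ⊞ pred (2^ 𝟎)
    q = ⊞-congʳ _ (≐-sym (≐-trans (pred-cong (≐-trans 2^-zero (≐-sym (⊞-identityˡ 𝟏)))) (pred-suc 𝟎)))

  const-1 : Δ ⊢ const 𝟏 𝟎 1ℝ
  const-1 = ∀I (decode _ (dy 𝟏 𝟎) ⟨ ≐-trans (lam-β (pair (pair 𝟏 𝟎) 𝟎)) (⊞-congˡ _ (≐-cong₂ (con times) q q)) ⟩)
    where
    q : ∀ {Γ Δ} → Γ ∣ Δ ⊢ pair 𝟏 𝟎 ⊞ 𝟎 ≐ pair 𝟏 𝟎 ⊞ pred (2^ 𝟎)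
    q = ⊞-congʳ _ (≐-sym (≐-trans (pred-cong (≐-trans 2^-zero (≐-sym (⊞-identityˡ 𝟏)))) (pred-suc 𝟎)))

  private
    unitF : Form (T1 ∷ [])
    unitF = real v0 ∧̇ 0ℝ ≤ṙ v0 ∧̇ v0 ≤ṙ 1ℝ

    unit⇒ : unit v0 ∷ [] ⊢ unitF
    unit⇒ = ⟨ h0 ⟩
    ⇒unit : unitF ∷ [] ⊢ unit v0
    ⇒unit = ⟨ h0 ⟩

  unit-elim : Δ ⊢ unit X → Δ ⊢ real X ∧̇ 0ℝ ≤ṙ X ∧̇ X ≤ṙ 1ℝ
  unit-elim {X = X} p = instantiate (X ▸ nil) unit⇒ (p ∷ [])

  unit-intro : Δ ⊢ real X → Δ ⊢ 0ℝ ≤ṙ X → Δ ⊢ X ≤ṙ 1ℝ → Δ ⊢ unit X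
  unit-intro {X = X} p q r = instantiate (X ▸ nil) ⇒unit (∧I p (∧I q r) ∷ [])

  unit-real : Δ ⊢ unit X → Δ ⊢ real X
  unit-real p = ∧E₁ (unit-elim p)

  unit-resp : Δ ⊢ real Y → Δ ⊢ X =ṙ Y → Δ ⊢ unit X → Δ ⊢ unit Y
  unit-resp p q r = unit-intro p
    (≤ṙ-trans (const-real 𝟎 𝟎 0ℝ const-0) p (∧E₁ (∧E₂ (unit-elim r))) (=ṙ⇒≤ṙ q))
    (≤ṙ-trans p (const-real 𝟏 𝟎 1ℝ const-1) (=ṙ⇒≥ṙ q) (∧E₂ (∧E₂ (unit-elim r))))

open Translates

-- Kleene's quantifier from an injection of the unit interval into the numbers.

module KleeneQuantifier where

  private variable
    Γ : Cxt
    Δ : List (Form Γ)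
    A B : Form Γ
    s t : Tm Γ o

  sg : Tm Γ o → Tm Γ o
  sg t = 𝟏 ∸ᵗ (𝟏 ∸ᵗ t)

  sg≼1 : ∀ {Δ} (t : Tm Γ o) → Γ ∣ Δ ⊢ sg t ≼ 𝟏
  sg≼1 t = ∨-elim (zero-or-pos (𝟏 ∸ᵗ t))
    (∨-intro₂ (≐-trans (∸-cong (≐-refl _) h0) (∸-zero 𝟏)))
    (≼-resp (≐-sym (1∸pos h0)) (≐-refl 𝟏) (0≼ 𝟏))

  sg-zero : ∀ {Δ} {t : Tm Γ o} → Γ ∣ Δ ⊢ t ≐ 𝟎 → Γ ∣ Δ ⊢ sg t ≐ 𝟎
  sg-zero p = 1∸pos (≺-resp (≐-refl 𝟎) (≐-sym (1∸0 p)) (ax 0≺1))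

  sg-pos : ∀ {Δ} {t : Tm Γ o} → Γ ∣ Δ ⊢ 𝟎 ≺ t → Γ ∣ Δ ⊢ sg t ≐ 𝟏
  sg-pos p = 1∸0 (1∸pos p)

  -- X is the real ∑ₙ sg (F n) 2⁻ⁿ⁻¹, and U n the numerator of its n-th partial sum over 2ⁿ.
  binary : Tm Γ T1 → Tm Γ T1 → Tm Γ T1 → Form Γ
  binary F U X = U · 𝟎 ≐̇ 𝟎 ∧̇
    ∀̇ o (wk U · (v0 ⊞ 𝟏) ≐̇ wk U · v0 ⊞ wk U · v0 ⊞ sg (wk F · v0)) ∧̇
    ∀̇ o (wk X at v0 ≈ dy (wk U · v0) v0)

  Tri : Cxt
  Tri = T1 ∷ T1 ∷ T1 ∷ []

  module _ (F U X : Tm Γ T1) (h : Δ ⊢ binary F U X) where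

    binary-zero : Δ ⊢ U · 𝟎 ≐̇ 𝟎
    binary-zero = ∧E₁ h

    binary-suc : ∀ n → Δ ⊢ U · (n ⊞ 𝟏) ≐̇ U · n ⊞ U · n ⊞ sg (F · n)
    binary-suc n = instantiate (n ▸ F ▸ U ▸ X ▸ nil)
      (specialise (∧E₁ (∧E₂ (#0 {A = binary v0 v1 v2} {Δ = []})))) (h ∷ [])

    binary-at : ∀ n → Δ ⊢ X at n ≈ dy (U · n) n
    binary-at n = instantiate (n ▸ F ▸ U ▸ X ▸ nil)
      (specialise (∧E₂ (∧E₂ (#0 {A = binary v0 v1 v2} {Δ = []})))) (h ∷ [])

    binary-step : ∀ n → Δ ⊢ X at (n ⊞ 𝟏) ≈ X at n ⊕ dy (sg (F · n)) (n ⊞ 𝟏)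
    binary-step n = ≈-trans (binary-at (n ⊞ 𝟏)) (≈-trans (dy-cong (binary-suc n) ⟨ ≐-refl _ ⟩)
      (≈-trans (dy-add _ _ _) (⊕-cong (≈-trans (dy-suc _ _) (≈-sym (binary-at n))) ≈-refl)))

  qf-≤ : (x y : Rat Γ) → QF ⌊ x ≤ y ⌋
  qf-≤ x y = (_ ≺ _) ∨ (_ ≐ _)

  const-at : ∀ (c j : Tm Γ o) X → Δ ⊢ const c j X → ∀ n → Δ ⊢ X at n ≈ dy c j
  const-at c j X p n = instantiate (n ▸ c ▸ j ▸ X ▸ nil)
    (specialise (#0 {A = const v0 v1 v2} {Δ = []})) (p ∷ [])

  code-at : ∀ (X : Tm Γ T1) → Δ ⊢ s ≐̇ t → Δ ⊢ X at s ≈ X at t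
  code-at X ⟨ p ⟩ = code-cong ⟨ ≐-cong X p ⟩

  -- The summand `e (n ⊞ i)` makes the upper bound inductive, since the next digit contributes at
  -- most half of it. It also leaves room for the strict inequality in the definition of a real.
  binary-bounds : ∀ (F U X : Tm Γ T1) → Δ ⊢ binary F U X → ∀ n i →
    Δ ⊢ X at n ≤ X at (n ⊞ i) ∧̇ X at (n ⊞ i) ⊕ e (n ⊞ i) ≤ X at n ⊕ e n
  binary-bounds F U X h n i = instantiate (i ▸ n ▸ F ▸ U ▸ X ▸ nil)
    (numInd P (qf-≤ (X′ at v1) (X′ at (v1 ⊞ v0)) ∧ qf-≤ (X′ at (v1 ⊞ v0) ⊕ e (v1 ⊞ v0)) (X′ at v1 ⊕ e v1))
      base step) (h ∷ [])
    where
    Ψ : Cxt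
    Ψ = o ∷ Tri
    H : List (Form Ψ)
    H = binary v1 v2 v3 ∷ []
    X′ : Tm (o ∷ Ψ) T1
    X′ = wk v3
    P : Form (o ∷ Ψ)
    P = X′ at v1 ≤ X′ at (v1 ⊞ v0) ∧̇ X′ at (v1 ⊞ v0) ⊕ e (v1 ⊞ v0) ≤ X′ at v1 ⊕ e v1
    base : H ⊢ sub (𝟎 ▸ var) P
    base = ∧I (≈⇒≥ p) (⊕-mono (≈⇒≤ p) (≈⇒≤ (dy-cong ⟨ ≐-refl 𝟏 ⟩ ⟨ ax (+-identity _) ⟩)))
      where
      p : H ⊢ v3 at (v0 ⊞ 𝟎) ≈ v3 at v0
      p = code-at v3 ⟨ ax (+-identity _) ⟩
    step : P ∷ map wkn H ⊢ sub shift₁ P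
    step = ∧I
      (≤-trans (∧E₁ #0) (≤-trans (dy-nonneg (sg (v2 · m)) (m ⊞ 𝟏) (X′ at m))
        (≤-trans (≈⇒≤ (⊕-comm _ _)) (≈⇒≥ p))))
      (≤-trans (⊕-mono (≤-trans (≈⇒≤ p) (⊕-mono ≤-refl (dy-mono (m ⊞ 𝟏) ⟨ sg≼1 _ ⟩)))
                       (≈⇒≤ (dy-cong ⟨ ≐-refl 𝟏 ⟩ ⟨ ≐-sym (ax (+-assoc _ _ _)) ⟩)))
        (≤-trans (≈⇒≤ (⊕-assoc _ _ _)) (≤-trans (⊕-mono ≤-refl (≈⇒≤ (2e-suc m))) (∧E₂ #0))))
      where
      m = v1 ⊞ v0
      p : P ∷ map wkn H ⊢ X′ at (v1 ⊞ (v0 ⊞ 𝟏)) ≈ X′ at m ⊕ dy (sg (v2 · m)) (m ⊞ 𝟏)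
      p = ≈-trans (code-at X′ ⟨ ≐-sym (ax (+-assoc _ _ _)) ⟩) (binary-step v2 v3 X′ #1 m)

  binary-unit : ∀ (F U X : Tm Γ T1) → Δ ⊢ binary F U X → Δ ⊢ unit X
  binary-unit F U X h = instantiate (F ▸ U ▸ X ▸ nil) main (h ∷ [])
    where
    H : List (Form Tri)
    H = binary v0 v1 v2 ∷ []
    upper : map wkn H ⊢ v3 at v0 ≤ dy 𝟏 𝟎
    upper = ≤-trans (dy-nonneg 𝟏 v0 _) (≤-trans (≈⇒≤ (⊕-comm _ _))
      (≤-trans (⊕-mono (≈⇒≥ p) (≈⇒≥ (dy-cong ⟨ ≐-refl 𝟏 ⟩ ⟨ ⊞-identityˡ v0 ⟩)))
        (≤-trans (∧E₂ (binary-bounds v1 v2 v3 #0 𝟎 v0))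
          (≤-trans (⊕-mono (≈⇒≤ (≈-trans (binary-at v1 v2 v3 #0 𝟎)
              (dy-cong (binary-zero v1 v2 v3 #0) ⟨ ≐-refl 𝟎 ⟩))) ≤-refl)
            (≈⇒≤ (≈-trans (⊕-comm _ _) (⊕-identityʳ 𝟎 _)))))))
      where
      p : map wkn H ⊢ v3 at (𝟎 ⊞ v0) ≈ v3 at v0
      p = code-at v3 ⟨ ⊞-identityˡ v0 ⟩
    main : H ⊢ unit v2
    main = unit-intro
      (real-intro
        (≤-<-trans (∧E₁ (b v1 v0)) (e-pos v1 _))
        (<-≤-trans (e-pos _ _) (≤-trans (≈⇒≤ (⊕-comm _ _)) (≤-trans (∧E₂ (b v1 v0)) (≈⇒≤ (⊕-comm _ _))))))
      (pointwise-≤ (≤-trans (≈⇒≤ (const-at 𝟎 𝟎 0ℝ const-0 v0)) (≤-trans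
        (≤-trans (dy-nonneg (v2 · v0) v0 (dy 𝟎 𝟎)) (≈⇒≤ (⊕-identityʳ 𝟎 _))) (≈⇒≥ (binary-at v1 v2 v3 #0 v0)))))
      (pointwise-≤ (≤-trans upper (≈⇒≥ (const-at 𝟏 𝟎 1ℝ const-1 v0))))
      where
      b = binary-bounds {Γ = o ∷ o ∷ Tri} v2 v3 (wk v3) (#0 {Δ = []})

  binary-digit : ∀ (F U X Z : Tm Γ T1) → Δ ⊢ binary F U X → Δ ⊢ const 𝟎 𝟎 Z → Δ ⊢ X ≤ṙ Z → ∀ n → Δ ⊢ F · n ≐̇ 𝟎
  binary-digit F U X Z p q r n = ∨E {A = F · n ≐̇ 𝟎} {B = 𝟎 ≺̇ F · n} ⟨ zero-or-pos (F · n) ⟩ #0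
    (e≰2e (n ⊞ 𝟏) (≤-trans low (≤-trans (≈⇒≤ (code-at X ⟨ ≐-sym (ax (+-assoc _ _ _)) ⟩))
      (≤-trans (≤ṙ-elim (up r) m) (≤-trans (⊕-mono ≤-refl (≈⇒≤ (const-at 𝟎 𝟎 Z (up q) m)))
        (≈⇒≤ (⊕-identityʳ 𝟎 _)))))))
    where
    -- A nonzero digit at `n` keeps the partial sums at or above 2^-(n+1) from index n + 1 on,
    -- whereas at `m` the comparison with 0 allows only 2·2^-(n+3).
    m = n ⊞ 𝟏 ⊞ 𝟏 ⊞ 𝟏
    low : 𝟎 ≺̇ F · n ∷ _ ⊢ e (n ⊞ 𝟏) ≤ X at (n ⊞ 𝟏 ⊞ (𝟏 ⊞ 𝟏))
    low = ≤-trans (dy-mono (n ⊞ 𝟏) ⟨ ∨-intro₂ (≐-sym (sg-pos h0)) ⟩)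
      (≤-trans (≤-trans (dy-nonneg (U · n) n _) (⊕-mono (≈⇒≥ (binary-at F U X (up p) n)) ≤-refl))
        (≤-trans (≈⇒≥ (binary-step F U X (up p) n)) (∧E₁ (binary-bounds F U X (up p) (n ⊞ 𝟏) (𝟏 ⊞ 𝟏)))))

  binary-digits : ∀ (F U X Z : Tm Γ T1) → Δ ⊢ binary F U X → Δ ⊢ const 𝟎 𝟎 Z → Δ ⊢ X ≤ṙ Z →
                  Δ ⊢ ∀̇ o (wk F · v0 ≐̇ 𝟎)
  binary-digits F U X Z p q r = instantiate (F ▸ U ▸ X ▸ Z ▸ nil)
    main (p ∷ q ∷ r ∷ [])
    where
    main : binary v0 v1 v2 ∷ const 𝟎 𝟎 v3 ∷ v2 ≤ṙ v3 ∷ [] ⊢ ∀̇ {T1 ∷ T1 ∷ T1 ∷ T1 ∷ []} o (v1 · v0 ≐̇ 𝟎)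
    main = ∀I (binary-digit v1 v2 v3 (wk v3) #0 #1 #2 v0)

  binary-const : ∀ (F U X : Tm Γ T1) → Δ ⊢ binary F U X → Δ ⊢ ∀̇ o (wk F · v0 ≐̇ 𝟎) → Δ ⊢ const 𝟎 𝟎 X
  binary-const F U X p q = instantiate (F ▸ U ▸ X ▸ nil) main (p ∷ q ∷ [])
    where
    H : List (Form Tri)
    H = binary v0 v1 v2 ∷ ∀̇ o (v1 · v0 ≐̇ 𝟎) ∷ []
    digit : v2 · v0 ≐̇ 𝟎 ∷ map wkn H ⊢ v1 · v0 ≐̇ 𝟎
    digit = ∀E #2 v0
    next : v2 · v0 ≐̇ 𝟎 ∷ map wkn H ⊢ v2 · (v0 ⊞ 𝟏) ≐̇ v2 · v0 ⊞ v2 · v0 ⊞ sg (v1 · v0)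
    next = binary-suc v1 v2 v3 #1 v0
    zeros : map wkn H ⊢ v2 · v0 ≐̇ 𝟎
    zeros = numInd {Δ = H} (v2 · v0 ≐̇ 𝟎) (_ ≐ _) (binary-zero v0 v1 v2 #0)
      ⟨ ≐-trans (un next) (zero-zero (zero-zero h0 h0) (sg-zero (un digit))) ⟩
    main : H ⊢ const 𝟎 𝟎 v2
    main = ∀I (≈-trans (binary-at v1 v2 v3 #0 v0) (≈-trans (dy-cong zeros ⟨ ≐-refl v0 ⟩)
      (≈-trans (≈-sym (⊕-identityʳ 𝟎 _)) (≈-trans (⊕-comm _ _) (⊕-identityʳ v0 _)))))

  const-unique : ∀ (c j : Tm Γ o) X Y → Δ ⊢ const c j X → Δ ⊢ const c j Y → Δ ⊢ X =ṙ Y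
  const-unique c j X Y p q = ≤ṙ-antisym (const-≤ c j X c j Y p q ≤-refl) (const-≤ c j Y c j X q p ≤-refl)

  -- The numerators and the real are produced uniformly in `F`, as required for defining a
  -- functional of `F`. The recursor of type 0 suffices, with `F` as a parameter.
  binary-exists : [] ⊢ ∃̇ {Γ = []} (T1 ⇾ o ⇾ o) (∃̇ (T1 ⇾ T1) (∀̇ T1 (binary v0 (v2 · v0) (v1 · v0))))
  binary-exists = ∃E (function₂ {σ₂ = o} {σ₁ = T1} {Γ = []} tU) (∃I v0
    (∃E (function₂ {σ₂ = o} {σ₁ = T1} tX) (∃I v0 (∀I main))))
    where
    tU : Tm (o ∷ T1 ∷ []) o
    tU = con (R o) · lam (lam (v0 ⊞ v0 ⊞ sg (v3 · v1))) · 𝟎 · v0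
    tX : Tm (o ∷ T1 ∷ (T1 ⇾ o ⇾ o) ∷ []) o
    tX = encode (dy (v2 · v1 · v0) v0)
    Ψ : Cxt
    Ψ = T1 ∷ (T1 ⇾ T1) ∷ (T1 ⇾ o ⇾ o) ∷ []
    H : List (Form Ψ)
    H = ∀̇ T1 (∀̇ o (v3 · v1 · v0 ≐̇ encode (dy (wk v3 · v1 · v0) v0))) ∷
        ∀̇ T1 (∀̇ o (wk v3 · v1 · v0 ≐̇ con (R o) · lam (lam (v0 ⊞ v0 ⊞ sg (v3 · v1))) · 𝟎 · v0)) ∷ []
    body : Tm (o ∷ o ∷ o ∷ Ψ) o
    body = v0 ⊞ v0 ⊞ sg (v3 · v1)
    rec : ∀ n → map wkn H ⊢ v3 · v1 · n ≐̇ con (R o) · lam (lam body) · 𝟎 · n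
    rec n = ∀E (∀E #1 v1) n
    rec₀ : H ⊢ v2 · v0 · 𝟎 ≐̇ con (R o) · lam (lam (v0 ⊞ v0 ⊞ sg (v2 · v1))) · 𝟎 · 𝟎
    rec₀ = ∀E (∀E #1 v0) 𝟎
    main : H ⊢ binary v0 (v2 · v0) (v1 · v0)
    main = ∧I ⟨ ≐-trans (un rec₀) (ax (R₀-zero _ _)) ⟩
      (∧I (∀I ⟨ ≐-trans (un (rec (v0 ⊞ 𝟏))) (≐-trans (ax (R₀-suc _ _ _))
            (≐-trans (inst (con (R o) · lam (lam body) · 𝟎 · v0 ▸ v0 ▸ var) (lam₂-β body) [])
              (⊞-congˡ _ (≐-cong₂ (con plus) (≐-sym (un (rec v0))) (≐-sym (un (rec v0))))))) ⟩)
          (∀I (decode _ (dy (v3 · v1 · v0) v0) (∀E (∀E #0 v1) v0))))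

  fun01 inj01 : Tm Γ (T1 ⇾ o) → Form Γ
  fun01 Y = ∀̇ T1 (∀̇ T1 (unit v1 ∧̇ unit v0 ∧̇ v1 =ṙ v0 ⇒̇ wk (wk Y) · v1 ≐̇ wk (wk Y) · v0))
  inj01 Y = ∀̇ T1 (∀̇ T1 (unit v1 ∧̇ unit v0 ∧̇ wk (wk Y) · v1 ≐̇ wk (wk Y) · v0 ⇒̇ v1 =ṙ v0))

  -- The functional is the distance, as a sum of two truncated differences, between the Y-values at
  -- the binary reals of the given function and of the zero function `Z`. Distance 0 forces all
  -- digits to vanish by injectivity; the converse is extensionality of Y, the two reals then being
  -- equal.
  Kleene-exists : fun01 v0 ∷ inj01 v0 ∷ [] ⊢ ∃̇ {Γ = (T1 ⇾ o) ∷ []} (T1 ⇾ o) (Kleene (here refl))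
  Kleene-exists = ∃E (instantiate nil binary-exists []) (∃E #0 (∃I E (∀I main)))
    where
    Z : Tm Γ T1
    Z = con (Π o o) · 𝟎
    Ψ : Cxt
    Ψ = T1 ∷ (T1 ⇾ T1) ∷ (T1 ⇾ o ⇾ o) ∷ (T1 ⇾ o) ∷ []
    p₀ p₁ : Tm Ψ o
    p₀ = v3 · (v1 · v0)
    p₁ = v3 · (v1 · Z)
    E : Tm ((T1 ⇾ T1) ∷ (T1 ⇾ o ⇾ o) ∷ (T1 ⇾ o) ∷ []) (T1 ⇾ o)
    E = lam ((p₀ ∸ᵗ p₁) ⊞ (p₁ ∸ᵗ p₀))
    H : List (Form Ψ)
    H = ∀̇ T1 (binary v0 (v3 · v0) (v2 · v0)) ∷ ∃̇ (T1 ⇾ T1) (∀̇ T1 (binary v0 (wk v3 · v0) (v1 · v0))) ∷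
        fun01 v3 ∷ inj01 v3 ∷ []
    bf : H ⊢ binary v0 (v2 · v0) (v1 · v0)
    bf = ∀E #0 v0
    bZ : H ⊢ binary Z (v2 · Z) (v1 · Z)
    bZ = ∀E #0 Z
    cZ : H ⊢ const 𝟎 𝟎 (v1 · Z)
    cZ = binary-const Z (v2 · Z) (v1 · Z) bZ (∀I ⟨ ax (Π-def _ _) ⟩)
    uf : H ⊢ unit (v1 · v0)
    uf = binary-unit v0 (v2 · v0) (v1 · v0) bf
    uZ : H ⊢ unit (v1 · Z)
    uZ = binary-unit Z (v2 · Z) (v1 · Z) bZ
    zero⇒ : p₀ ≐̇ p₁ ∷ H ⊢ ∀̇ o (v1 · v0 ≐̇ 𝟎)
    zero⇒ = binary-digits v0 (v2 · v0) (v1 · v0) (v1 · Z) (up bf) (up cZ)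
      (=ṙ⇒≤ṙ (⇒E (∀E (∀E #4 (v1 · v0)) (v1 · Z)) (∧I (up uf) (∧I (up uZ) #0))))
    ⇒zero : ∀̇ o (v1 · v0 ≐̇ 𝟎) ∷ H ⊢ p₀ ≐̇ p₁
    ⇒zero = ⇒E (∀E (∀E #3 (v1 · v0)) (v1 · Z)) (∧I (up uf) (∧I (up uZ)
      (const-unique 𝟎 𝟎 (v1 · v0) (v1 · Z) (binary-const v0 (v2 · v0) (v1 · v0) (up bf) #0) (up cZ))))
    β : ∀ {Δ : List (Form Ψ)} → Δ ⊢ wk E · v0 ≐̇ (p₀ ∸ᵗ p₁) ⊞ (p₁ ∸ᵗ p₀)
    β = ⟨ lam-β ((p₀ ∸ᵗ p₁) ⊞ (p₁ ∸ᵗ p₀)) ⟩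
    main : H ⊢ (wk E · v0 ≐̇ 𝟎 ⇒̇ ∀̇ o (v1 · v0 ≐̇ 𝟎)) ∧̇ (∀̇ o (v1 · v0 ≐̇ 𝟎) ⇒̇ wk E · v0 ≐̇ 𝟎)
    main = ∧I
      (⇒I (⇒E (up (⇒I zero⇒)) ⟨ ≼-antisym (m∸n≐0⇒m≼n (sum-zero p)) (m∸n≐0⇒m≼n (sum-zero′ p)) ⟩))
      (⇒I ⟨ ≐-trans (un (β {Δ = ∀̇ o (v1 · v0 ≐̇ 𝟎) ∷ H})) (zero-zero
        (m≼n⇒m∸n≐0 (∨-intro₂ (un ⇒zero)))
        (m≼n⇒m∸n≐0 (∨-intro₂ (≐-sym (un ⇒zero))))) ⟩)
      where
      p = ≐-trans (≐-sym (un (β {Δ = wk E · v0 ≐̇ 𝟎 ∷ H}))) h0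

open KleeneQuantifier

-- The functionals of the proof and the interval around a point.

module Functionals where

  private variable
    Γ Γ′ : Cxt
    Δ : List (Form Γ)
    ρ σ σ₁ σ₂ : Ty

  startE : (A : Form Γ) → Δ ⊢ A → Δ ⊢ sub var A
  startE A ⟨ p ⟩ = ⟨ cast (sym (trans (⌊⌋-sub var A) (subFm-id (λ _ → refl) ⌊ A ⌋))) p ⟩

  stepE : (f : Sub Γ′ Γ) (A : Form (σ ∷ Γ′)) → Δ ⊢ ∀̇ σ (sub (lift f) A) → (t : Tm Γ σ) → Δ ⊢ sub (t ▸ f) A
  stepE f A ⟨ p ⟩ t = ⟨ cast (trans (cong (subFm (t ▸ var)) (⌊⌋-sub (lift f) A))
    (trans (subFm-sub (t ▸ var) (lift f) ⌊ A ⌋) (trans (subFm-cong h ⌊ A ⌋) (sym (⌊⌋-sub (t ▸ f) A)))))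
    (∀-elim p t) ⟩
    where
    h : ∀ {ρ} (x : ρ ∈ _ ∷ _) → subTm (t ▸ var) (lift f x) ≡ (t ▸ f) x
    h (here refl) = refl
    h (there x)   = wk-[] t (f x)

  -- Instantiating one variable after the other would leave a substituted weakening of `s`, which
  -- does not compute for an arbitrary term; a single simultaneous substitution does.
  ∀E₂ : (A : Form (σ₂ ∷ σ₁ ∷ Γ)) → Δ ⊢ ∀̇ σ₁ (∀̇ σ₂ A) →
        ∀ s t → Δ ⊢ sub (t ▸ s ▸ var) A
  ∀E₂ A p s t = stepE (s ▸ var) A (stepE var (∀̇ _ A) (startE (∀̇ _ (∀̇ _ A)) p) s) t

  -- The exponent of the radius: 2^-(r n) is 4^-(n+1), a quarter of a cell at level n.
  r : Tm Γ o → Tm Γ o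
  r n = n ⊞ n ⊞ 𝟏 ⊞ 𝟏

  -- The functionals of the proof are variables of the context: their weakening is
  -- then again a variable by computation.
  record Names (Γ : Cxt) : Set where
    constructor names
    field
      iY iE : (T1 ⇾ o) ∈ Γ
      iM    : (T1 ⇾ T1 ⇾ T1) ∈ Γ
      iS iD : (T1 ⇾ o ⇾ T1) ∈ Γ
      iC    : (o ⇾ o ⇾ T1) ∈ Γ

    Y : Tm Γ T1 → Tm Γ o
    Y t = var iY · t
    M : Tm Γ T1 → Tm Γ T1 → Tm Γ T1
    M a b = var iM · a · b
    S D : Tm Γ T1 → Tm Γ o → Tm Γ T1
    S x j = var iS · x · j
    D x j = var iD · x · j
    C : Tm Γ o → Tm Γ o → Tm Γ T1
    C i j = var iC · i · j

    -- (a , b) is the interval of radius 2^-(2 n + 2) around a point with Y-value n.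
    inA : Tm Γ T1 → Tm Γ T1 → Form Γ
    inA a b = unit (M a b) ∧̇ a =ṙ S (M a b) (r (Y (M a b))) ∧̇ b =ṙ D (M a b) (r (Y (M a b)))

  wkN : Names Γ → Names (σ ∷ Γ)
  wkN (names y e m s d c) = names (there y) (there e) (there m) (there s) (there d) (there c)

  record Facts {Γ : Cxt} (N : Names Γ) (Δ : List (Form Γ)) : Set where
    open Names N
    field
      Y-fun    : Δ ⊢ fun01 (var iY)
      Y-inj    : Δ ⊢ inj01 (var iY)
      E-spec   : Δ ⊢ Kleene iE
      M-spec   : Δ ⊢ ∀̇ T1 (∀̇ T1 (mid v1 v0 (Names.M (wkN (wkN N)) v1 v0)))
      S-spec   : Δ ⊢ ∀̇ T1 (∀̇ o (shift v0 (Names.S (wkN (wkN N)) v1 v0) v1))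
      D-spec   : Δ ⊢ ∀̇ T1 (∀̇ o (shift v0 v1 (Names.D (wkN (wkN N)) v1 v0)))
      C-spec   : Δ ⊢ ∀̇ o (∀̇ o (const v1 v0 (Names.C (wkN (wkN N)) v1 v0)))

  wkF : {N : Names Γ} → Facts N Δ → Facts (wkN {σ = σ} N) (map wkn Δ)
  wkF F = record { Y-fun = wkD Y-fun ; Y-inj = wkD Y-inj ; E-spec = wkD E-spec ; M-spec = wkD M-spec
                 ; S-spec = wkD S-spec ; D-spec = wkD D-spec ; C-spec = wkD C-spec }
    where
    open Facts F

  upF : {N : Names Γ} {A : Form Γ} → Facts N Δ → Facts N (A ∷ Δ)
  upF F = record { Y-fun = up Y-fun ; Y-inj = up Y-inj ; E-spec = up E-spec ; M-spec = up M-spec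
                 ; S-spec = up S-spec ; D-spec = up D-spec ; C-spec = up C-spec }
    where
    open Facts F

  shift-cong : ∀ (i j : Tm Γ o) X Z → Δ ⊢ i ≐̇ j → Δ ⊢ shift i X Z → Δ ⊢ shift j X Z
  shift-cong i j X Z p q = instantiate (i ▸ j ▸ X ▸ Z ▸ nil) main (p ∷ q ∷ [])
    where
    main : v0 ≐̇ v1 ∷ shift v0 v2 v3 ∷ [] ⊢ shift {o ∷ o ∷ T1 ∷ T1 ∷ []} v1 v2 v3
    main = ∀I (≈-trans (∀E #1 v0) (⊕-cong ≈-refl (dy-cong ⟨ ≐-refl 𝟏 ⟩ #0)))

  r-cong : ∀ {s t : Tm Γ o} → Δ ⊢ s ≐̇ t → Δ ⊢ r s ≐̇ r t
  r-cong ⟨ p ⟩ = ⟨ ⊞-congˡ 𝟏 (⊞-congˡ 𝟏 (≐-cong₂ (con plus) p p)) ⟩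

  module Intervals {N : Names Γ} (F : Facts N Δ) where
    open Names N
    open Facts F

    Y-cong : ∀ x z → Δ ⊢ unit x → Δ ⊢ unit z → Δ ⊢ x =ṙ z → Δ ⊢ Y x ≐̇ Y z
    Y-cong x z p q e = ⇒E (∀E₂
      (unit v1 ∧̇ unit v0 ∧̇ v1 =ṙ v0 ⇒̇ var (there (there iY)) · v1 ≐̇ var (there (there iY)) · v0)
      Y-fun x z) (∧I p (∧I q e))

    Y-injective : ∀ x z → Δ ⊢ unit x → Δ ⊢ unit z → Δ ⊢ Y x ≐̇ Y z → Δ ⊢ x =ṙ z
    Y-injective x z p q e = ⇒E (∀E₂
      (unit v1 ∧̇ unit v0 ∧̇ var (there (there iY)) · v1 ≐̇ var (there (there iY)) · v0 ⇒̇ v1 =ṙ v0)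
      Y-inj x z) (∧I p (∧I q e))

    M-mid : ∀ a b → Δ ⊢ mid a b (M a b)
    M-mid = ∀E₂ (mid v1 v0 (Names.M (wkN (wkN N)) v1 v0)) M-spec

    S-shift : ∀ x j → Δ ⊢ shift j (S x j) x
    S-shift = ∀E₂ (shift v0 (Names.S (wkN (wkN N)) v1 v0) v1) S-spec

    D-shift : ∀ x j → Δ ⊢ shift j x (D x j)
    D-shift = ∀E₂ (shift v0 v1 (Names.D (wkN (wkN N)) v1 v0)) D-spec

    C-const : ∀ i j → Δ ⊢ const i j (C i j)
    C-const = ∀E₂ (const v1 v0 (Names.C (wkN (wkN N)) v1 v0)) C-spec

    M-real : ∀ a b → Δ ⊢ real a → Δ ⊢ real b → Δ ⊢ real (M a b)
    M-real a b = mid-real a b (M a b) (M-mid a b)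

    M-cong : ∀ a b a′ b′ → Δ ⊢ a =ṙ a′ → Δ ⊢ b =ṙ b′ → Δ ⊢ M a b =ṙ M a′ b′
    M-cong a b a′ b′ p q = ≤ṙ-antisym
      (mid-≤ a b (M a b) a′ b′ (M a′ b′) (M-mid a b) (M-mid a′ b′) (=ṙ⇒≤ṙ p) (=ṙ⇒≤ṙ q))
      (mid-≤ a′ b′ (M a′ b′) a b (M a b) (M-mid a′ b′) (M-mid a b) (=ṙ⇒≥ṙ p) (=ṙ⇒≥ṙ q))

    S-cong : ∀ x z i j → Δ ⊢ x =ṙ z → Δ ⊢ i ≐̇ j → Δ ⊢ S x i =ṙ S z j
    S-cong x z i j p q = ≤ṙ-antisym
      (shift-≤⁻ j (S x i) x (S z j) z (shift-cong i j (S x i) x q (S-shift x i)) (S-shift z j) (=ṙ⇒≤ṙ p))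
      (shift-≤⁻ j (S z j) z (S x i) x (S-shift z j) (shift-cong i j (S x i) x q (S-shift x i)) (=ṙ⇒≥ṙ p))

    D-cong : ∀ x z i j → Δ ⊢ x =ṙ z → Δ ⊢ i ≐̇ j → Δ ⊢ D x i =ṙ D z j
    D-cong x z i j p q = ≤ṙ-antisym
      (shift-≤ j x (D x i) z (D z j) (shift-cong i j x (D x i) q (D-shift x i)) (D-shift z j) (=ṙ⇒≤ṙ p))
      (shift-≤ j z (D z j) x (D x i) (D-shift z j) (shift-cong i j x (D x i) q (D-shift x i)) (=ṙ⇒≥ṙ p))

    S-real : ∀ x j → Δ ⊢ real x → Δ ⊢ real (S x j)
    S-real x j = shift-real⁻ j (S x j) x (S-shift x j)

    D-real : ∀ x j → Δ ⊢ real x → Δ ⊢ real (D x j)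
    D-real x j = shift-real j x (D x j) (D-shift x j)

    -- Both ends are translates of the midpoint by a radius that depends on the midpoint alone. With
    -- injectivity of Y this makes an interval determined by its Y-value.
    inA-unique : ∀ a b a′ b′ → Δ ⊢ real a ∧̇ real b → Δ ⊢ real a′ ∧̇ real b′ → Δ ⊢ inA a b → Δ ⊢ inA a′ b′ →
                 Δ ⊢ M a b =ṙ M a′ b′ → Δ ⊢ a =ṙ a′ ∧̇ b =ṙ b′
    inA-unique a b a′ b′ p p′ q q′ e = ∧I
      (=ṙ-trans (∧E₁ p) (∧E₁ p′) (∧E₁ (∧E₂ q)) (=ṙ-sym (=ṙ-trans (∧E₁ p′) (S-real _ _ (unit-real (∧E₁ q)))
        (∧E₁ (∧E₂ q′)) (=ṙ-sym (S-cong _ _ _ _ e (r-cong (Y-cong _ _ (∧E₁ q) (∧E₁ q′) e)))))))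
      (=ṙ-trans (∧E₂ p) (∧E₂ p′) (∧E₂ (∧E₂ q)) (=ṙ-sym (=ṙ-trans (∧E₂ p′) (D-real _ _ (unit-real (∧E₁ q)))
        (∧E₂ (∧E₂ q′)) (=ṙ-sym (D-cong _ _ _ _ e (r-cong (Y-cong _ _ (∧E₁ q) (∧E₁ q′) e)))))))

    inA-resp : ∀ a b a′ b′ → Δ ⊢ real a ∧̇ real b → Δ ⊢ real a′ ∧̇ real b′ →
               Δ ⊢ a =ṙ a′ → Δ ⊢ b =ṙ b′ → Δ ⊢ inA a b → Δ ⊢ inA a′ b′
    inA-resp a b a′ b′ p p′ q₁ q₂ h = ∧I u (∧I
      (=ṙ-trans (∧E₁ p′) (S-real _ _ (unit-real u)) (=ṙ-sym q₁)
        (=ṙ-trans (∧E₁ p) (S-real _ _ (unit-real u)) (∧E₁ (∧E₂ h)) (S-cong _ _ _ _ same index)))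
      (=ṙ-trans (∧E₂ p′) (D-real _ _ (unit-real u)) (=ṙ-sym q₂)
        (=ṙ-trans (∧E₂ p) (D-real _ _ (unit-real u)) (∧E₂ (∧E₂ h)) (D-cong _ _ _ _ same index))))
      where
      same : Δ ⊢ M a b =ṙ M a′ b′
      same = M-cong a b a′ b′ q₁ q₂
      u : Δ ⊢ unit (M a′ b′)
      u = unit-resp (M-real a′ b′ (∧E₁ p′) (∧E₂ p′)) same (∧E₁ h)
      index : Δ ⊢ r (Y (M a b)) ≐̇ r (Y (M a′ b′))
      index = r-cong (Y-cong _ _ (∧E₁ h) u same)

    module _ (x : Tm Γ T1) (u : Δ ⊢ unit x) where
      private
        a b : Tm Γ T1
        a = S x (r (Y x))
        b = D x (r (Y x))

      around-real : Δ ⊢ real a ∧̇ real b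
      around-real = ∧I (S-real x _ (unit-real u)) (D-real x _ (unit-real u))

      -- Membership refers to `M a b` and not to `x`. The two are equal as reals by `mid-unique`,
      -- and extensionality of Y then gives the same radius for both.
      around-inA : Δ ⊢ inA a b
      around-inA = ∧I v (∧I (S-cong _ _ _ _ (=ṙ-sym same) index) (D-cong _ _ _ _ (=ṙ-sym same) index))
        where
        same : Δ ⊢ M a b =ṙ x
        same = mid-unique (r (Y x)) a b x (M a b) (S-shift _ _) (D-shift _ _) (M-mid a b)
        v : Δ ⊢ unit (M a b)
        v = unit-resp (M-real a b (∧E₁ around-real) (∧E₂ around-real)) (=ṙ-sym same) u
        index : Δ ⊢ r (Y x) ≐̇ r (Y (M a b))
        index = r-cong (Y-cong _ _ u v (=ṙ-sym same))

      around-< : Δ ⊢ a <ṙ x ∧̇ x <ṙ b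
      around-< = ∧I (shift-< (r (Y x)) a x (S-shift _ _)) (shift-< (r (Y x)) x b (D-shift _ _))

open Functionals

-- The set of intervals: extensional, countable and covering.

module IntervalSet where

  private variable
    Γ : Cxt
    Δ : List (Form Γ)
    σ : Ty

  -- This and the next definitions restate the predicates of the principle in the syntax with atoms;
  -- `heine-borel≡HBC₀` confirms the agreement.
  fun² : Tm Γ T1² → Form Γ
  fun² F = ∀̇ T1 (∀̇ T1 (∀̇ T1 (∀̇ T1
      ((real v3 ∧̇ real v2) ∧̇ (real v1 ∧̇ real v0) ∧̇ (v3 =ṙ v1 ∧̇ v2 =ṙ v0)
        ⇒̇ G · v3 · v2 ≐̇ G · v1 · v0))))
    where G = wk (wk (wk (wk F)))

  subset² : Tm Γ T1² → Form Γ
  subset² F = fun² F ∧̇ ∀̇ T1 (∀̇ T1 (real v1 ∧̇ real v0 ⇒̇ G · v1 · v0 ≐̇ 𝟎 ∨̇ G · v1 · v0 ≐̇ 𝟏))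
    where G = wk (wk F)

  member : Tm Γ T1² → Tm Γ T1 → Tm Γ T1 → Form Γ
  member A a b = real a ∧̇ real b ∧̇ A · a · b ≐̇ 𝟏

  injective² : Tm Γ T1² → Tm Γ T1² → Form Γ
  injective² A Y = ∀̇ T1 (∀̇ T1 (∀̇ T1 (∀̇ T1
        (member B v3 v2 ∧̇ member B v1 v0 ⇒̇ Z · v3 · v2 ≐̇ Z · v1 · v0
          ⇒̇ v3 =ṙ v1 ∧̇ v2 =ṙ v0))))
    where
    B = wk (wk (wk (wk A)))
    Z = wk (wk (wk (wk Y)))

  countable : Tm Γ T1² → Form Γ
  countable A = ∃̇ T1² (fun² v0 ∧̇ injective² (wk A) v0)

  covering : Tm Γ T1² → Form Γ
  covering A = ∀̇ T1 (unit v0 ⇒̇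
    ∃̇ T1 (∃̇ T1 (member (wk (wk (wk A))) v1 v0 ∧̇ v1 <ṙ v2 ∧̇ v2 <ṙ v0)))

  record Setting (Γ : Cxt) (Δ : List (Form Γ)) : Set where
    field
      N : Names Γ
      F : Facts N Δ
      iA : T1² ∈ Γ
      A-spec : Δ ⊢ ∀̇ T1 (∀̇ T1 (((var (there (there iA)) · v1 · v0 ≐̇ 𝟏 ⇒̇ Names.inA (wkN (wkN N)) v1 v0) ∧̇
                                 (Names.inA (wkN (wkN N)) v1 v0 ⇒̇ var (there (there iA)) · v1 · v0 ≐̇ 𝟏)) ∧̇
                                (var (there (there iA)) · v1 · v0 ≐̇ 𝟎 ∨̇ var (there (there iA)) · v1 · v0 ≐̇ 𝟏)))
    open Names N public
    open Intervals F public
    A : Tm Γ T1²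
    A = var iA

  wkS : Setting Γ Δ → Setting (σ ∷ Γ) (map wkn Δ)
  wkS W = record { N = wkN N ; F = wkF F ; iA = there iA ; A-spec = wkD A-spec }
    where
    open Setting W

  upS : {B : Form Γ} → Setting Γ Δ → Setting Γ (B ∷ Δ)
  upS W = record { N = N ; F = upF F ; iA = iA ; A-spec = up A-spec }
    where
    open Setting W

  module TheSet (W : Setting Γ Δ) where
    open Setting W

    A-all : ∀ x z → Δ ⊢ ((A · x · z ≐̇ 𝟏 ⇒̇ inA x z) ∧̇ (inA x z ⇒̇ A · x · z ≐̇ 𝟏)) ∧̇ (A · x · z ≐̇ 𝟎 ∨̇ A · x · z ≐̇ 𝟏)
    A-all = ∀E₂ (((var (there (there iA)) · v1 · v0 ≐̇ 𝟏 ⇒̇ Names.inA (wkN (wkN N)) v1 v0) ∧̇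
                 (Names.inA (wkN (wkN N)) v1 v0 ⇒̇ var (there (there iA)) · v1 · v0 ≐̇ 𝟏)) ∧̇
                (var (there (there iA)) · v1 · v0 ≐̇ 𝟎 ∨̇ var (there (there iA)) · v1 · v0 ≐̇ 𝟏)) A-spec

    A⇒in : ∀ x z → Δ ⊢ A · x · z ≐̇ 𝟏 → Δ ⊢ inA x z
    A⇒in x z = ⇒E (∧E₁ (∧E₁ (A-all x z)))

    in⇒A : ∀ x z → Δ ⊢ inA x z → Δ ⊢ A · x · z ≐̇ 𝟏
    in⇒A x z = ⇒E (∧E₂ (∧E₁ (A-all x z)))

    A-01 : ∀ x z → Δ ⊢ A · x · z ≐̇ 𝟎 ∨̇ A · x · z ≐̇ 𝟏
    A-01 x z = ∧E₂ (A-all x z)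

    member-real : ∀ x z → Δ ⊢ member A x z → Δ ⊢ real x ∧̇ real z
    member-real x z h = ∧I (∧E₁ h) (∧E₁ (∧E₂ h))

    member-in : ∀ x z → Δ ⊢ member A x z → Δ ⊢ inA x z
    member-in x z h = A⇒in x z (∧E₂ (∧E₂ h))

    A-resp : ∀ x z x′ z′ → Δ ⊢ real x ∧̇ real z → Δ ⊢ real x′ ∧̇ real z′ → Δ ⊢ x =ṙ x′ → Δ ⊢ z =ṙ z′ →
             Δ ⊢ A · x · z ≐̇ 𝟏 → Δ ⊢ A · x′ · z′ ≐̇ 𝟏
    A-resp x z x′ z′ p p′ q₁ q₂ h = in⇒A x′ z′ (inA-resp x z x′ z′ p p′ q₁ q₂ (A⇒in x z h))

  module Properties (W : Setting Γ Δ) where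
    open Setting W
    open TheSet W

    A-cong : ∀ x z x′ z′ → Δ ⊢ real x ∧̇ real z → Δ ⊢ real x′ ∧̇ real z′ → Δ ⊢ x =ṙ x′ → Δ ⊢ z =ṙ z′ →
             Δ ⊢ A · x · z ≐̇ A · x′ · z′
    A-cong x z x′ z′ p p′ q₁ q₂ = ∨E (A-01 x z)
      (∨E (up (A-01 x′ z′)) ⟨ ≐-trans h1 (≐-sym h0) ⟩ ⟨ 0≐1 (≐-trans (≐-sym (un back)) h1) ⟩)
      ⟨ ≐-trans h0 (≐-sym (un forth)) ⟩
      where
      forth : A · x · z ≐̇ 𝟏 ∷ Δ ⊢ A · x′ · z′ ≐̇ 𝟏
      forth = TheSet.A-resp (upS W) x z x′ z′ (up p) (up p′) (up q₁) (up q₂) #0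
      back : A · x′ · z′ ≐̇ 𝟏 ∷ A · x · z ≐̇ 𝟎 ∷ Δ ⊢ A · x · z ≐̇ 𝟏
      back = TheSet.A-resp (upS (upS W)) x′ z′ x z (up (up p′)) (up (up p))
        (=ṙ-sym (up (up q₁))) (=ṙ-sym (up (up q₂))) #0

  module _ (W : Setting Γ Δ) where
    open Setting W

    A-subset : Δ ⊢ subset² A
    A-subset = ∧I
      (∀I (∀I (∀I (∀I (⇒I (Properties.A-cong (upS (wkS (wkS (wkS (wkS W))))) v3 v2 v1 v0
        (∧E₁ #0) (∧E₁ (∧E₂ #0)) (∧E₁ (∧E₂ (∧E₂ #0))) (∧E₂ (∧E₂ (∧E₂ #0)))))))))
      (∀I (∀I (⇒I (up (TheSet.A-01 (wkS (wkS W)) v1 v0)))))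

    A-covering : Δ ⊢ covering A
    A-covering = ∀I (⇒I (∃I (V.S v0 (r (V.Y v0))) (∃I (V.D v0 (r (V.Y v0)))
      (∧I (∧I (∧E₁ (V.around-real v0 #0)) (∧I (∧E₂ (V.around-real v0 #0))
        (TheSet.in⇒A V _ _ (V.around-inA v0 #0)))) (V.around-< v0 #0)))))
      where
      V : Setting (T1 ∷ Γ) (unit v0 ∷ map wkn Δ)
      V = upS (wkS W)
      module V = Setting V

  module Counting (W : Setting Γ Δ) (i : T1² ∈ Γ)
    (K-all : ∀ x z → Δ ⊢ var i · x · z ≐̇ Setting.A W · x · z ⊠ Setting.Y W (Setting.M W x z)) where
    open Setting W
    open TheSet W

    K-one : ∀ x z → Δ ⊢ A · x · z ≐̇ 𝟏 → Δ ⊢ var i · x · z ≐̇ Y (M x z)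
    K-one x z p = ⟨ ≐-trans (un (K-all x z)) (≐-trans (⊠-congˡ _ (un p))
      (≐-trans (ax (*-comm _ _)) (ax (*-identity _)))) ⟩

    K-zero : ∀ x z → Δ ⊢ A · x · z ≐̇ 𝟎 → Δ ⊢ var i · x · z ≐̇ 𝟎
    K-zero x z p = ⟨ ≐-trans (un (K-all x z)) (zero-prod _ (un p)) ⟩

    K-injective : ∀ x z x′ z′ → Δ ⊢ member A x z → Δ ⊢ member A x′ z′ → Δ ⊢ var i · x · z ≐̇ var i · x′ · z′ →
                  Δ ⊢ x =ṙ x′ ∧̇ z =ṙ z′
    K-injective x z x′ z′ p p′ q = inA-unique x z x′ z′ (member-real x z p) (member-real x′ z′ p′)
      (member-in x z p) (member-in x′ z′ p′)
      (Y-injective _ _ (∧E₁ (member-in x z p)) (∧E₁ (member-in x′ z′ p′))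
        ⟨ ≐-trans (≐-sym (un (K-one x z (∧E₂ (∧E₂ p))))) (≐-trans (un q) (un (K-one x′ z′ (∧E₂ (∧E₂ p′))))) ⟩)

  module Counting′ (W : Setting Γ Δ) (i : T1² ∈ Γ)
    (K-all : ∀ x z → Δ ⊢ var i · x · z ≐̇ Setting.A W · x · z ⊠ Setting.Y W (Setting.M W x z)) where
    open Setting W
    open TheSet W
    open Properties W

    K-cong : ∀ x z x′ z′ → Δ ⊢ real x ∧̇ real z → Δ ⊢ real x′ ∧̇ real z′ → Δ ⊢ x =ṙ x′ → Δ ⊢ z =ṙ z′ →
             Δ ⊢ var i · x · z ≐̇ var i · x′ · z′
    K-cong x z x′ z′ p p′ q₁ q₂ = ∨E (A-01 x z)
      ⟨ ≐-trans (un (K′.K-zero x z #0)) (≐-sym (un (K′.K-zero x′ z′ same₀))) ⟩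
      ⟨ ≐-trans (un (K″.K-one x z #0)) (≐-trans (un (Setting.Y-cong W″ _ _
          (∧E₁ (TheSet.A⇒in W″ x z #0)) (∧E₁ (TheSet.A⇒in W″ x′ z′ same₁))
          (up (M-cong x z x′ z′ q₁ q₂)))) (≐-sym (un (K″.K-one x′ z′ same₁)))) ⟩
      where
      W′ = upS {B = A · x · z ≐̇ 𝟎} W
      W″ = upS {B = A · x · z ≐̇ 𝟏} W
      module K′ = Counting W′ i (λ x z → up (K-all x z))
      module K″ = Counting W″ i (λ x z → up (K-all x z))
      same : Δ ⊢ A · x · z ≐̇ A · x′ · z′
      same = A-cong x z x′ z′ p p′ q₁ q₂
      same₀ : A · x · z ≐̇ 𝟎 ∷ Δ ⊢ A · x′ · z′ ≐̇ 𝟎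
      same₀ = ⟨ ≐-trans (≐-sym (un (up {B = A · x · z ≐̇ 𝟎} same))) h0 ⟩
      same₁ : A · x · z ≐̇ 𝟏 ∷ Δ ⊢ A · x′ · z′ ≐̇ 𝟏
      same₁ = ⟨ ≐-trans (≐-sym (un (up {B = A · x · z ≐̇ 𝟏} same))) h0 ⟩

  -- The counting map is A(a,b) · Y(M a b). The factor sends every pair outside the set to 0: there
  -- the midpoint may leave [0,1], where Y need not respect equality of reals, while the map must
  -- respect it on the whole plane.
  A-countable : (W : Setting Γ Δ) → Δ ⊢ countable (Setting.A W)
  A-countable {Γ = Γ} {Δ = Δ} W = ∃E (function₂ t) (∃I v0 (∧I
    (∀I (∀I (∀I (∀I (⇒I (Counting′.K-cong (upS (wkS (wkS (wkS (wkS W₁))))) (there (there (there (there (here refl)))))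
      (λ x z → up (K-all₄ x z)) v3 v2 v1 v0
      (∧E₁ #0) (∧E₁ (∧E₂ #0)) (∧E₁ (∧E₂ (∧E₂ #0))) (∧E₂ (∧E₂ (∧E₂ #0)))))))))
    (∀I (∀I (∀I (∀I (⇒I (⇒I (Counting.K-injective (upS (upS (wkS (wkS (wkS (wkS W₁)))))) (there (there (there (there (here refl)))))
      (λ x z → up (up (K-all₄ x z))) v3 v2 v1 v0
      (∧E₁ #1) (∧E₂ #1) #0)))))))))
    where
    open Setting W
    t : Tm (T1 ∷ T1 ∷ Γ) o
    t = var (there (there iA)) · v1 · v0 ⊠ Names.Y (wkN (wkN N)) (Names.M (wkN (wkN N)) v1 v0)
    KF : ∀ {Γ} → T1² ∈ Γ → T1² ∈ Γ → Names Γ → Form (T1 ∷ T1 ∷ Γ)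
    KF i a N = var (there (there i)) · v1 · v0 ≐̇
               var (there (there a)) · v1 · v0 ⊠ Names.Y (wkN (wkN N)) (Names.M (wkN (wkN N)) v1 v0)
    H = ∀̇ T1 (∀̇ T1 (KF (here refl) (there iA) (wkN N))) ∷ map wkn Δ
    W₁ : Setting (T1² ∷ Γ) H
    W₁ = upS (wkS W)
    K-spec : H ⊢ ∀̇ T1 (∀̇ T1 (KF (here refl) (there iA) (wkN N)))
    K-spec = #0
    K-all : ∀ {Γ} {Δ : List (Form Γ)} i a N → Δ ⊢ ∀̇ T1 (∀̇ T1 (KF i a N)) → ∀ x z →
            Δ ⊢ var i · x · z ≐̇ var a · x · z ⊠ Names.Y N (Names.M N x z)
    K-all i a N = ∀E₂ (KF i a N)
    K-all₄ : ∀ x z → map wkn (map wkn (map wkn (map wkn H))) ⊢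
             var (there (there (there (there (here refl))))) · x · z ≐̇
             var (there (there (there (there (there iA))))) · x · z ⊠
             Names.Y (wkN (wkN (wkN (wkN (wkN N))))) (Names.M (wkN (wkN (wkN (wkN (wkN N))))) x z)
    K-all₄ = K-all _ _ (wkN (wkN (wkN (wkN (wkN N))))) (wkD (wkD (wkD (wkD K-spec))))

open IntervalSet

-- Cells that avoid the intervals with small Y-value.

module Sequences where

  open S using (_:=_; _:+_; _:*_)

  private variable
    Γ : Cxt
    Δ : List (Form Γ)
    σ : Ty

  record Sequence (Γ : Cxt) : Set where
    constructor sequence
    field
      N   : Names Γ
      f g : (o ⇾ T1) ∈ Γ
      κ   : o ∈ Γ
    open Names N public
    left right : Tm Γ o → Tm Γ T1
    left i  = var f · i
    right i = var g · i
    centre : Tm Γ o → Tm Γ T1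
    centre i = M (left i) (right i)
    n : Tm Γ o → Tm Γ o
    n i = Y (centre i)
    -- The i-th interval misses [c / 2^j , (c + 1) / 2^j].
    misses : Tm Γ o → Tm Γ o → Tm Γ o → Form Γ
    misses c j i = C (c ⊞ 𝟏) j ≤ṙ left i ∨̇ right i ≤ṙ C c j

  wkQ : Sequence Γ → Sequence (σ ∷ Γ)
  wkQ (sequence N f g κ) = sequence (wkN N) (there f) (there g) (there κ)

  missed : Sequence Γ → (c j m : Tm Γ o) → Form Γ
  missed Q c j m = ∀̇ o (v0 ≼̇ var κ ⇒̇ n v0 ≺̇ wk m ⇒̇ misses (wk c) (wk j) v0)
    where
    open Sequence (wkQ Q)

  -- The induction formula in `m`, with exponent `m ⊞ m` because cells have size 4^-m. Its
  -- quantifiers, those inside `≤ṙ` included, range over numbers; this is what makes the induction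
  -- legitimate.
  stage : Sequence Γ → Tm Γ o → Form Γ
  stage Q m = ∃̇ o (dy (v0 ⊞ 𝟏) (wk m ⊞ wk m) ≤ dy 𝟏 𝟎 ∧̇ missed (wkQ Q) v0 (wk m ⊞ wk m) (wk m))

  members : Sequence Γ → (T1² ∈ Γ) → Form Γ
  members Q a = ∀̇ o (v0 ≼̇ var κ ⇒̇ member (var (there a)) (left v0) (right v0))
    where
    open Sequence (wkQ Q)

  record Finite (Γ : Cxt) (Δ : List (Form Γ)) : Set where
    field
      W   : Setting Γ Δ
      f g : (o ⇾ T1) ∈ Γ
      κ   : o ∈ Γ
    Q : Sequence Γ
    Q = sequence (Setting.N W) f g κ
    field
      mem : Δ ⊢ members Q (Setting.iA W)

  wkΦ : Finite Γ Δ → Finite (σ ∷ Γ) (map wkn Δ)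
  wkΦ Φ = record { W = wkS W ; f = there f ; g = there g ; κ = there κ ; mem = wkD mem }
    where
    open Finite Φ

  upΦ : {B : Form Γ} → Finite Γ Δ → Finite Γ (B ∷ Δ)
  upΦ Φ = record { W = upS W ; f = f ; g = g ; κ = κ ; mem = up mem }
    where
    open Finite Φ

  quadruple : Tm Γ o → Tm Γ o
  quadruple c = c ⊞ c ⊞ (c ⊞ c)

  dy-quadruple : ∀ c m → Δ ⊢ dy (quadruple c) (m ⊞ 𝟏 ⊞ (m ⊞ 𝟏)) ≈ dy c (m ⊞ m)
  dy-quadruple c m = ≈-trans (dy-cong ⟨ ≐-refl _ ⟩
      ⟨ S.solve 1 (λ m → m :+ :1 :+ (m :+ :1) := m :+ m :+ :1 :+ :1) (≐-refl _) m ⟩)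
    (≈-trans (dy-suc _ _) (dy-suc c _))

  module Members (Φ : Finite Γ Δ) where
    open Finite Φ using (W; f; g; κ; mem; Q)
    open Setting W hiding (N; Y; M; S; D; C)
    open Sequence Q using (left; right; centre; n; misses; Y; M; S; D; C)
    open TheSet W

    is-member : ∀ i → Δ ⊢ i ≼̇ var κ → Δ ⊢ member A (left i) (right i)
    is-member i = ⇒E (∀E₁ i)
      where
      ∀E₁ : ∀ i → Δ ⊢ i ≼̇ var κ ⇒̇ member A (left i) (right i)
      ∀E₁ i = ∀E mem i

    in-A : ∀ i → Δ ⊢ i ≼̇ var κ → Δ ⊢ inA (left i) (right i)
    in-A i p = member-in _ _ (is-member i p)

    ends : ∀ i → Δ ⊢ i ≼̇ var κ → Δ ⊢ real (left i) ∧̇ real (right i)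
    ends i p = member-real _ _ (is-member i p)

    C-real : ∀ c j → Δ ⊢ real (C c j)
    C-real c j = const-real c j (C c j) (C-const c j)

    C-≤ : ∀ c i d j → Δ ⊢ dy c i ≤ dy d j → Δ ⊢ C c i ≤ṙ C d j
    C-≤ c i d j = const-≤ c i (C c i) d j (C d j) (C-const c i) (C-const d j)

    -- At level `J` the cell size equals the radius, so an interval with Y-value `m` is two cells
    -- long; hence `c ⊞ 𝟏 ⊞ 𝟏`.
    short : ∀ i m c → Δ ⊢ i ≼̇ var κ → Δ ⊢ n i ≐̇ m →
      let J = m ⊞ 𝟏 ⊞ (m ⊞ 𝟏) in
      Δ ⊢ left i ≤ṙ C c J → Δ ⊢ right i ≤ṙ C (c ⊞ 𝟏 ⊞ 𝟏) J
    short i m c p q h = ≤ṙ-trans (∧E₂ (ends i p)) (C-real _ J) (=ṙ⇒≤ṙ (∧E₂ (∧E₂ (in-A i p))))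
      (const-shift-≤ J′ (S x J′) x (D x J′) c J (C c J) (c ⊞ 𝟏 ⊞ 𝟏) J (C (c ⊞ 𝟏 ⊞ 𝟏) J)
        (S-shift x J′) (D-shift x J′) (C-const _ _) (C-const _ _)
        (≤-trans (⊕-mono (⊕-mono ≤-refl (≈⇒≤ err)) (≈⇒≤ err))
          (≤-trans (⊕-mono (≈⇒≥ (dy-add _ _ _)) ≤-refl) (≈⇒≥ (dy-add _ _ _))))
        (≤ṙ-trans (S-real x J′ (unit-real (∧E₁ (in-A i p)))) (C-real c J)
          (=ṙ⇒≥ṙ (∧E₁ (∧E₂ (in-A i p)))) h))
      where
      J = m ⊞ 𝟏 ⊞ (m ⊞ 𝟏)
      x = centre i
      J′ = r (n i)
      err : Δ ⊢ e J′ ≈ e J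
      err = dy-cong ⟨ ≐-refl 𝟏 ⟩ ⟨ ≐-trans (un (r-cong q))
        (S.solve 1 (λ m → m :+ m :+ :1 :+ :1 := m :+ :1 :+ (m :+ :1)) (≐-refl _) m) ⟩

    same-ends : ∀ i i′ → Δ ⊢ i ≼̇ var κ → Δ ⊢ i′ ≼̇ var κ → Δ ⊢ n i ≐̇ n i′ →
                Δ ⊢ left i =ṙ left i′ ∧̇ right i =ṙ right i′
    same-ends i i′ p p′ q = inA-unique _ _ _ _ (ends i p) (ends i′ p′) (in-A i p) (in-A i′ p′)
      (Y-injective _ _ (∧E₁ (in-A i p)) (∧E₁ (in-A i′ p′)) q)

  module _ (Φ : Finite Γ Δ) where
    open Finite Φ using (κ; Q)
    open Sequence Q using (left; right; n; misses; C)
    open Members Φ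

    misses-mono : ∀ c j c′ j′ i → Δ ⊢ i ≼̇ var κ → Δ ⊢ dy (c′ ⊞ 𝟏) j′ ≤ dy (c ⊞ 𝟏) j → Δ ⊢ dy c j ≤ dy c′ j′ →
                  Δ ⊢ misses c j i → Δ ⊢ misses c′ j′ i
    misses-mono c j c′ j′ i p q q′ h = ∨E h
      (∨I₁ (≤ṙ-trans (up (C-real _ _)) (up (∧E₁ (ends i p))) (up (C-≤ _ _ _ _ q)) #0))
      (∨I₂ (≤ṙ-trans (up (∧E₂ (ends i p))) (up (C-real _ _)) #0 (up (C-≤ _ _ _ _ q′))))

    -- If the left end were at most the dyadic c + 1 of level `J`, the length of two cells would put
    -- the right end at most at c + 3, and the cell c + 3 would be missed after all.
    short-misses : ∀ i m c → Δ ⊢ i ≼̇ var κ → Δ ⊢ n i ≐̇ m →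
      let J = m ⊞ 𝟏 ⊞ (m ⊞ 𝟏) in
      Δ ⊢ ¬̇ misses (c ⊞ (𝟏 ⊞ 𝟏 ⊞ 𝟏)) J i → Δ ⊢ C (c ⊞ 𝟏) J ≤ṙ left i
    short-misses i m c p q h = ∨E (EM (left i ≤ṙ C (c ⊞ 𝟏) J))
      (⊥E (⇒E (up h) (∨I₂ (≤ṙ-trans (up (∧E₂ (ends i p))) (up (C-real _ J))
        (Members.short (upΦ Φ) i m (c ⊞ 𝟏) (up p) (up q) #0)
        (up (C-≤ _ J _ J (dy-mono J ⟨ ∨-intro₂
          (S.solve 1 (λ c → c :+ :1 :+ :1 :+ :1 := c :+ (:1 :+ :1 :+ :1)) (≐-refl _) c) ⟩)))))))
      (<ṙ⇒≤ṙ (up (C-real _ J)) (up (∧E₁ (ends i p))) #0)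
      where
      J = m ⊞ 𝟏 ⊞ (m ⊞ 𝟏)

  module Quarters {Γ} (c m : Tm Γ o) where
    -- The outer quarters of cell c at level 2m are the cells 4c and 4c + 3 at level 2(m + 1).
    lo hi J : Tm Γ o
    lo = quadruple c
    hi = lo ⊞ (𝟏 ⊞ 𝟏 ⊞ 𝟏)
    J = m ⊞ 𝟏 ⊞ (m ⊞ 𝟏)

    lo-end : {Δ : List (Form Γ)} → Δ ⊢ dy (lo ⊞ 𝟏) J ≤ dy (c ⊞ 𝟏) (m ⊞ m)
    lo-end = ≤-trans (dy-mono J ⟨ ≼-resp (≐-refl _)
        (S.solve 1 (λ c → c :+ c :+ (c :+ c) :+ :1 :+ (:1 :+ :1 :+ :1)
                       := c :+ :1 :+ (c :+ :1) :+ (c :+ :1 :+ (c :+ :1))) (≐-refl _) c)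
        (m≼m+n _ (𝟏 ⊞ 𝟏 ⊞ 𝟏)) ⟩)
      (≈⇒≤ (dy-quadruple (c ⊞ 𝟏) m))

    hi-end : {Δ : List (Form Γ)} → Δ ⊢ dy (hi ⊞ 𝟏) J ≤ dy (c ⊞ 𝟏) (m ⊞ m)
    hi-end = ≤-trans (dy-mono J ⟨ ∨-intro₂
        (S.solve 1 (λ c → c :+ c :+ (c :+ c) :+ (:1 :+ :1 :+ :1) :+ :1
                       := c :+ :1 :+ (c :+ :1) :+ (c :+ :1 :+ (c :+ :1))) (≐-refl _) c) ⟩)
      (≈⇒≤ (dy-quadruple (c ⊞ 𝟏) m))

    lo-start : {Δ : List (Form Γ)} → Δ ⊢ dy c (m ⊞ m) ≤ dy lo J
    lo-start = ≈⇒≥ (dy-quadruple c m)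

    hi-start : {Δ : List (Form Γ)} → Δ ⊢ dy c (m ⊞ m) ≤ dy hi J
    hi-start = ≤-trans lo-start (dy-mono J ⟨ m≼m+n _ _ ⟩)

  module _ (Φ : Finite Γ Δ) (c m : Tm Γ o) where
    open Finite Φ using (Q; κ)
    open Sequence Q using (n; misses)
    open Quarters c m

    -- Intervals with the same Y-value coincide, so if the right quarter fails for one of
    -- them then the left quarter works for all.
    left-quarter : (∀ i → Δ ⊢ i ≼̇ var κ ⇒̇ n i ≺̇ m ⇒̇ misses c (m ⊞ m) i) → ∀ i i′ →
      Δ ⊢ i ≼̇ var κ → Δ ⊢ n i ≺̇ m ⊞ 𝟏 → Δ ⊢ ¬̇ misses hi J i →
      Δ ⊢ i′ ≼̇ var κ → Δ ⊢ n i′ ≺̇ m ⊞ 𝟏 → Δ ⊢ misses lo J i′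
    left-quarter old i i′ p q h p′ q′ =
      ∨E (below q′)
        (misses-mono (upΦ Φ) c (m ⊞ m) lo J i′ (up p′) lo-end lo-start (⇒E (⇒E (up (old i′)) (up p′)) #0))
        -- Now `i′` has Y-value `m`. A smaller value of `i` is excluded, as `i` would then miss the
        -- whole old cell and its right quarter too.
        (∨E (up (below q))
          (⊥E (⇒E (up (up h)) (misses-mono (upΦ (upΦ Φ)) c (m ⊞ m) hi J i (up (up p)) hi-end hi-start
            (⇒E (⇒E (up (up (old i))) (up (up p))) #0))))
          (∨I₁ (≤ṙ-trans (up (up (Members.C-real Φ _ _))) (up (up (∧E₁ (Members.ends Φ i′ p′))))
            (short-misses Ψ i m lo (up (up p)) #0 (up (up h)))
            (=ṙ⇒≤ṙ (∧E₁ (Members.same-ends Ψ i i′ (up (up p)) (up (up p′)) ⟨ ≐-trans h0 (≐-sym h1) ⟩))))))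
      where
      Ψ : Finite Γ (n i ≐̇ m ∷ n i′ ≐̇ m ∷ Δ)
      Ψ = upΦ (upΦ Φ)
      below : ∀ {s} → Δ ⊢ s ≺̇ m ⊞ 𝟏 → Δ ⊢ s ≺̇ m ∨̇ s ≐̇ m
      below p = ⟨ m≺n+1⇒m≼n (un p) ⟩

open Sequences

-- The induction on Y-values and the uncovered point.

module Diagonal where

  private variable
    Γ : Cxt
    Δ : List (Form Γ)

  -- The quarter is chosen by excluded middle. When the left one fails, the right one must be missed
  -- by each index separately, for an index hitting it would make the left one succeed by
  -- `left-quarter`.
  stage-suc : (Φ : Finite Γ Δ) (c m : o ∈ Γ) →
    Δ ⊢ dy (var c ⊞ 𝟏) (var m ⊞ var m) ≤ dy 𝟏 𝟎 →
    Δ ⊢ missed (Finite.Q Φ) (var c) (var m ⊞ var m) (var m) → Δ ⊢ stage (Finite.Q Φ) (var m ⊞ 𝟏)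
  stage-suc {Γ = Γ} {Δ = Δ} Φ c m bound old = ∨E (EM L)
    (∃I lo (∧I (up (≤-trans lo-end bound)) #0))
    (∃I hi (∧I (up (≤-trans hi-end bound)) (∀I (⇒I (⇒I (RAA (⇒E #3 (∀I (⇒I (⇒I left-half))))))))))
    where
    open Finite Φ using (Q)
    open Quarters (var c) (var m)
    L : Form Γ
    L = missed Q lo J (var m ⊞ 𝟏)
    small : ∀ {Γ} → Sequence Γ → o ∈ Γ → Tm Γ o → Form Γ
    small Q m i = Sequence.n Q i ≺̇ var m ⊞ 𝟏
    H : List (Form (o ∷ Γ))
    H = ¬̇ Sequence.misses (wkQ Q) (wk hi) (wk J) v0 ∷ small (wkQ Q) (there m) v0 ∷
        v0 ≼̇ var (Sequence.κ (wkQ Q)) ∷ ¬̇ missed (wkQ Q) (wk lo) (wk J) (wk (var m ⊞ 𝟏)) ∷ map wkn Δ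
    Φ₁ : Finite (o ∷ Γ) H
    Φ₁ = upΦ (upΦ (upΦ (upΦ (wkΦ Φ))))
    H₂ : List (Form (o ∷ o ∷ Γ))
    H₂ = small (wkQ (wkQ Q)) (there (there m)) v0 ∷ v0 ≼̇ var (Sequence.κ (wkQ (wkQ Q))) ∷ map wkn H
    Φ₂ : Finite (o ∷ o ∷ Γ) H₂
    Φ₂ = upΦ (upΦ (wkΦ Φ₁))
    old₁ : H ⊢ missed (wkQ Q) (wk (var c)) (wk (var m ⊞ var m)) (wk (var m))
    old₁ = up (up (up (up (wkD old))))
    old₂ : H₂ ⊢ missed (wkQ (wkQ Q)) (wk (wk (var c))) (wk (wk (var m ⊞ var m))) (wk (wk (var m)))
    old₂ = up (up (wkD old₁))
    left-half : H₂ ⊢ Sequence.misses (wkQ (wkQ Q)) (wk (wk lo)) (wk (wk J)) v0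
    left-half = left-quarter Φ₂ (var (there (there c))) (var (there (there m))) (∀E old₂) v1 v0 #4 #3 #2 #1 #0

  stages : (Φ : Finite Γ Δ) → map wkn Δ ⊢ stage (wkQ (Finite.Q Φ)) v0
  stages {Γ = Γ} {Δ = Δ} Φ = arithInd iE (stage (wkQ Q) v0) (arith (stage (wkQ Q) v0)) E-spec
    -- The initial cell is [0,1] itself, and no Y-value lies below 0.
    (∃I 𝟎 (∧I (≤-trans (≈⇒≤ (dy-cong ⟨ ⊞-identityˡ 𝟏 ⟩ ⟨ ⊞-identityˡ 𝟎 ⟩)) ≤-refl)
      (∀I (⇒I (⇒I ⟨ ≺-irr (≺-≼-trans h0 (0≼ _)) ⟩)))))
    (∃E #0 (stage-suc (upΦ (wkΦ Ψ)) (here refl) (there (here refl)) (∧E₁ #0) (∧E₂ #0)))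
    where
    open Finite Φ using (Q; W)
    open Setting W using (iE; F)
    open Facts F using (E-spec)
    Ψ : Finite (o ∷ Γ) (stage (wkQ Q) v0 ∷ map wkn Δ)
    Ψ = upΦ (wkΦ Φ)

  n-cong : (Φ : Finite Γ Δ) → ∀ {s t} → Δ ⊢ s ≐̇ t →
           Δ ⊢ Sequence.n (Finite.Q Φ) s ≐̇ Sequence.n (Finite.Q Φ) t
  n-cong Φ ⟨ p ⟩ = ⟨ eq-arg _ (eq-· (eq-arg _ (eq-arg _ p)) (eq-arg _ p)) ⟩

  bounded : Sequence Γ → Tm Γ o → Form Γ
  bounded Q k = ∃̇ o (∀̇ o (v0 ≼̇ wk (wk k) ⇒̇ Sequence.n (wkQ (wkQ Q)) v0 ≺̇ v1))

  -- Collection for the finitely many Y-values. The induction formula has the form ∃∀, so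
  -- arithmetical induction is needed here as well.
  bounds : (Φ : Finite Γ Δ) → map wkn Δ ⊢ bounded (wkQ (Finite.Q Φ)) v0
  bounds {Γ = Γ} {Δ = Δ} Φ = arithInd iE (bounded (wkQ Q) v0) (arith (bounded (wkQ Q) v0)) E-spec
    (∃I (n 𝟎 ⊞ 𝟏) (∀I (⇒I base)))
    -- The old bound plus the new value plus one serves in place of a maximum.
    (∃E #0 (∃I (v0 ⊞ (Sequence.n (wkQ (wkQ Q)) (v1 ⊞ 𝟏) ⊞ 𝟏)) (∀I (⇒I step))))
    where
    open Finite Φ using (Q; W)
    open Setting W using (iE; F)
    open Facts F using (E-spec)
    open Sequence Q using (n)
    base : v0 ≼̇ 𝟎 ∷ map wkn Δ ⊢ Sequence.n (wkQ Q) v0 ≺̇ Sequence.n (wkQ Q) 𝟎 ⊞ 𝟏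
    base = ⟨ ≺-resp (≐-sym (un (n-cong (upΦ {B = v0 ≼̇ 𝟎} (wkΦ Φ)) ⟨ ≼-antisym h0 (0≼ v0) ⟩))) (≐-refl _) (n≺n+1 _) ⟩
    Q₃ : Sequence (o ∷ o ∷ o ∷ Γ)
    Q₃ = wkQ (wkQ (wkQ Q))
    H : List (Form (o ∷ o ∷ Γ))
    H = ∀̇ o (v0 ≼̇ v2 ⇒̇ Sequence.n Q₃ v0 ≺̇ v1) ∷ bounded (wkQ (wkQ Q)) v1 ∷ map wkn (map wkn Δ)
    Ψ₁ : Finite (o ∷ Γ) (bounded (wkQ Q) v0 ∷ map wkn Δ)
    Ψ₁ = upΦ (wkΦ Φ)
    Ψ : Finite (o ∷ o ∷ Γ) H
    Ψ = upΦ (wkΦ Ψ₁)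
    i′ : Tm (o ∷ o ∷ o ∷ Γ) o
    i′ = Sequence.n Q₃ (v2 ⊞ 𝟏)
    step : v0 ≼̇ v2 ⊞ 𝟏 ∷ map wkn H ⊢ Sequence.n Q₃ v0 ≺̇ v1 ⊞ (i′ ⊞ 𝟏)
    step = ∨E #0
      ⟨ ≺-≼-trans (un (⇒E (earlier v0) earlier-index)) (m≼m+n _ _) ⟩
      ⟨ ≺-≼-trans
          (≺-resp (≐-sym (un (n-cong (upΦ {B = v0 ≐̇ v2 ⊞ 𝟏} (upΦ {B = v0 ≼̇ v2 ⊞ 𝟏} (wkΦ Ψ))) #0)))
            (≐-refl _) (n≺n+1 i′))
          (≼-resp (≐-refl _) (ax (+-comm _ _)) (m≼m+n _ _)) ⟩
      where
      earlier-index : v0 ≺̇ v2 ⊞ 𝟏 ∷ v0 ≼̇ v2 ⊞ 𝟏 ∷ map wkn H ⊢ v0 ≼̇ v2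
      earlier-index = ⟨ m≺n+1⇒m≼n h0 ⟩
      earlier : ∀ {B} i → B ∷ v0 ≼̇ v2 ⊞ 𝟏 ∷ map wkn H ⊢ i ≼̇ v2 ⇒̇ Sequence.n Q₃ i ≺̇ v1
      earlier i = ∀E #2 i

  covers : Sequence Γ → Form Γ
  covers Q = ∀̇ T1 (unit v0 ⇒̇ ∃̇ o (v0 ≼̇ var κ ∧̇ left v0 <ṙ v1 ∧̇ v1 <ṙ right v0))
    where
    open Sequence (wkQ (wkQ Q))

  missed-point : (Φ : Finite Γ Δ) (c m : o ∈ Γ) →
    Δ ⊢ dy (var c ⊞ 𝟏) (var m ⊞ var m) ≤ dy 𝟏 𝟎 →
    Δ ⊢ missed (Finite.Q Φ) (var c) (var m ⊞ var m) (var m) →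
    Δ ⊢ ∀̇ o (v0 ≼̇ var (there (Finite.κ Φ)) ⇒̇ Sequence.n (wkQ (Finite.Q Φ)) v0 ≺̇ var (there m)) →
    Δ ⊢ covers (Finite.Q Φ) → Δ ⊢ ⊥̇
  missed-point {Γ = Γ} {Δ = Δ} Φ c m top miss below cov =
    ∃E (⇒E (∀E cov z) z-unit) (∨E (⇒E (⇒E (up (∀E (wkD miss) v0)) (∧E₁ #0))
                                            (⇒E (up (∀E (wkD below) v0)) (∧E₁ #0)))
      -- If the interval lies to the right of the cell, its left end is at least the right end of
      -- the cell and so at least `z`, against left end < `z`. In the other case its right end is at
      -- most `z` directly.
      (⇒E (∧E₁ (∧E₂ #1)) (≤ṙ-trans (Members.C-real Ψ _ _) (∧E₁ (Members.ends Ψ v0 (∧E₁ #1)))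
        (Members.C-≤ Ψ _ _ _ _ (dy-mono _ ⟨ n≼n+1 _ ⟩)) #0))
      (⇒E (∧E₂ (∧E₂ #1)) #0))
    where
    open Finite Φ using (Q; κ; W)
    open Sequence Q using (C; left; right)
    open Members Φ using (C-real; C-≤)
    open Intervals (Setting.F W) using (C-const)
    j z : _
    j = var m ⊞ var m
    z = C (var c) j
    z-unit : Δ ⊢ unit z
    z-unit = unit-intro (C-real _ _)
      (const-≤ 𝟎 𝟎 0ℝ (var c) j z const-0 (C-const _ _)
        (≤-trans (dy-nonneg (var c) j (dy 𝟎 𝟎)) (≈⇒≤ (⊕-identityʳ 𝟎 _))))
      (const-≤ (var c) j z 𝟏 𝟎 1ℝ (C-const _ _) const-1 (≤-trans (dy-mono j ⟨ n≼n+1 _ ⟩) top))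
    Ψ = upΦ (upΦ (wkΦ Φ))

  no-finite-subcover : (Φ : Finite Γ Δ) → Δ ⊢ covers (Finite.Q Φ) → Δ ⊢ ⊥̇
  no-finite-subcover {Γ = Γ} {Δ = Δ} Φ cov = ∃E bounded-κ (∃E {Δ = H} (up (stages Φ))
    (missed-point (upΦ (wkΦ Ψ)) (here refl) (there (here refl)) (∧E₁ #0) (∧E₂ #0) below cov′))
    where
    open Finite Φ using (κ; Q)
    bounded-κ : Δ ⊢ bounded Q (var κ)
    bounded-κ = ∀E (∀I (bounds Φ)) (var κ)
    H : List (Form (o ∷ Γ))
    H = ∀̇ o (v0 ≼̇ var (there (there κ)) ⇒̇ Sequence.n (wkQ (wkQ Q)) v0 ≺̇ v1) ∷ map wkn Δ
    Ψ : Finite (o ∷ Γ) H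
    Ψ = upΦ (wkΦ Φ)
    S₀ : Form (o ∷ o ∷ Γ)
    S₀ = dy (v0 ⊞ 𝟏) (v1 ⊞ v1) ≤ dy 𝟏 𝟎 ∧̇ missed (wkQ (wkQ Q)) v0 (v1 ⊞ v1) v1
    below : S₀ ∷ map wkn H ⊢ ∀̇ o (v0 ≼̇ var (there (there (there κ))) ⇒̇ Sequence.n (wkQ (wkQ (wkQ Q))) v0 ≺̇ v2)
    below = #1
    cov′ : S₀ ∷ map wkn H ⊢ covers (wkQ (wkQ Q))
    cov′ = up (wkD cov₁)
      where
      cov₁ : H ⊢ covers (wkQ Q)
      cov₁ = up (wkD cov)

open Diagonal

-- Existence of the functionals and the final contradiction.

private variable
  Γ : Cxt
  Δ : List (Form Γ)
  A : Form Γ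

midpoints : [] ⊢ ∃̇ {Γ = []} (T1 ⇾ T1 ⇾ T1) (∀̇ T1 (∀̇ T1 (mid v1 v0 (v2 · v1 · v0))))
midpoints = ∃E (sequence₂ (half (v2 at v0 ⊕ v1 at v0))) (∃I v0 (∀I (∀I (∀I
  (≈-trans (⊕-cong value value) (half-double _))))))
  where
  A₀ : Form (o ∷ T1 ∷ T1 ∷ (T1 ⇾ T1 ⇾ T1) ∷ [])
  A₀ = (v3 · v2 · v1) at v0 ≈ half (v2 at v0 ⊕ v1 at v0)
  value : map wkn (map wkn (map wkn (∀̇ T1 (∀̇ T1 (∀̇ o A₀)) ∷ []))) ⊢ A₀
  value = specialise (specialise (specialise (#0 {A = ∀̇ T1 (∀̇ T1 (∀̇ o A₀))} {Δ = []})))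

left-translates : [] ⊢ ∃̇ {Γ = []} (T1 ⇾ o ⇾ T1) (∀̇ T1 (∀̇ o (shift v0 (v2 · v1 · v0) v1)))
left-translates = ∃E (sequence₂ (v2 at v0 ⊖ e v1)) (∃I v0 (∀I (∀I (∀I
  (≈-trans (≈-sym (⊖-⊕ _ (e v1))) (⊕-cong (≈-sym value) ≈-refl))))))
  where
  A₀ : Form (o ∷ o ∷ T1 ∷ (T1 ⇾ o ⇾ T1) ∷ [])
  A₀ = (v3 · v2 · v1) at v0 ≈ v2 at v0 ⊖ e v1
  value : map wkn (map wkn (map wkn (∀̇ T1 (∀̇ o (∀̇ o A₀)) ∷ []))) ⊢ A₀
  value = specialise (specialise (specialise (#0 {A = ∀̇ T1 (∀̇ o (∀̇ o A₀))} {Δ = []})))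

right-translates : [] ⊢ ∃̇ {Γ = []} (T1 ⇾ o ⇾ T1) (∀̇ T1 (∀̇ o (shift v0 v1 (v2 · v1 · v0))))
right-translates = ∃E (sequence₂ (v2 at v0 ⊕ e v1)) (∃I v0 #0)

dyadics : [] ⊢ ∃̇ {Γ = []} (o ⇾ o ⇾ T1) (∀̇ o (∀̇ o (const v1 v0 (v2 · v1 · v0))))
dyadics = ∃E (sequence₂ (dy v2 v1)) (∃I v0 #0)

finite : Tm Γ T1² → Form Γ
finite A = ∃̇ o (∃̇ (o ⇾ T1) (∃̇ (o ⇾ T1) (
    ∀̇ o (v0 ≼̇ v3 ⇒̇ member (wk (wk (wk (wk A)))) (v2 · v0) (v1 · v0))
  ∧̇ ∀̇ T1 (unit v0 ⇒̇
      ∃̇ o (v0 ≼̇ wk v3 ∧̇ v3 · v0 <ṙ v1 ∧̇ v1 <ṙ v2 · v0)))))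

heine-borel : Form Γ
heine-borel = ∀̇ T1² (subset² v0 ∧̇ countable v0 ∧̇ covering v0 ⇒̇ finite v0)

not-injective : Form []
not-injective = ∀̇ (T1 ⇾ o) (fun01 v0 ⇒̇
  ∃̇ T1 (∃̇ T1 (unit v1 ∧̇ unit v0 ∧̇ ¬̇ (v1 =ṙ v0) ∧̇ v2 · v1 ≐̇ v2 · v0)))

opaque
  unfolding fst′

  -- With the projections unfolded, the copies with atoms translate into literally the formulas of
  -- the statement, so reflexivity suffices.
  heine-borel≡HBC₀ : ⌊ heine-borel ⌋ ≡ HBC₀
  heine-borel≡HBC₀ = refl

  not-injective≡NIN : ⌊ not-injective ⌋ ≡ NIN
  not-injective≡NIN = refl

-- Every functional enters through `∃E` and is thus a variable when the set is formed. Kleene's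
-- quantifier has to be present before the comprehension, because `inA` contains `unit` and `=ṙ`.
no-injection : heine-borel ∷ fun01 v0 ∷ inj01 v0 ∷ [] ⊢ ⊥̇ {(T1 ⇾ o) ∷ []}
no-injection =
  ∃E (instantiate var Kleene-exists (#1 ∷ #2 ∷ []))
  (∃E {Δ = H₁} (instantiate nil midpoints [])
  (∃E {Δ = H₂} (instantiate nil left-translates [])
  (∃E {Δ = H₃} (instantiate nil right-translates [])
  (∃E {Δ = H₄} (instantiate nil dyadics [])
  (∃E {Δ = H₅} (comprehension (Names.iE N) in-A (arith in-A) (Facts.E-spec F))
  (∃E {Δ = H₆} (⇒E heine-borel₆ (∧I (A-subset W) (∧I (A-countable W) (A-covering W))))
  (∃E {Δ = H₇} #0 (∃E {Δ = H₈} #0 (no-finite-subcover Φ (∧E₂ #0))))))))))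
  where
  Ψ : Cxt
  Ψ = (o ⇾ o ⇾ T1) ∷ (T1 ⇾ o ⇾ T1) ∷ (T1 ⇾ o ⇾ T1) ∷ (T1 ⇾ T1 ⇾ T1) ∷ (T1 ⇾ o) ∷ (T1 ⇾ o) ∷ []
  N : Names Ψ
  N = names (there (there (there (there (there (here refl)))))) (there (there (there (there (here refl)))))
    (there (there (there (here refl)))) (there (there (here refl))) (there (here refl)) (here refl)
  H₁ : List (Form _)
  H₁ = Kleene (here refl) ∷ heine-borel ∷ fun01 v1 ∷ inj01 v1 ∷ []
  H₂ : List (Form _)
  H₂ = ∀̇ T1 (∀̇ T1 (mid v1 v0 (v2 · v1 · v0))) ∷ map wkn H₁
  H₃ : List (Form _)
  H₃ = ∀̇ T1 (∀̇ o (shift v0 (v2 · v1 · v0) v1)) ∷ map wkn H₂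
  H₄ : List (Form _)
  H₄ = ∀̇ T1 (∀̇ o (shift v0 v1 (v2 · v1 · v0))) ∷ map wkn H₃
  H₅ : List (Form Ψ)
  H₅ = ∀̇ o (∀̇ o (const v1 v0 (v2 · v1 · v0))) ∷ map wkn H₄
  F : Facts N H₅
  F = record { Y-fun = up (up #4) ; Y-inj = up (up (up #4)) ; E-spec = #4 ; M-spec = #3
             ; S-spec = #2 ; D-spec = #1 ; C-spec = #0 }
  in-A : Form (T1 ∷ T1 ∷ Ψ)
  in-A = Names.inA (wkN (wkN N)) v1 v0
  H₆ : List (Form (T1² ∷ Ψ))
  H₆ = ∀̇ T1 (∀̇ T1 (((v2 · v1 · v0 ≐̇ 𝟏 ⇒̇ Names.inA (wkN (wkN (wkN N))) v1 v0) ∧̇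
                     (Names.inA (wkN (wkN (wkN N))) v1 v0 ⇒̇ v2 · v1 · v0 ≐̇ 𝟏))
                    ∧̇ (v2 · v1 · v0 ≐̇ 𝟎 ∨̇ v2 · v1 · v0 ≐̇ 𝟏))) ∷ map wkn H₅
  W : Setting (T1² ∷ Ψ) H₆
  W = record { N = wkN N ; F = upF (wkF F) ; iA = here refl ; A-spec = #0 }
  heine-borel₆ : H₆ ⊢ subset² v0 ∧̇ countable v0 ∧̇ covering v0 ⇒̇ finite v0
  heine-borel₆ = ∀E (up (up #4)) v0
  B₃ : Form ((o ⇾ T1) ∷ (o ⇾ T1) ∷ o ∷ T1² ∷ Ψ)
  B₃ = ∀̇ o (v0 ≼̇ v3 ⇒̇ member (wk v3) (v2 · v0) (v1 · v0)) ∧̇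
       ∀̇ T1 (unit v0 ⇒̇ ∃̇ o (v0 ≼̇ wk v3 ∧̇ v3 · v0 <ṙ v1 ∧̇ v1 <ṙ v2 · v0))
  H₇ : List (Form (o ∷ T1² ∷ Ψ))
  H₇ = ∃̇ (o ⇾ T1) (∃̇ (o ⇾ T1) B₃) ∷ map wkn H₆
  H₈ : List (Form ((o ⇾ T1) ∷ o ∷ T1² ∷ Ψ))
  H₈ = ∃̇ (o ⇾ T1) B₃ ∷ map wkn H₇
  W₇ : Setting _ H₇
  W₇ = upS (wkS W)
  W₈ : Setting _ H₈
  W₈ = upS (wkS W₇)
  Φ : Finite ((o ⇾ T1) ∷ (o ⇾ T1) ∷ o ∷ T1² ∷ Ψ) (B₃ ∷ map wkn H₈)
  Φ = record { W = upS (wkS W₈) ; f = there (here refl) ; g = here refl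
             ; κ = there (there (here refl)) ; mem = ∧E₁ #0 }

corollary : [] ⊢ heine-borel ⇒̇ not-injective
corollary = ⇒I (∀I (⇒I (RAA (⇒E (⇒E (⇒E (up (up (up (⇒I (⇒I (⇒I no-injection)))))) inj) #1) #2))))
  where
  E₀ : Form ((T1 ⇾ o) ∷ [])
  E₀ = ∃̇ T1 (∃̇ T1 (unit v1 ∧̇ unit v0 ∧̇ ¬̇ (v1 =ṙ v0) ∧̇ v2 · v1 ≐̇ v2 · v0))
  -- Two points with equal values that were not `=ṙ` would be the witnesses that `¬̇ E₀` denies.
  inj : ¬̇ E₀ ∷ fun01 v0 ∷ heine-borel ∷ [] ⊢ inj01 v0
  inj = ∀I (∀I (⇒I (RAA (⇒E #2 (∃I v1 (∃I v0 (∧I (∧E₁ #1) (∧I (∧E₁ (∧E₂ #1)) (∧I #0 (∧E₂ (∧E₂ #1)))))))))))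

corollary3p22 : RCA₀ω⊢ (HBC₀ ⇒ NIN)
corollary3p22 = cast (cong₂ _⇒_ heine-borel≡HBC₀ not-injective≡NIN) (un corollary)
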